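{- Let $\varepsilon>0$ and let $F$ be a graph on $r$ vertices with $t$ edges. If $\delta_F\geq 1/2$ or $F$ has a bridge, then let $\delta^T_F=\delta_F$, and otherwise let $\delta^T_F=1/2$. Then there is some $n_0$ such that the following holds for all $n\geq n_0$. Suppose $\mathfrak{G}$ is a graph collection on $[rn]$ with $|\mathfrak{G}|=tn$ and $\delta(\mathfrak{G})\geq (\delta^T_F+\varepsilon)rn$. Then $\mathfrak{G}$ contains a transversal which is an $F$-factor.
   Context: A graph collection on a set $V$ is a finite sequence $\mathfrak{G}=(G_1,\ldots,G_m)$ of (not necessarily distinct) graphs, each with vertex set $V$; $|\mathfrak{G}|=m$ and $\delta(\mathfrak{G})=\min_{i}\delta(G_i)$. An $m$-edge graph $H$ on $V$ is a $\mathfrak{G}$-transversal (a transversal of $\mathfrak{G}$) if there is an injection $\phi:E(H)\to[m]$ with $e\in E(G_{\phi(e)})$ for all $e\in E(H)$. An $F$-factor of a vertex set is a graph consisting of vertex-disjoint copies of $F$ covering all vertices. For a graph $F$, $\delta_F$ is the smallest real number $\delta$ such that for each $\varepsilon>0$ there is $n_0$ such that for every $n\geq n_0$ with $|F|$ dividing $n$, every $n$-vertex graph with minimum degree at least $(\delta+\varepsilon)n$ contains an $F$-factor. -}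

module Defs where

open import Data.Nat using (ℕ; zero; suc; _+_; _*_; _≥_; _<_)
open import Data.Nat.Divisibility using (_∣_)
open import Data.Fin using (Fin; toℕ)
import Data.Fin as Fin
open import Data.Bool using (Bool; true; false; if_then_else_; _∧_; not)
open import Data.Product using (Σ; ∃; ∃-syntax; _×_; _,_; proj₁)
open import Data.Sum using (_⊎_)
open import Data.Empty using (⊥)
open import Relation.Nullary using (¬_)
open import Relation.Binary.PropositionalEquality using (_≡_)
open import Data.Integer using (+_)
open import Data.Rational using (ℚ; _/_; _≤_; _<_; _+_; _*_; 0ℚ; ½)

record Graph (n : ℕ) : Set where
  field
    adj   : Fin n → Fin n → Bool
    sym   : ∀ u v → adj u v ≡ adj v u
    irrfl : ∀ u → adj u u ≡ false
open Graph public

sumFin : {n : ℕ} → (Fin n → ℕ) → ℕ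
sumFin {zero}  f = 0
sumFin {suc n} f = f Fin.zero Data.Nat.+ sumFin (λ i → f (Fin.suc i))

count : {n : ℕ} → (Fin n → Bool) → ℕ
count f = sumFin (λ i → if f i then 1 else 0)

deg : {n : ℕ} → Graph n → Fin n → ℕ
deg G v = count (adj G v)

Edge : {n : ℕ} → Graph n → Set
Edge {n} G = Σ (Fin n × Fin n) λ p →
  (toℕ (proj₁ p) Data.Nat.< toℕ (Data.Product.proj₂ p)) ×
  (adj G (proj₁ p) (Data.Product.proj₂ p) ≡ true)

edgeCount : {n : ℕ} → Graph n → ℕ
edgeCount G = sumFin (λ u → count (λ v → (toℕ u Data.Nat.<ᵇ toℕ v) ∧ adj G u v))

ℕ→ℚ : ℕ → ℚ
ℕ→ℚ k = (+ k) / 1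

MinDegAtLeast : {n : ℕ} → Graph n → ℚ → Set
MinDegAtLeast G x = ∀ v → x ≤ ℕ→ℚ (deg G v)

IsFactor : {r m : ℕ} → Graph r → Graph m → Set
IsFactor {r} {m} F H =
  Σ ℕ λ k → Σ (Fin k → Fin r → Fin m) λ φ →
    (∀ i a j b → φ i a ≡ φ j b → (i ≡ j) × (a ≡ b)) ×
    (∀ u → ∃[ i ] ∃[ a ] (φ i a ≡ u)) ×
    (∀ u v → adj H u v ≡ true →
       ∃[ i ] ∃[ a ] ∃[ b ] ((φ i a ≡ u) × (φ i b ≡ v) × (adj F a b ≡ true))) ×
    (∀ i a b → adj F a b ≡ true → adj H (φ i a) (φ i b) ≡ true)

Collection : ℕ → ℕ → Set
Collection m N = Fin m → Graph N

IsTransversal : {m N : ℕ} → Collection m N → Graph N → Set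
IsTransversal {m} 𝔊 H =
  (edgeCount H ≡ m) ×
  Σ (Edge H → Fin m) λ φ →
    (∀ e e' → φ e ≡ φ e' → proj₁ e ≡ proj₁ e') ×
    (∀ e → adj (𝔊 (φ e)) (proj₁ (proj₁ e)) (Data.Product.proj₂ (proj₁ e)) ≡ true)

deleteEdge : {n : ℕ} → Graph n → Fin n → Fin n → Graph n
deleteEdge {n} G x y = record
  { adj   = λ u v → adj G u v ∧ not (isXY u v)
  ; sym   = λ u v → symProof u v
  ; irrfl = λ u → irrProof u }
  where
  open import Data.Fin using (_≟_)
  open import Relation.Nullary.Decidable using (⌊_⌋)
  open import Relation.Binary.PropositionalEquality using (cong₂; refl)
  import Data.Bool.Properties as BP
  isXY : Fin n → Fin n → Bool
  isXY u v = (⌊ u ≟ x ⌋ ∧ ⌊ v ≟ y ⌋) Data.Bool.∨ (⌊ u ≟ y ⌋ ∧ ⌊ v ≟ x ⌋)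
  isXY-sym : ∀ u v → isXY u v ≡ isXY v u
  isXY-sym u v = Relation.Binary.PropositionalEquality.trans
    (BP.∨-comm (⌊ u ≟ x ⌋ ∧ ⌊ v ≟ y ⌋) (⌊ u ≟ y ⌋ ∧ ⌊ v ≟ x ⌋))
      (cong₂ Data.Bool._∨_ (BP.∧-comm (⌊ u ≟ y ⌋) (⌊ v ≟ x ⌋))
                          (BP.∧-comm (⌊ u ≟ x ⌋) (⌊ v ≟ y ⌋)))
  symProof : ∀ u v → (adj G u v ∧ not (isXY u v)) ≡ (adj G v u ∧ not (isXY v u))
  symProof u v = cong₂ (λ a b → a ∧ not b) (sym G u v) (isXY-sym u v)
  irrProof : ∀ u → (adj G u u ∧ not (isXY u u)) ≡ false
  irrProof u = Relation.Binary.PropositionalEquality.subst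
    (λ z → (z ∧ not (isXY u u)) ≡ false) (Relation.Binary.PropositionalEquality.sym (irrfl G u)) refl

data Reach {n : ℕ} (G : Graph n) : Fin n → Fin n → Set where
  here : ∀ {u} → Reach G u u
  step : ∀ {u v w} → adj G u v ≡ true → Reach G v w → Reach G u w

HasBridge : {r : ℕ} → Graph r → Set
HasBridge {r} F = ∃[ x ] ∃[ y ] ((adj F x y ≡ true) × ¬ Reach (deleteEdge F x y) x y)

FactorThreshold : {r : ℕ} → Graph r → ℚ → Set
FactorThreshold {r} F c =
  ∃[ n₀ ] ∀ n → n ≥ n₀ → r ∣ n → (G : Graph n) →
    MinDegAtLeast G (c Data.Rational.* ℕ→ℚ n) →
    ∃[ H ] (IsFactor F H × (∀ u v → adj H u v ≡ true → adj G u v ≡ true))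

-- δ is admissible in the definition of δ_F:  ∀ ε>0, FactorThreshold F (δ+ε).
-- δ_F is the smallest admissible real; hence for rational δ,
-- AdmissibleδF F δ  ⟺  δ_F ≤ δ.
AdmissibleδF : {r : ℕ} → Graph r → ℚ → Set
AdmissibleδF F δ = ∀ ε → 0ℚ Data.Rational.< ε → FactorThreshold F (δ Data.Rational.+ ε)

δF≥½ : {r : ℕ} → Graph r → Set
δF≥½ F = ∀ δ → AdmissibleδF F δ → ½ ≤ δ

-- δ^T_F ≤ c  for rational c.  δ^T_F = δ_F if F has a bridge (or δ_F ≥ 1/2),
-- otherwise δ^T_F = 1/2; in all cases δ^T_F = δ_F if F has a bridge and
-- δ^T_F = max(δ_F, 1/2) otherwise.  So δ^T_F ≤ c iff δ_F ≤ c and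
-- (F has a bridge or 1/2 ≤ c).
δT≤ : {r : ℕ} → Graph r → ℚ → Set
δT≤ F c = AdmissibleδF F c × (HasBridge F ⊎ (½ ≤ c))

{-# OPTIONS --safe #-}
-- Write δ for the threshold c, so that every colour class has minimum degree at least (δ + ε)|V|.  Call an
-- edge popular for a set of colours if a fixed proportion of these colours contain it.  The popular edges
-- form a graph of minimum degree above δ on every vertex set on which all colours have such a degree, so
-- the definition of δ_F provides an F-factor of popular edges there; its edges receive distinct colours
-- greedily as long as the colours outnumber them by a large constant factor.  Randomly splitting V into many
-- small parts (derandomised by a potential function) and treating one part after the other therefore
-- rainbow-tiles all of V except a small reservoir R, at the cost of a few unused colours.  Each of these is
-- given its own copy of F in R: one edge has that colour and the others are popular.  Such copies exist
-- by an Erdős–Stone argument, where either δ ≥ 1/2 makes two colour classes meet in a dense graph, or F is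
-- bipartite and the prescribed edge is a bridge.  What remains of R is tiled by popular edges,
-- whose colours come from an absorber prepared in advance: among colours that pairwise overlap in
-- many edges, one fixes coloured copies of F such that for every popular edge e and every spare colour z
-- many of their edges f have a colour that is available at e, while z is available at f.  Then e takes the
-- colour of f, and f takes z.
module Submission where

-- There are exactly as many colours as edges, so no colour may be wasted, and a greedy choice has
-- to fail near the end. The greedy tiling stops with `g` colours about which nothing more is known;
-- such a colour can be placed only on an edge of its own graph. Here 1/2 and bridges enter: below
-- 1/2 a colour class may be bipartite with all popular edges inside its two sides, and then only a
-- bridge of F can take the colour. A spare colour cannot be exchanged with an arbitrary absorbing
-- colour either. Both come from a set `B` of colours in which each one overlaps with almost all
-- others; hence the spare colours are set aside before the greedy tiling, and the edges to be
-- absorbed are popular within `B`. All densities are fractions over one denominator `Q`, with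
-- `c = P / Q` and `6 / Q ≤ ε`. Passing to popular edges, deleting a small set of vertices and a
-- whole sequence of halvings cost `1 / Q` each. Vertices, edges and colours are lists up to
-- permutation, so that the final counts are exact.

module Development where
  open import Data.Nat using (ℕ; zero; suc; _+_; _*_; _∸_; _^_; _≤_; _<_; _≥_; z≤n; s≤s; s≤s⁻¹; _≤ᵇ_; _<ᵇ_; _≤?_; _<?_; ⌊_/2⌋; ⌈_/2⌉)
  open import Data.Nat.Properties hiding (_≟_; ≡-irrelevant; <-irrelevant)
  open import Data.Nat.Tactic.RingSolver using (solve-∀)
  open import Data.Bool using (Bool; true; false; _∧_; _∨_; not; if_then_else_)
  open import Data.Fin using (Fin; toℕ; _↑ˡ_; _↑ʳ_; combine; remQuot)
  open import Data.List using (List; []; _∷_; _++_; length; map; concat; concatMap; tabulate; zip; allFin; lookup; cartesianProduct; [_])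
  open import Data.List.Properties using (length-++; length-map; map-++; length-tabulate; map-∘; concatMap-++; tabulate-lookup)
  open import Data.List.Membership.Propositional using (_∈_)
  open import Data.List.Membership.Propositional.Properties using (∈-++⁺ʳ; ∈-++⁺ˡ; ∈-++⁻; ∈-map⁺; ∈-map⁻; ∈-tabulate⁺; ∈-tabulate⁻; ∈-allFin; ∈-concat⁻′; ∈-cartesianProduct⁺; ∈-cartesianProduct⁻; ∈-lookup)
  open import Data.List.Relation.Unary.Any using (here; there)
  open import Data.List.Relation.Binary.Permutation.Propositional using (_↭_; refl; prep; swap; ↭-refl; ↭-sym; ↭-trans; ↭-reflexive) renaming (trans to ptrans)
  open import Data.List.Relation.Binary.Permutation.Propositional.Properties using (∈-resp-↭; ↭-length; shift; shifts; ++⁺; ++⁺ˡ; ++⁺ʳ; map⁺) renaming (++-comm to ↭-++-comm; ++-assoc to ↭-++-assoc)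
  open import Data.Product using (Σ; ∃-syntax; _×_; _,_; proj₁; proj₂)
  open import Data.Sum using (_⊎_; inj₁; inj₂)
  open import Data.Empty using (⊥; ⊥-elim)
  open import Function using (id; case_of_)
  open import Relation.Nullary using (¬_; yes; no; contradiction; Dec; does)
  open import Relation.Binary.PropositionalEquality using (_≡_; _≢_; refl; sym; trans; cong; cong₂; subst; subst₂; module ≡-Reasoning)
  open import Relation.Nullary.Reflects using (Reflects; ofʸ; ofⁿ)
  open import Data.Nat.Divisibility using (_∣_; divides)
  open import Data.Rational as ℚ using (ℚ; 0ℚ)
  open import Defs using (sumFin)

  -- Booleans and elementary inequalities

  ≤ᵇ-true : ∀ {a b} → a ≤ b → (a ≤ᵇ b) ≡ true
  ≤ᵇ-true {a} {b} p with a ≤ᵇ b | ≤ᵇ-reflects-≤ a b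
  ... | true | _ = refl
  ... | false | ofⁿ q = contradiction p q

  ≤ᵇ-≤ : ∀ {a b} → (a ≤ᵇ b) ≡ true → a ≤ b
  ≤ᵇ-≤ {a} {b} p with a ≤ᵇ b | ≤ᵇ-reflects-≤ a b
  ... | true | ofʸ q = q

  true≢false : true ≢ false
  true≢false ()

  ∧-true : ∀ {a b} → a ∧ b ≡ true → (a ≡ true) × (b ≡ true)
  ∧-true {true} {true} refl = refl , refl

  ∧-intro : ∀ {a b} → a ≡ true → b ≡ true → a ∧ b ≡ true
  ∧-intro refl refl = refl

  -- A linear combination X ≤ Y of the hypotheses proves a ≤ b once the semiring identity holds.
  by-lin : ∀ {X Y a b} s → X ≤ Y → a + Y + s ≡ b + X → a ≤ b
  by-lin {X} {Y} {a} {b} s h e = +-cancelʳ-≤ Y a b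
    (≤-trans (m≤m+n (a + Y) s) (≤-trans (≤-reflexive e) (+-monoʳ-≤ b h)))

  -- Sums and counts over lists

  b2n : Bool → ℕ
  b2n true = 1
  b2n false = 0

  Σl : {A : Set} → (A → ℕ) → List A → ℕ
  Σl f [] = 0
  Σl f (x ∷ xs) = f x + Σl f xs

  cnt : {A : Set} → (A → Bool) → List A → ℕ
  cnt p = Σl (λ x → b2n (p x))

  module _ {A : Set} where

    Σl-mono : {f g : A → ℕ} (xs : List A) → (∀ {x} → x ∈ xs → f x ≤ g x) → Σl f xs ≤ Σl g xs
    Σl-mono [] h = z≤n
    Σl-mono (x ∷ xs) h = +-mono-≤ (h (here refl)) (Σl-mono xs (λ i → h (there i)))

    Σl-cong : {f g : A → ℕ} (xs : List A) → (∀ x → f x ≡ g x) → Σl f xs ≡ Σl g xs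
    Σl-cong [] h = refl
    Σl-cong (x ∷ xs) h = cong₂ _+_ (h x) (Σl-cong xs h)

    Σl-++ : (f : A → ℕ) (xs ys : List A) → Σl f (xs ++ ys) ≡ Σl f xs + Σl f ys
    Σl-++ f [] ys = refl
    Σl-++ f (x ∷ xs) ys = trans (cong (f x +_) (Σl-++ f xs ys)) (sym (+-assoc (f x) _ _))

    Σl-↭ : (f : A → ℕ) {xs ys : List A} → xs ↭ ys → Σl f xs ≡ Σl f ys
    Σl-↭ f refl = refl
    Σl-↭ f (prep x p) = cong (f x +_) (Σl-↭ f p)
    Σl-↭ f {_ ∷ _ ∷ xs} {_ ∷ _ ∷ ys} (swap x y p) = trans (cong (λ z → f x + (f y + z)) (Σl-↭ f p))
      (trans (sym (+-assoc (f x) (f y) _)) (trans (cong (_+ Σl f ys) (+-comm (f x) (f y))) (+-assoc (f y) (f x) _)))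
    Σl-↭ f (ptrans p q) = trans (Σl-↭ f p) (Σl-↭ f q)

    Σl-+ : (f g : A → ℕ) (xs : List A) → Σl (λ x → f x + g x) xs ≡ Σl f xs + Σl g xs
    Σl-+ f g [] = refl
    Σl-+ f g (x ∷ xs) rewrite Σl-+ f g xs = aux (f x) (g x) (Σl f xs) (Σl g xs)
      where
      aux : ∀ a b c d → a + b + (c + d) ≡ a + c + (b + d)
      aux = solve-∀

    Σl-*ˡ : (k : ℕ) (f : A → ℕ) (xs : List A) → Σl (λ x → k * f x) xs ≡ k * Σl f xs
    Σl-*ˡ k f [] = sym (*-zeroʳ k)
    Σl-*ˡ k f (x ∷ xs) = trans (cong (k * f x +_) (Σl-*ˡ k f xs)) (sym (*-distribˡ-+ k (f x) _))

    Σl-*ʳ : (k : ℕ) (f : A → ℕ) (xs : List A) → Σl (λ x → f x * k) xs ≡ Σl f xs * k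
    Σl-*ʳ k f xs = trans (Σl-cong xs (λ x → *-comm (f x) k)) (trans (Σl-*ˡ k f xs) (*-comm k _))

    Σl-const : (k : ℕ) (xs : List A) → Σl (λ _ → k) xs ≡ length xs * k
    Σl-const k [] = refl
    Σl-const k (x ∷ xs) = cong (k +_) (Σl-const k xs)

    Σl-≤-const : {f : A → ℕ} {k : ℕ} (xs : List A) → (∀ {x} → x ∈ xs → f x ≤ k) → Σl f xs ≤ length xs * k
    Σl-≤-const {k = k} xs h = ≤-trans (Σl-mono xs h) (≤-reflexive (Σl-const k xs))

    Σl-≥-const : {f : A → ℕ} {k : ℕ} (xs : List A) → (∀ {x} → x ∈ xs → k ≤ f x) → length xs * k ≤ Σl f xs
    Σl-≥-const {k = k} xs h = ≤-trans (≤-reflexive (sym (Σl-const k xs))) (Σl-mono xs h)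

  Σl-swap : {A B : Set} (f : A → B → ℕ) (xs : List A) (ys : List B) →
    Σl (λ x → Σl (f x) ys) xs ≡ Σl (λ y → Σl (λ x → f x y) xs) ys
  Σl-swap f [] ys = sym (trans (Σl-const 0 ys) (*-zeroʳ (length ys)))
  Σl-swap f (x ∷ xs) ys = trans (cong (Σl (f x) ys +_) (Σl-swap f xs ys)) (sym (Σl-+ (f x) _ ys))

  b2n≤1 : ∀ b → b2n b ≤ 1
  b2n≤1 true = ≤-refl
  b2n≤1 false = z≤n

  module _ {A : Set} where

    Σl-∈ : (f : A → ℕ) {x : A} {xs : List A} → x ∈ xs → f x ≤ Σl f xs
    Σl-∈ f (here refl) = m≤m+n _ _
    Σl-∈ f (there i) = ≤-trans (Σl-∈ f i) (m≤n+m _ _)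

    cnt≤length : (p : A → Bool) (xs : List A) → cnt p xs ≤ length xs
    cnt≤length p xs = ≤-trans (Σl-≤-const {k = 1} xs (λ {x} _ → b2n≤1 (p x))) (≤-reflexive (*-identityʳ _))

    cnt-mono : {p q : A → Bool} (xs : List A) → (∀ {x} → x ∈ xs → p x ≡ true → q x ≡ true) → cnt p xs ≤ cnt q xs
    cnt-mono {p} {q} xs h = Σl-mono xs λ {x} i → aux (h i)
      where
      aux : ∀ {a b} → (a ≡ true → b ≡ true) → b2n a ≤ b2n b
      aux {true} {b} f rewrite f refl = ≤-refl
      aux {false} f = z≤n

    cnt-∧ : (p q : A → Bool) (xs : List A) → cnt p xs + cnt q xs ≤ cnt (λ x → p x ∧ q x) xs + length xs
    cnt-∧ p q xs = begin
      cnt p xs + cnt q xs ≡⟨ Σl-+ _ _ xs ⟨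
      Σl (λ x → b2n (p x) + b2n (q x)) xs ≤⟨ Σl-mono xs (λ {x} _ → aux (p x) (q x)) ⟩
      Σl (λ x → b2n (p x ∧ q x) + 1) xs ≡⟨ Σl-+ _ _ xs ⟩
      cnt (λ x → p x ∧ q x) xs + Σl (λ _ → 1) xs ≡⟨ cong (cnt (λ x → p x ∧ q x) xs +_) (trans (Σl-const 1 xs) (*-identityʳ (length xs))) ⟩
      cnt (λ x → p x ∧ q x) xs + length xs ∎
      where
      open ≤-Reasoning
      aux : ∀ a b → b2n a + b2n b ≤ b2n (a ∧ b) + 1
      aux true true = ≤-refl
      aux true false = ≤-refl
      aux false b = b2n≤1 b

    cnt-split : (p q : A → Bool) (xs : List A) →
      cnt p xs ≡ cnt (λ x → p x ∧ q x) xs + cnt (λ x → p x ∧ not (q x)) xs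
    cnt-split p q xs = trans (Σl-cong xs (λ x → aux (p x) (q x))) (Σl-+ _ _ xs)
      where
      aux : ∀ a b → b2n a ≡ b2n (a ∧ b) + b2n (a ∧ not b)
      aux true true = refl
      aux true false = refl
      aux false b = refl

    cnt-++≤ : (p : A → Bool) {zs : List A} (xs ys : List A) → zs ↭ xs ++ ys → cnt p zs ≤ length xs + cnt p ys
    cnt-++≤ p xs ys e = ≤-trans (≤-reflexive (trans (Σl-↭ _ e) (Σl-++ _ xs ys))) (+-monoˡ-≤ _ (cnt≤length p xs))

    ↭-len : {zs : List A} (xs ys : List A) → zs ↭ xs ++ ys → length zs ≡ length xs + length ys
    ↭-len xs ys e = trans (↭-length e) (length-++ xs)

    ↭-len≤ʳ : {zs : List A} (xs ys : List A) → zs ↭ xs ++ ys → length ys ≤ length zs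
    ↭-len≤ʳ xs ys e = ≤-trans (m≤n+m _ (length xs)) (≤-reflexive (sym (↭-len xs ys e)))

    ∈-sub : {x : A} {zs : List A} (xs ys : List A) → zs ↭ xs ++ ys → x ∈ ys → x ∈ zs
    ∈-sub xs ys e i = ∈-resp-↭ (↭-sym e) (∈-++⁺ʳ xs i)

    ∈-subˡ : {x : A} {zs : List A} (xs ys : List A) → zs ↭ xs ++ ys → x ∈ xs → x ∈ zs
    ∈-subˡ xs ys e i = ∈-resp-↭ (↭-sym e) (∈-++⁺ˡ i)

    pick : (p : A → Bool) (xs : List A) → 1 ≤ cnt p xs → ∃[ x ] ∃[ ys ] (xs ↭ x ∷ ys) × (p x ≡ true)
    pick p (x ∷ xs) h with p x in eq
    ... | true = x , xs , ↭-refl , eq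
    ... | false with pick p xs h
    ... | y , ys , e , py = y , x ∷ ys , ↭-trans (prep x e) (swap x y ↭-refl) , py

    pickN : (p : A → Bool) (h : ℕ) (xs : List A) → h ≤ cnt p xs →
      ∃[ ys ] ∃[ zs ] (xs ↭ ys ++ zs) × (length ys ≡ h) × (∀ {y} → y ∈ ys → p y ≡ true)
    pickN p zero xs le = [] , xs , ↭-refl , refl , λ ()
    pickN p (suc h) xs le with pick p xs (≤-trans (s≤s z≤n) le)
    ... | x , xs′ , e , px with pickN p h xs′ (s≤s⁻¹ (≤-trans le (≤-trans (≤-reflexive (Σl-↭ _ e)) (+-monoˡ-≤ _ (b2n≤1 (p x))))))
    ... | ys , zs , e′ , l , f = x ∷ ys , zs , ↭-trans e (prep x e′) , cong suc l ,
            λ { (here refl) → px ; (there i) → f i }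

    takeN : (h : ℕ) (xs : List A) → h ≤ length xs → ∃[ ys ] ∃[ zs ] (xs ↭ ys ++ zs) × (length ys ≡ h)
    takeN zero xs le = [] , xs , ↭-refl , refl
    takeN (suc h) (x ∷ xs) (s≤s le) with takeN h xs le
    ... | ys , zs , e , l = x ∷ ys , zs , prep x e , cong suc l

    big-term? : (p : A → Bool) (f : A → ℕ) (X : ℕ) (ys : List A) →
      (∃[ x ] (x ∈ ys) × (p x ≡ true) × (suc X ≤ f x)) ⊎ (Σl (λ x → b2n (p x) * f x) ys ≤ cnt p ys * X)
    big-term? p f X [] = inj₂ z≤n
    big-term? p f X (y ∷ ys) with big-term? p f X ys
    ... | inj₁ (x , i , r) = inj₁ (x , there i , r)
    ... | inj₂ q with p y in eq | suc X ≤? f y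
    ... | true | yes l = inj₁ (y , here refl , eq , l)
    ... | true | no l = inj₂ (+-mono-≤ (≤-trans (≤-reflexive (*-identityˡ (f y))) (s≤s⁻¹ (≰⇒> l))) q)
    ... | false | _ = inj₂ q

    -- If every term with `p` were smaller than `X`, the sum would be at most `(X - 1) * K`, which
    -- is below `X * K` because `K` is positive.
    averaging : (p : A → Bool) (f : A → ℕ) (X K : ℕ) (xs : List A) → 1 ≤ X → 1 ≤ K → cnt p xs ≤ K →
      X * K ≤ Σl (λ x → b2n (p x) * f x) xs → ∃[ x ] (x ∈ xs) × (p x ≡ true) × (X ≤ f x)
    averaging p f (suc X) K xs _ K≥1 cK le with big-term? p f X xs
    ... | inj₁ r = r
    ... | inj₂ q = contradiction (≤-trans le (≤-trans q (*-monoˡ-≤ X cK))) (<⇒≱ aux)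
      where
      aux : K * X < K + X * K
      aux = ≤-trans (≤-reflexive (cong suc (*-comm K X))) (+-monoˡ-≤ (X * K) K≥1)

    -- A reverse Markov inequality: an entry that passes the test contributes at most `M * W`, any
    -- other at most `W`.
    markov : (f : A → ℕ) (W M : ℕ) (xs : List A) → (∀ {x} → x ∈ xs → f x ≤ W) →
      M * Σl f xs ≤ M * W * cnt (λ x → W ≤ᵇ M * f x) xs + length xs * W
    markov f W M xs h = begin
      M * Σl f xs ≡⟨ Σl-*ˡ M f xs ⟨
      Σl (λ x → M * f x) xs ≤⟨ Σl-mono xs (λ {x} i → aux x (h i)) ⟩
      Σl (λ x → M * W * b2n (W ≤ᵇ M * f x) + W) xs ≡⟨ Σl-+ _ _ xs ⟩
      Σl (λ x → M * W * b2n (W ≤ᵇ M * f x)) xs + Σl (λ _ → W) xs ≡⟨ cong₂ _+_ (Σl-*ˡ (M * W) _ xs) (Σl-const W xs) ⟩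
      M * W * cnt (λ x → W ≤ᵇ M * f x) xs + length xs * W ∎
      where
      open ≤-Reasoning
      aux : ∀ x → f x ≤ W → M * f x ≤ M * W * b2n (W ≤ᵇ M * f x) + W
      aux x fx≤W with W ≤ᵇ M * f x in eq
      ... | true = ≤-trans (*-monoʳ-≤ M fx≤W) (≤-trans (≤-reflexive (sym (*-identityʳ (M * W)))) (m≤m+n _ _))
      ... | false = ≤-trans (<⇒≤ (≰⇒> {W} (λ le → true≢false (trans (sym (≤ᵇ-true le)) eq)))) (m≤n+m W (M * W * 0))

  -- Halving a list with small discrepancy

  ^-distribʳ-* : ∀ k x y → (x * y) ^ k ≡ x ^ k * y ^ k
  ^-distribʳ-* zero x y = refl
  ^-distribʳ-* (suc k) x y = trans (cong (x * y *_) (^-distribʳ-* k x y)) (e x y (x ^ k) (y ^ k))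
    where
    e : ∀ x y a b → x * y * (a * b) ≡ x * a * (y * b)
    e = solve-∀

  -- Bernoulli's inequality `1 + k / x ≤ (1 + 1 / x) ^ k` with denominators cleared.
  bernoulli⁺ : ∀ x k → x ^ k * (x + k) ≤ suc x ^ k * x
  bernoulli⁺ x zero = ≤-reflexive (cong (1 *_) (+-identityʳ x))
  bernoulli⁺ x (suc k) = ≤-trans (by-lin (x ^ k * k) z≤n (id₁ x k (x ^ k)))
    (≤-trans (*-monoʳ-≤ (suc x) (bernoulli⁺ x k)) (≤-reflexive (sym (*-assoc (suc x) (suc x ^ k) x))))
    where
    id₁ : ∀ x k y → x * y * (x + suc k) + 0 + y * k ≡ suc x * (y * (x + k)) + 0
    id₁ = solve-∀

  -- Bernoulli's inequality `1 - q / X ≤ (1 - 1 / X) ^ q` for `X = suc Y`; `Z` replaces the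
  -- truncated difference `X - q`.
  bernoulli⁻ : ∀ Y q Z → Z + q ≤ suc Y → suc Y ^ q * Z ≤ Y ^ q * suc Y
  bernoulli⁻ Y zero Z le = *-monoʳ-≤ 1 (≤-trans (≤-reflexive (sym (+-identityʳ Z))) le)
  bernoulli⁻ Y (suc q) Z le = begin
    suc Y * suc Y ^ q * Z ≡⟨ e₁ Y (suc Y ^ q) Z ⟩
    suc Y ^ q * (Y * Z + Z) ≤⟨ *-monoʳ-≤ (suc Y ^ q) (+-monoʳ-≤ (Y * Z) Z≤Y) ⟩
    suc Y ^ q * (Y * Z + Y) ≡⟨ e₂ Y (suc Y ^ q) Z ⟩
    Y * (suc Y ^ q * suc Z) ≤⟨ *-monoʳ-≤ Y (bernoulli⁻ Y q (suc Z) (≤-trans (≤-reflexive (sym (+-suc Z q))) le)) ⟩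
    Y * (Y ^ q * suc Y) ≡⟨ *-assoc Y (Y ^ q) (suc Y) ⟨
    Y * Y ^ q * suc Y ∎
    where
    open ≤-Reasoning
    Z≤Y : Z ≤ Y
    Z≤Y = s≤s⁻¹ (≤-trans (s≤s (m≤m+n Z q)) (≤-trans (≤-reflexive (sym (+-suc Z q))) le))
    e₁ : ∀ Y p Z → suc Y * p * Z ≡ p * (Y * Z + Z)
    e₁ = solve-∀
    e₂ : ∀ Y p Z → p * (Y * Z + Y) ≡ Y * (p * suc Z)
    e₂ = solve-∀

  1≤^ : ∀ x k → 1 ≤ x → 1 ≤ x ^ k
  1≤^ (suc x) k _ = m^n>0 (suc x) k

  cancelˡ : ∀ k {a b} → 1 ≤ k → k * a ≤ k * b → a ≤ b
  cancelˡ (suc k) {a} {b} _ h = *-cancelˡ-≤ (suc k) h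

  double-pow : ∀ x → 1 ≤ x → 2 * x ^ x ≤ suc x ^ x
  double-pow x x≥1 = cancelˡ x x≥1 (≤-trans (≤-reflexive (e x (x ^ x))) (≤-trans (bernoulli⁺ x x) (≤-reflexive (*-comm (suc x ^ x) x))))
    where
    e : ∀ x y → x * (2 * y) ≡ y * (x + x)
    e = solve-∀

  double-pow-* : ∀ x w → 1 ≤ x → 2 ^ w * x ^ (x * w) ≤ suc x ^ (x * w)
  double-pow-* x w x≥1 = begin
    2 ^ w * x ^ (x * w) ≡⟨ cong (2 ^ w *_) (^-*-assoc x x w) ⟨
    2 ^ w * (x ^ x) ^ w ≡⟨ ^-distribʳ-* w 2 (x ^ x) ⟨
    (2 * x ^ x) ^ w ≤⟨ ^-monoˡ-≤ w (double-pow x x≥1) ⟩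
    (suc x ^ x) ^ w ≡⟨ ^-*-assoc (suc x) x w ⟩
    suc x ^ (x * w) ∎
    where open ≤-Reasoning

  n<2^n : ∀ n → n < 2 ^ n
  n<2^n zero = ≤-refl
  n<2^n (suc n) = begin
    suc (suc n) ≡⟨ +-comm 1 (suc n) ⟩
    suc n + 1 ≤⟨ +-mono-≤ (n<2^n n) (m^n>0 2 n) ⟩
    2 ^ n + 2 ^ n ≡⟨ cong (2 ^ n +_) (sym (+-identityʳ (2 ^ n))) ⟩
    2 ^ suc n ∎
    where open ≤-Reasoning

  double-pow-≤ : ∀ x w d → 1 ≤ x → x * w ≤ d → 2 ^ w * x ^ d ≤ suc x ^ d
  double-pow-≤ x w d x≥1 le = begin
    2 ^ w * x ^ d ≡⟨ cong (λ e → 2 ^ w * x ^ e) (sym (m+[n∸m]≡n le)) ⟩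
    2 ^ w * x ^ (x * w + d′) ≡⟨ cong (2 ^ w *_) (^-distribˡ-+-* x (x * w) d′) ⟩
    2 ^ w * (x ^ (x * w) * x ^ d′) ≡⟨ *-assoc (2 ^ w) _ _ ⟨
    2 ^ w * x ^ (x * w) * x ^ d′ ≤⟨ *-mono-≤ (double-pow-* x w x≥1) (^-monoˡ-≤ d′ (n≤1+n x)) ⟩
    suc x ^ (x * w) * suc x ^ d′ ≡⟨ ^-distribˡ-+-* (suc x) (x * w) d′ ⟨
    suc x ^ (x * w + d′) ≡⟨ cong (suc x ^_) (m+[n∸m]≡n le) ⟩
    suc x ^ d ∎
    where
    open ≤-Reasoning
    d′ = d ∸ x * w

  -- Optimised at b = 2q: a deviation d > s/q costs a factor (1 + 1/8q)^d.
  tail-bound : ∀ q p u v z s k w → 1 ≤ q → suc p ≡ 2 * q → u + v + z ≡ s → 8 * q * q * w ≤ s →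
    k < 2 ^ w → suc (suc p) ^ u * (p ^ v * suc p ^ z) ≤ suc p ^ s * k → q * u ≤ q * v + s
  tail-bound q p u v z s k w q≥1 bq refl ws k< hyp with q * u ≤? q * v + s
  ... | yes le = le
  ... | no nle = contradiction 2^w≤k (<⇒≱ k<)
    where
    open ≤-Reasoning
    b = suc p
    X = b * b
    -- This is `(b + 1) * (b - 1)`, written so that `suc Y` computes to `X`. Matching the `v`
    -- factors `b - 1` with as many factors `b + 1` leaves `d = u - v` unmatched factors `b + 1`.
    Y = p + p * suc p
    gt : q * v + (u + v + z) < q * u
    gt = ≰⇒> nle
    v≤u : v ≤ u
    v≤u = cancelˡ q q≥1 (≤-trans (m≤m+n (q * v) _) (<⇒≤ gt))
    d = u ∸ v
    u≡ : v + d ≡ u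
    u≡ = m+[n∸m]≡n v≤u
    s<qd : u + v + z ≤ q * d
    s<qd = +-cancelˡ-≤ (q * v) _ _ (≤-trans (<⇒≤ gt) (≤-reflexive (trans (cong (q *_) (sym u≡)) (*-distribˡ-+ q v d))))
    v≤qd : v ≤ q * d
    v≤qd = ≤-trans (≤-trans (m≤n+m v u) (m≤m+n (u + v) z)) s<qd
    8qw≤d : 8 * q * w ≤ d
    8qw≤d = cancelˡ q q≥1 (≤-trans (≤-reflexive (e q w)) (≤-trans ws s<qd))
      where
      e : ∀ q w → q * (8 * q * w) ≡ 8 * q * q * w
      e = solve-∀
    b+1*p : suc b * p ≡ Y
    b+1*p = e p
      where
      e : ∀ p → suc (suc p) * p ≡ p + p * suc p
      e = solve-∀
    step₁ : suc b ^ d * Y ^ v ≤ b ^ d * (X ^ v * k)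
    step₁ = cancelˡ (b ^ z) (1≤^ b z (s≤s z≤n)) (begin
      b ^ z * (suc b ^ d * Y ^ v) ≡⟨ cong (λ t → b ^ z * (suc b ^ d * t ^ v)) (sym b+1*p) ⟩
      b ^ z * (suc b ^ d * (suc b * p) ^ v) ≡⟨ cong (λ t → b ^ z * (suc b ^ d * t)) (^-distribʳ-* v (suc b) p) ⟩
      b ^ z * (suc b ^ d * (suc b ^ v * p ^ v)) ≡⟨ e₁ (b ^ z) (suc b ^ d) (suc b ^ v) (p ^ v) ⟩
      suc b ^ v * suc b ^ d * (p ^ v * b ^ z) ≡⟨ cong (_* (p ^ v * b ^ z)) (sym (^-distribˡ-+-* (suc b) v d)) ⟩
      suc b ^ (v + d) * (p ^ v * b ^ z) ≡⟨ cong (λ t → suc b ^ t * (p ^ v * b ^ z)) u≡ ⟩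
      suc b ^ u * (p ^ v * b ^ z) ≤⟨ hyp ⟩
      b ^ (u + v + z) * k ≡⟨ cong (λ t → b ^ (t + v + z) * k) (sym u≡) ⟩
      b ^ (v + d + v + z) * k ≡⟨ cong (_* k) (trans (^-distribˡ-+-* b (v + d + v) z) (cong (_* b ^ z) (trans (^-distribˡ-+-* b (v + d) v) (cong (_* b ^ v) (^-distribˡ-+-* b v d))))) ⟩
      b ^ v * b ^ d * b ^ v * b ^ z * k ≡⟨ e₂ (b ^ v) (b ^ d) (b ^ z) k ⟩
      b ^ z * (b ^ d * (b ^ v * b ^ v * k)) ≡⟨ cong (λ t → b ^ z * (b ^ d * (t * k))) (sym (^-distribʳ-* v b b)) ⟩
      b ^ z * (b ^ d * (X ^ v * k)) ∎)
      where
      e₁ : ∀ z d v p → z * (d * (v * p)) ≡ v * d * (p * z)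
      e₁ = solve-∀
      e₂ : ∀ v d z k → v * d * v * z * k ≡ z * (d * (v * v * k))
      e₂ = solve-∀
    f = q * d ∸ v
    v+f : v + f ≡ q * d
    v+f = m+[n∸m]≡n v≤qd
    Y≤X : Y ≤ X
    Y≤X = n≤1+n Y
    -- As `v ≤ q * d` and `Y ≤ X`, the exponent `v` may be raised to `q * d`; now every exponent is
    -- a multiple of `d`.
    step₂ : suc b ^ d * Y ^ (q * d) ≤ b ^ d * (X ^ (q * d) * k)
    step₂ = begin
      suc b ^ d * Y ^ (q * d) ≡⟨ cong (λ t → suc b ^ d * Y ^ t) (sym v+f) ⟩
      suc b ^ d * Y ^ (v + f) ≡⟨ cong (suc b ^ d *_) (^-distribˡ-+-* Y v f) ⟩
      suc b ^ d * (Y ^ v * Y ^ f) ≡⟨ *-assoc (suc b ^ d) (Y ^ v) (Y ^ f) ⟨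
      suc b ^ d * Y ^ v * Y ^ f ≤⟨ *-mono-≤ step₁ (^-monoˡ-≤ f Y≤X) ⟩
      b ^ d * (X ^ v * k) * X ^ f ≡⟨ e (b ^ d) (X ^ v) k (X ^ f) ⟩
      b ^ d * (X ^ v * X ^ f * k) ≡⟨ cong (λ t → b ^ d * (t * k)) (sym (^-distribˡ-+-* X v f)) ⟩
      b ^ d * (X ^ (v + f) * k) ≡⟨ cong (λ t → b ^ d * (X ^ t * k)) v+f ⟩
      b ^ d * (X ^ (q * d) * k) ∎
      where
      e : ∀ a x k y → a * (x * k) * y ≡ a * (x * y * k)
      e = solve-∀
    Z = X ∸ q
    q≤X : q ≤ X
    q≤X = begin
      q ≤⟨ m≤m+n q (q + 0) ⟩
      2 * q ≡⟨ bq ⟨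
      b ≤⟨ m≤m*n b b ⟩
      X ∎
    Z+q : Z + q ≡ X
    Z+q = m∸n+n≡m q≤X
    step₃ : (X ^ q * Z) ^ d ≤ (Y ^ q * X) ^ d
    step₃ = ^-monoˡ-≤ d (bernoulli⁻ Y q Z (≤-reflexive Z+q))
    step₄ : (suc b * Z) ^ d ≤ (b * X) ^ d * k
    step₄ = cancelˡ (X ^ (q * d)) (1≤^ X (q * d) (s≤s z≤n)) (begin
      X ^ (q * d) * (suc b * Z) ^ d ≡⟨ cong₂ _*_ (sym (^-*-assoc X q d)) (^-distribʳ-* d (suc b) Z) ⟩
      (X ^ q) ^ d * (suc b ^ d * Z ^ d) ≡⟨ e₁ ((X ^ q) ^ d) (suc b ^ d) (Z ^ d) ⟩
      suc b ^ d * ((X ^ q) ^ d * Z ^ d) ≡⟨ cong (suc b ^ d *_) (sym (^-distribʳ-* d (X ^ q) Z)) ⟩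
      suc b ^ d * (X ^ q * Z) ^ d ≤⟨ *-monoʳ-≤ (suc b ^ d) step₃ ⟩
      suc b ^ d * (Y ^ q * X) ^ d ≡⟨ cong (suc b ^ d *_) (^-distribʳ-* d (Y ^ q) X) ⟩
      suc b ^ d * ((Y ^ q) ^ d * X ^ d) ≡⟨ cong (λ t → suc b ^ d * (t * X ^ d)) (^-*-assoc Y q d) ⟩
      suc b ^ d * (Y ^ (q * d) * X ^ d) ≡⟨ *-assoc (suc b ^ d) _ _ ⟨
      suc b ^ d * Y ^ (q * d) * X ^ d ≤⟨ *-monoˡ-≤ (X ^ d) step₂ ⟩
      b ^ d * (X ^ (q * d) * k) * X ^ d ≡⟨ e₂ (b ^ d) (X ^ (q * d)) k (X ^ d) ⟩
      X ^ (q * d) * (b ^ d * X ^ d * k) ≡⟨ cong (λ t → X ^ (q * d) * (t * k)) (sym (^-distribʳ-* d b X)) ⟩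
      X ^ (q * d) * ((b * X) ^ d * k) ∎)
      where
      e₁ : ∀ a b c → a * (b * c) ≡ b * (a * c)
      e₁ = solve-∀
      e₂ : ∀ a x k y → a * (x * k) * y ≡ x * (a * y * k)
      e₂ = solve-∀
    q² = q * q
    -- The margin is `q * (q - 1)`, since `(2 * q + 1) * (4 * q * q - q) = q * q * (8 * q + 1) + q *
    -- (q - 1)`.
    low : q² * suc (8 * q) ≤ suc b * Z
    low = +-cancelʳ-≤ (suc b * q) _ _ (≤-trans aux (≤-reflexive e))
      where
      aux : q * q * suc (8 * q) + suc b * q ≤ suc (2 * q) * (2 * q * (2 * q))
      aux = ≤-trans (≤-reflexive (cong (λ t → q * q * suc (8 * q) + suc t * q) bq))
        (by-lin 0 (*-monoʳ-≤ q q≥1) (e₀ q))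
        where
        e₀ : ∀ q → q * q * suc (8 * q) + suc (2 * q) * q + q * q + 0 ≡ suc (2 * q) * (2 * q * (2 * q)) + q * 1
        e₀ = solve-∀
      e : suc (2 * q) * (2 * q * (2 * q)) ≡ suc b * Z + suc b * q
      e = trans (cong (λ t → suc t * (t * t)) (sym bq)) (trans (cong (suc b *_) (sym Z+q)) (*-distribˡ-+ (suc b) Z q))
    up : b * X ≡ q² * (8 * q)
    up = trans (cong (λ t → t * (t * t)) bq) (e q)
      where
      e : ∀ q → 2 * q * (2 * q * (2 * q)) ≡ q * q * (8 * q)
      e = solve-∀
    step₅ : suc (8 * q) ^ d ≤ (8 * q) ^ d * k
    step₅ = cancelˡ (q² ^ d) (1≤^ q² d (*-mono-≤ q≥1 q≥1)) (begin
      q² ^ d * suc (8 * q) ^ d ≡⟨ ^-distribʳ-* d q² (suc (8 * q)) ⟨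
      (q² * suc (8 * q)) ^ d ≤⟨ ^-monoˡ-≤ d low ⟩
      (suc b * Z) ^ d ≤⟨ step₄ ⟩
      (b * X) ^ d * k ≡⟨ cong (λ t → t ^ d * k) up ⟩
      (q² * (8 * q)) ^ d * k ≡⟨ cong (_* k) (^-distribʳ-* d q² (8 * q)) ⟩
      q² ^ d * (8 * q) ^ d * k ≡⟨ *-assoc (q² ^ d) _ _ ⟩
      q² ^ d * ((8 * q) ^ d * k) ∎)
    8q≥1 : 1 ≤ 8 * q
    8q≥1 = ≤-trans q≥1 (m≤m+n q (7 * q))
    2^w≤k : 2 ^ w ≤ k
    2^w≤k = cancelˡ ((8 * q) ^ d) (1≤^ (8 * q) d 8q≥1) (≤-trans (≤-reflexive (*-comm _ (2 ^ w)))
      (≤-trans (double-pow-≤ (8 * q) w d 8q≥1 8qw≤d) step₅))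


  lefts rights : {V : Set} → List (V × V) → List V
  lefts = map proj₁
  rights = map proj₂

  module Halving {V : Set} (p : ℕ) where

    b : ℕ
    b = suc p

    -- Relative to `b` these are the factors `1 + 1 / b`, `1 - 1 / b` and 1: exponential weights for
    -- the excess of the left entry, as in a derandomised Chernoff bound.
    factor : Bool → Bool → ℕ
    factor true false = suc b
    factor false true = p
    factor true true = b
    factor false false = b

    factor-sum : ∀ x y → factor x y + factor y x ≡ 2 * b
    factor-sum true true = e p
      where
      e : ∀ p → suc p + suc p ≡ 2 * suc p
      e = solve-∀
    factor-sum true false = e p
      where
      e : ∀ p → suc (suc p) + p ≡ 2 * suc p
      e = solve-∀
    factor-sum false true = e p
      where
      e : ∀ p → p + suc (suc p) ≡ 2 * suc p
      e = solve-∀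
    factor-sum false false = factor-sum true true

    weight : (V → Bool) → List (V × V) → ℕ
    weight g [] = 1
    weight g ((x , y) ∷ os) = factor (g x) (g y) * weight g os

    -- The factors of the two orientations of a pair average to b, so one of them does not increase the potential.
    orient : (ps : List (V × V)) (Gs : List (V → Bool)) (w : (V → Bool) → ℕ) →
      ∃[ os ] (lefts ps ++ rights ps ↭ lefts os ++ rights os) × (length os ≡ length ps) ×
        (Σl (λ g → w g * weight g os) Gs ≤ b ^ length ps * Σl w Gs)
    orient [] Gs w = [] , ↭-refl , refl ,
      ≤-reflexive (trans (Σl-cong Gs (λ g → *-identityʳ (w g))) (sym (+-identityʳ _)))
    orient ((x , y) ∷ ps) Gs w = choose (≤-total (Σl w₁ Gs) (Σl w₂ Gs))
      where
      w₁ w₂ : (V → Bool) → ℕ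
      w₁ g = w g * factor (g x) (g y)
      w₂ g = w g * factor (g y) (g x)
      total : Σl w₁ Gs + Σl w₂ Gs ≡ 2 * (b * Σl w Gs)
      total = trans (sym (Σl-+ w₁ w₂ Gs)) (trans (Σl-cong Gs λ g → trans (sym (*-distribˡ-+ (w g) _ _))
        (trans (cong (w g *_) (factor-sum (g x) (g y))) (*-comm (w g) (2 * b))))
        (trans (Σl-*ˡ (2 * b) w Gs) (*-assoc 2 b _)))
      half : ∀ {u v X} → u + v ≡ 2 * X → u ≤ v → u ≤ X
      half {u} {v} {X} e le = *-cancelˡ-≤ 2 (≤-trans (≤-reflexive (cong (u +_) (+-identityʳ u))) (≤-trans (+-monoʳ-≤ u le) (≤-reflexive e)))
      extend : (x′ y′ : V) → Σl (λ g → w g * factor (g x′) (g y′)) Gs ≤ b * Σl w Gs →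
        x ∷ y ∷ lefts ps ++ rights ps ↭ x′ ∷ y′ ∷ lefts ps ++ rights ps →
        ∃[ os ] (lefts ((x , y) ∷ ps) ++ rights ((x , y) ∷ ps) ↭ lefts os ++ rights os) ×
          (length os ≡ suc (length ps)) × (Σl (λ g → w g * weight g os) Gs ≤ b ^ suc (length ps) * Σl w Gs)
      extend x′ y′ le e with orient ps Gs (λ g → w g * factor (g x′) (g y′))
      ... | os , eo , l , bound = (x′ , y′) ∷ os ,
        ↭-trans (prep x (shift y (lefts ps) (rights ps))) (↭-trans e (↭-trans (prep x′ (prep y′ eo)) (prep x′ (↭-sym (shift y′ (lefts os) (rights os)))))) ,
        cong suc l ,
        (begin
          Σl (λ g → w g * (factor (g x′) (g y′) * weight g os)) Gs ≡⟨ Σl-cong Gs (λ g → sym (*-assoc (w g) _ _)) ⟩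
          Σl (λ g → w g * factor (g x′) (g y′) * weight g os) Gs ≤⟨ bound ⟩
          b ^ length ps * Σl (λ g → w g * factor (g x′) (g y′)) Gs ≤⟨ *-monoʳ-≤ (b ^ length ps) le ⟩
          b ^ length ps * (b * Σl w Gs) ≡⟨ *-assoc (b ^ length ps) b _ ⟨
          b ^ length ps * b * Σl w Gs ≡⟨ cong (_* Σl w Gs) (*-comm (b ^ length ps) b) ⟩
          b ^ suc (length ps) * Σl w Gs ∎)
        where open ≤-Reasoning
      choose : Σl w₁ Gs ≤ Σl w₂ Gs ⊎ Σl w₂ Gs ≤ Σl w₁ Gs → _
      choose (inj₁ le) = extend x y (half total le) ↭-refl
      choose (inj₂ le) = extend y x (half (trans (+-comm (Σl w₂ Gs) _) total) le) (swap x y ↭-refl)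

    -- `u` and `v` count the pairs that `g` separates in favour of the left and of the right. Thus
    -- `u - v` is the discrepancy, and what remains for `tail-bound` is arithmetic.
    weight-shape : (g : V → Bool) (os : List (V × V)) → ∃[ u ] ∃[ v ] ∃[ z ]
      (weight g os ≡ suc b ^ u * (p ^ v * b ^ z)) × (cnt g (lefts os) + v ≡ cnt g (rights os) + u) ×
      (u + v + z ≡ length os)
    weight-shape g [] = 0 , 0 , 0 , refl , refl , refl
    weight-shape g ((x , y) ∷ os) with g x | g y | weight-shape g os
    ... | true | true | u , v , z , e , c , l = u , v , suc z , trans (cong (b *_) e) (e₁ b (suc b ^ u) (p ^ v) (b ^ z)) ,
          cong suc c , trans (+-suc (u + v) z) (cong suc l)
      where
      e₁ : ∀ b u v z → b * (u * (v * z)) ≡ u * (v * (b * z))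
      e₁ = solve-∀
    ... | false | false | u , v , z , e , c , l = u , v , suc z , trans (cong (b *_) e) (e₁ b (suc b ^ u) (p ^ v) (b ^ z)) ,
          c , trans (+-suc (u + v) z) (cong suc l)
      where
      e₁ : ∀ b u v z → b * (u * (v * z)) ≡ u * (v * (b * z))
      e₁ = solve-∀
    ... | true | false | u , v , z , e , c , l = suc u , v , z , trans (cong (suc b *_) e) (sym (*-assoc (suc b) (suc b ^ u) _)) ,
          trans (cong suc c) (sym (+-suc _ u)) , cong suc l
    ... | false | true | u , v , z , e , c , l = u , suc v , z , trans (cong (p *_) e) (e₁ p (suc b ^ u) (p ^ v) (b ^ z)) ,
          trans (+-suc _ v) (cong suc c) , trans (cong (_+ z) (+-suc u v)) (cong suc l)
      where
      e₁ : ∀ b u v z → b * (u * (v * z)) ≡ u * (b * v * z)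
      e₁ = solve-∀

  cnt-not : {V : Set} (g : V → Bool) (xs : List V) → cnt g xs + cnt (λ x → not (g x)) xs ≡ length xs
  cnt-not g [] = refl
  cnt-not g (x ∷ xs) with g x
  ... | true = cong suc (cnt-not g xs)
  ... | false = trans (+-suc _ _) (cong suc (cnt-not g xs))

  lefts-zip : {V : Set} (xs ys : List V) → length xs ≡ length ys →
    (lefts (zip xs ys) ≡ xs) × (rights (zip xs ys) ≡ ys) × (length (zip xs ys) ≡ length xs)
  lefts-zip [] [] _ = refl , refl , refl
  lefts-zip (x ∷ xs) (y ∷ ys) e with lefts-zip xs ys (suc-injective e)
  ... | a , b , c = cong (x ∷_) a , cong (y ∷_) b , cong suc c

  -- The potential starts at the number of predicates and grows by at most `b` per pair, so no
  -- single weight ends above `b ^ s` times that number. The resulting tail bound is one-sided,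
  -- which is why the complements join the family.
  halve : {V : Set} (q w s : ℕ) (Gs : List (V → Bool)) (L₀ R₀ : List V) → 1 ≤ q → length L₀ ≡ s → length R₀ ≡ s →
    length Gs + length Gs < 2 ^ w → 8 * q * q * w ≤ s →
    ∃[ L ] ∃[ R ] (L₀ ++ R₀ ↭ L ++ R) × (length L ≡ s) × (length R ≡ s) ×
      (∀ {g} → g ∈ Gs → (q * cnt g L ≤ q * cnt g R + s) × (q * cnt g R ≤ q * cnt g L + s))
  halve {V} q@(suc q′) w s Gs L₀ R₀ q≥1 lL lR k< ws with lefts-zip L₀ R₀ (trans lL (sym lR))
  ... | zl , zr , zlen with Halving.orient (2 * q ∸ 1) (zip L₀ R₀) (Gs ++ map (λ g x → not (g x)) Gs) (λ _ → 1)
  ... | os , e , l , bound = lefts os , rights os ,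
          ↭-trans (↭-reflexive (cong₂ _++_ (sym zl) (sym zr))) e ,
          trans (length-map _ os) lo , trans (length-map _ os) lo ,
          λ {g} i → one (∈-++⁺ˡ i) , flip g (one (∈-++⁺ʳ Gs (∈-map⁺ _ i)))
    where
    open Halving {V} (2 * q ∸ 1)
    Gs₂ = Gs ++ map (λ g x → not (g x)) Gs
    lo : length os ≡ s
    lo = trans l (trans zlen lL)
    lenG : length Gs₂ ≡ length Gs + length Gs
    lenG = trans (length-++ Gs) (cong (length Gs +_) (length-map _ Gs))
    bound′ : Σl (λ g → 1 * weight g os) Gs₂ ≤ b ^ s * length Gs₂
    bound′ = ≤-trans bound (≤-reflexive (cong₂ (λ s′ t → b ^ s′ * t) (trans zlen lL) (trans (Σl-const 1 Gs₂) (*-identityʳ _))))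
    one : ∀ {g} → g ∈ Gs₂ → q * cnt g (lefts os) ≤ q * cnt g (rights os) + s
    one {g} i with weight-shape g os
    ... | u , v , z , ew , ec , es = +-cancelʳ-≤ (q * v) _ _ (begin
        q * cnt g (lefts os) + q * v ≡⟨ *-distribˡ-+ q _ v ⟨
        q * (cnt g (lefts os) + v) ≡⟨ cong (q *_) ec ⟩
        q * (cnt g (rights os) + u) ≡⟨ *-distribˡ-+ q _ u ⟩
        q * cnt g (rights os) + q * u ≤⟨ +-monoʳ-≤ (q * cnt g (rights os)) tb ⟩
        q * cnt g (rights os) + (q * v + s) ≡⟨ e₁ (q * cnt g (rights os)) (q * v) s ⟩
        q * cnt g (rights os) + s + q * v ∎)
      where
      open ≤-Reasoning
      e₁ : ∀ a b c → a + (b + c) ≡ a + c + b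
      e₁ = solve-∀
      tb : q * u ≤ q * v + s
      tb = tail-bound q (2 * q ∸ 1) u v z s (length Gs + length Gs) w q≥1 refl (trans es lo) ws k<
        (≤-trans (≤-reflexive (trans (sym ew) (sym (*-identityˡ _)))) (≤-trans (Σl-∈ (λ g → 1 * weight g os) i)
          (≤-trans bound′ (≤-reflexive (cong (b ^ s *_) lenG)))))
    flip : ∀ g → q * cnt (λ x → not (g x)) (lefts os) ≤ q * cnt (λ x → not (g x)) (rights os) + s →
      q * cnt g (rights os) ≤ q * cnt g (lefts os) + s
    flip g h = by-lin 0 (+-mono-≤ h (≤-reflexive eq)) (e₁ (q * cnt g (lefts os)) (q * cnt g (rights os)) (q * cnt g′ (lefts os)) (q * cnt g′ (rights os)) s)
      where
      g′ = λ x → not (g x)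
      tot : ∀ xs → q * cnt g xs + q * cnt g′ xs ≡ q * length xs
      tot xs = trans (sym (*-distribˡ-+ q (cnt g xs) (cnt g′ xs))) (cong (q *_) (cnt-not g xs))
      eq : q * cnt g (rights os) + q * cnt g′ (rights os) ≡ q * cnt g (lefts os) + q * cnt g′ (lefts os)
      eq = trans (tot (rights os)) (trans (cong (q *_) (trans (length-map _ os) (sym (length-map _ os)))) (sym (tot (lefts os))))
      e₁ : ∀ gl gr nl nr s → gr + (nr + s + (gl + nl)) + 0 ≡ gl + s + (nl + (gr + nr))
      e₁ = solve-∀

  -- Deleting `X` removes at most `length V₀ / Q` neighbours, hence the loss of one unit over the
  -- denominator `Q`.
  drop-degree : {V : Set} (A Q : ℕ) (g : V → Bool) {V₀ : List V} (X U : List V) → V₀ ↭ X ++ U → Q * length X ≤ length V₀ →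
    suc A * length V₀ ≤ Q * cnt g V₀ → A * length U ≤ Q * cnt g U
  drop-degree A Q g {V₀} X U e small deg = by-lin (A * length X)
    (+-mono-≤ (≤-trans deg (*-monoʳ-≤ Q (cnt-++≤ g X U e))) (+-mono-≤ small (≤-reflexive (cong (A *_) (sym (↭-len X U e))))))
    (e₁ A Q (length U) (length V₀) (length X) (cnt g U))
    where
    e₁ : ∀ A Q u v x c → A * u + (Q * (x + c) + (v + A * v)) + A * x ≡ Q * c + (suc A * v + (Q * x + A * (x + u)))
    e₁ = solve-∀

  ⌈2*n/2⌉ : ∀ n → ⌈ 2 * n /2⌉ ≡ n
  ⌈2*n/2⌉ n = sym (trans (n≡⌈n+n/2⌉ n) (cong (λ k → ⌈ n + k /2⌉) (sym (+-identityʳ n))))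

  ⌊2*n/2⌋ : ∀ n → ⌊ 2 * n /2⌋ ≡ n
  ⌊2*n/2⌋ n = sym (trans (n≡⌊n+n/2⌋ n) (cong (λ k → ⌊ n + k /2⌋) (sym (+-identityʳ n))))

  half-excess : ∀ x → ∃[ d ] (d ≤ 1) × (⌈ x /2⌉ ≡ d + ⌊ x /2⌋) × (x ≡ d + (⌊ x /2⌋ + ⌊ x /2⌋))
  half-excess zero = 0 , z≤n , refl , refl
  half-excess (suc zero) = 1 , ≤-refl , refl , refl
  half-excess (suc (suc x)) with half-excess x
  ... | d , d≤1 , e , e′ = d , d≤1 , trans (cong suc e) (sym (+-suc d _)) ,
    trans (cong (λ z → suc (suc z)) e′) (e₁ d ⌊ x /2⌋)
    where
    e₁ : ∀ d h → suc (suc (d + (h + h))) ≡ d + (suc h + suc h)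
    e₁ = solve-∀

  -- Halving with precision `2 * B` uses only a fraction of the unit `1 / B` given up; the rest pays
  -- for the at most `r` vertices that stay unpaired.
  halve-degrees : {V : Set} (r x A B w : ℕ) (Gs : List (V → Bool)) (U : List V) → 1 ≤ r → 1 ≤ B → length U ≡ r * x →
    length Gs + length Gs < 2 ^ w → 8 * (2 * B) * (2 * B) * w ≤ ⌊ x /2⌋ → 2 * (A + B) ≤ ⌊ x /2⌋ →
    (∀ {g} → g ∈ Gs → suc A * length U ≤ B * cnt g U) →
    ∃[ L ] ∃[ R ] (U ↭ L ++ R) × (length L ≡ r * ⌈ x /2⌉) × (length R ≡ r * ⌊ x /2⌋) ×
      (∀ {g} → g ∈ Gs → (A * length L ≤ B * cnt g L) × (A * length R ≤ B * cnt g R))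
  halve-degrees {V} r x A B w Gs U r≥1 B≥1 lU kw wx AB deg with half-excess x
  ... | d , d≤1 , ceil , tot = result
    where
    h = ⌊ x /2⌋
    s = r * h
    lenU : length U ≡ r * d + (s + s)
    lenU = trans lU (trans (cong (r *_) tot) (e₁ r d h))
      where
      e₁ : ∀ r d h → r * (d + (h + h)) ≡ r * d + (r * h + r * h)
      e₁ = solve-∀
    h≤s : h ≤ s
    h≤s = ≤-trans (≤-reflexive (sym (*-identityˡ h))) (*-monoˡ-≤ h r≥1)
    result : ∃[ L ] ∃[ R ] (U ↭ L ++ R) × (length L ≡ r * ⌈ x /2⌉) × (length R ≡ s) ×
      (∀ {g} → g ∈ Gs → (A * length L ≤ B * cnt g L) × (A * length R ≤ B * cnt g R))
    -- `d` is the parity of `x`. The `r * d` unpaired vertices join the left part, so that both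
    -- lengths remain multiples of `r`.
    result with takeN (r * d) U (≤-trans (m≤m+n _ _) (≤-reflexive (sym lenU)))
    ... | ex , U₁ , e₁ , lex with takeN s U₁ (≤-trans (m≤m+n s s) (≤-reflexive (sym lU₁)))
      where
      lU₁ : length U₁ ≡ s + s
      lU₁ = +-cancelˡ-≡ (r * d) _ _ (trans (cong (_+ length U₁) (sym lex)) (trans (sym (↭-len ex U₁ e₁)) lenU))
    ... | L₀ , R₀ , e₂ , lL₀ with halve (2 * B) w s Gs L₀ R₀ (≤-trans B≥1 (m≤m+n B (B + 0))) lL₀ lR₀ kw (≤-trans wx h≤s)
      where
      lR₀ : length R₀ ≡ s
      lR₀ = +-cancelˡ-≡ (r * d + s) _ _ (trans (+-assoc (r * d) s (length R₀)) (trans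
        (cong₂ _+_ (sym lex) (trans (cong (_+ length R₀) (sym lL₀)) (sym (↭-len L₀ R₀ e₂))))
        (trans (sym (↭-len ex U₁ e₁)) (trans lenU (sym (+-assoc (r * d) s s))))))
    ... | L , R , e₃ , lL , lR , dev = ex ++ L , R ,
        ↭-trans e₁ (↭-trans (++⁺ˡ ex (↭-trans e₂ e₃)) (↭-sym (↭-++-assoc ex L R))) ,
        lenL , lR , λ i → boundL i , boundR i
      where
      lenL : length (ex ++ L) ≡ r * ⌈ x /2⌉
      lenL = trans (length-++ ex) (trans (cong₂ _+_ lex lL) (trans (sym (*-distribˡ-+ r d h)) (cong (r *_) (sym ceil))))
      cU : ∀ g → cnt g U ≡ cnt g ex + (cnt g L + cnt g R)
      cU g = trans (Σl-↭ _ e₁) (trans (Σl-++ _ ex U₁) (cong (cnt g ex +_) (trans (Σl-↭ _ (↭-trans e₂ e₃)) (Σl-++ _ L R))))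
      h₁ : ∀ {g} → g ∈ Gs → suc A * (r * d + (s + s)) ≤ B * (r * d + (cnt g L + cnt g R))
      h₁ {g} i = ≤-trans (≤-reflexive (cong (suc A *_) (sym lenU))) (≤-trans (deg i) (*-monoʳ-≤ B
        (≤-trans (≤-reflexive (cU g)) (+-monoˡ-≤ _ (≤-trans (cnt≤length g ex) (≤-reflexive lex))))))
      h₃ : 2 * (A + B) * (r * d) ≤ s
      h₃ = begin
        2 * (A + B) * (r * d) ≤⟨ *-mono-≤ AB (*-monoʳ-≤ r d≤1) ⟩
        h * (r * 1) ≡⟨ e h r ⟩
        r * h ∎
        where
        open ≤-Reasoning
        e : ∀ h r → h * (r * 1) ≡ r * h
        e = solve-∀
      core : ∀ c c′ z → suc A * (r * d + (s + s)) ≤ B * (r * d + (c + c′)) → 2 * B * c′ ≤ 2 * B * c + s →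
        z ≤ r * d → A * (z + s) ≤ B * c
      core c c′ z p₁ p₂ p₃ = *-cancelˡ-≤ 4 (by-lin (2 * s + 2 * (r * d))
        (+-mono-≤ (*-monoʳ-≤ 2 p₁) (+-mono-≤ p₂ (+-mono-≤ h₃ (*-monoʳ-≤ (4 * A) p₃)))) (e A B (r * d) s c c′ z))
        where
        e : ∀ A B x s c c′ z → 4 * (A * (z + s)) + (2 * (B * (x + (c + c′))) + (2 * B * c + s + (s + 4 * A * x))) + (2 * s + 2 * x)
          ≡ 4 * (B * c) + (2 * (suc A * (x + (s + s))) + (2 * B * c′ + (2 * (A + B) * x + 4 * A * z)))
        e = solve-∀
      boundL : ∀ {g} → g ∈ Gs → A * length (ex ++ L) ≤ B * cnt g (ex ++ L)
      boundL {g} i = begin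
        A * length (ex ++ L) ≡⟨ cong (A *_) (trans (length-++ ex) (cong₂ _+_ lex lL)) ⟩
        A * (r * d + s) ≤⟨ core (cnt g L) (cnt g R) (r * d) (h₁ i) (proj₂ (dev i)) ≤-refl ⟩
        B * cnt g L ≤⟨ *-monoʳ-≤ B (m≤n+m (cnt g L) (cnt g ex)) ⟩
        B * (cnt g ex + cnt g L) ≡⟨ cong (B *_) (Σl-++ _ ex L) ⟨
        B * cnt g (ex ++ L) ∎
        where open ≤-Reasoning
      boundR : ∀ {g} → g ∈ Gs → A * length R ≤ B * cnt g R
      boundR {g} i = ≤-trans (≤-reflexive (cong (A *_) lR)) (core (cnt g R) (cnt g L) 0
        (≤-trans (h₁ i) (≤-reflexive (cong (λ z → B * (r * d + z)) (+-comm (cnt g L) (cnt g R))))) (proj₁ (dev i)) z≤n)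

  -- Greedy colouring, families of copies of F, repeated halving of numbers

  greedy : {E C : Set} (rel : C → E → Bool) (es : List E) (D : List C) →
    (∀ {e} → e ∈ es → length es ≤ cnt (λ c → rel c e) D) →
    ∃[ L ] ∃[ D′ ] (D ↭ map proj₂ L ++ D′) × (map proj₁ L ≡ es) × (∀ {x} → x ∈ L → rel (proj₂ x) (proj₁ x) ≡ true)
  greedy rel [] D h = [] , D , ↭-refl , refl , λ ()
  greedy rel (e ∷ es) D h with pick (λ c → rel c e) D (≤-trans (s≤s z≤n) (h (here refl)))
  -- A colour once taken is at most one of those available at any later edge.
  ... | c , D₁ , p , ok with greedy rel es D₁ (λ {e′} i → s≤s⁻¹ (≤-trans (h (there i)) (cnt-++≤ (λ c → rel c e′) [ c ] D₁ p)))
  ... | L , D′ , p′ , fst , all = (e , c) ∷ L , D′ , ↭-trans p (prep c p′) , cong (e ∷_) fst ,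
          λ { (here refl) → ok ; (there i) → all i }

  length-× : {A B : Set} (xs : List A) (ys : List B) → length (cartesianProduct xs ys) ≡ length xs * length ys
  length-× [] ys = refl
  length-× (x ∷ xs) ys = trans (length-++ (map (x ,_) ys)) (cong₂ _+_ (length-map _ ys) (length-× xs ys))

  edge : {V : Set} {r : ℕ} → (Fin r → V) → Fin r × Fin r → V × V
  edge τ (a , b) = τ a , τ b

  verts : {V : Set} {r : ℕ} → List (Fin r → V) → List V
  verts = concatMap tabulate

  edgesOf : {V : Set} {r : ℕ} → List (Fin r × Fin r) → List (Fin r → V) → List (V × V)
  edgesOf EF = concatMap (λ τ → map (edge τ) EF)

  length-verts : {V : Set} {r : ℕ} (Ts : List (Fin r → V)) → length (verts Ts) ≡ length Ts * r
  length-verts [] = refl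
  length-verts (τ ∷ Ts) = trans (length-++ (tabulate τ)) (cong₂ _+_ (length-tabulate τ) (length-verts Ts))

  -- The form in which the construction uses the threshold of F. A list `U` and a relation `K` in
  -- place of a graph make it applicable to any part of the vertex set and any graph of popular
  -- edges.
  BlackBox : Set → (r : ℕ) → List (Fin r × Fin r) → (A Q n₀ : ℕ) → Set
  BlackBox V r EF A Q n₀ = (U : List V) (x : ℕ) (K : V → V → Bool) → (∀ u v → K u v ≡ K v u) → (∀ u → K u u ≡ false) →
    length U ≡ r * x → n₀ ≤ length U → (∀ {v} → v ∈ U → A * length U ≤ Q * cnt (K v) U) →
    Σ (List (Fin r → V)) λ Ts → (U ↭ verts Ts) × (length Ts ≡ x) × (∀ {e} → e ∈ edgesOf EF Ts → K (proj₁ e) (proj₂ e) ≡ true)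

  -- The quotient of `x` by `2 ^ κ` rounded down, in the form in which successive splittings produce
  -- it.
  halves : ℕ → ℕ → ℕ
  halves zero x = x
  halves (suc κ) x = halves κ ⌊ x /2⌋

  2*⌊n/2⌋≤n : ∀ n → 2 * ⌊ n /2⌋ ≤ n
  2*⌊n/2⌋≤n n = begin
    2 * ⌊ n /2⌋ ≡⟨ cong (⌊ n /2⌋ +_) (+-identityʳ _) ⟩
    ⌊ n /2⌋ + ⌊ n /2⌋ ≤⟨ +-monoʳ-≤ ⌊ n /2⌋ (⌊n/2⌋≤⌈n/2⌉ n) ⟩
    ⌊ n /2⌋ + ⌈ n /2⌉ ≡⟨ ⌊n/2⌋+⌈n/2⌉≡n n ⟩
    n ∎
    where open ≤-Reasoning

  n<2*[1+⌊n/2⌋] : ∀ n → n < 2 * suc ⌊ n /2⌋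
  n<2*[1+⌊n/2⌋] zero = s≤s z≤n
  n<2*[1+⌊n/2⌋] (suc zero) = s≤s (s≤s z≤n)
  n<2*[1+⌊n/2⌋] (suc (suc n)) = ≤-trans (s≤s (s≤s (n<2*[1+⌊n/2⌋] n))) (≤-reflexive (e ⌊ n /2⌋))
    where
    e : ∀ h → suc (suc (2 * suc h)) ≡ 2 * suc (suc h)
    e = solve-∀

  halves-upper : ∀ κ x → 2 ^ κ * halves κ x ≤ x
  halves-upper zero x = ≤-reflexive (*-identityˡ x)
  halves-upper (suc κ) x = ≤-trans (≤-reflexive (*-assoc 2 (2 ^ κ) _))
    (≤-trans (*-monoʳ-≤ 2 (halves-upper κ ⌊ x /2⌋)) (2*⌊n/2⌋≤n x))

  halves-lower : ∀ κ x → x < 2 ^ κ * suc (halves κ x)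
  halves-lower zero x = ≤-reflexive (sym (*-identityˡ (suc x)))
  halves-lower (suc κ) x = ≤-trans (n<2*[1+⌊n/2⌋] x) (≤-trans (*-monoʳ-≤ 2 (halves-lower κ ⌊ x /2⌋))
    (≤-reflexive (sym (*-assoc 2 (2 ^ κ) _))))

  halves≤ : ∀ κ x → halves κ x ≤ x
  halves≤ zero x = ≤-refl
  halves≤ (suc κ) x = ≤-trans (halves≤ κ ⌊ x /2⌋) (⌊n/2⌋≤n x)

  -- The Erdős–Stone step

  ∈⇒↭ : {A : Set} {x : A} {xs : List A} → x ∈ xs → ∃[ ys ] xs ↭ x ∷ ys
  ∈⇒↭ {x = x} (here refl) = _ , ↭-refl
  ∈⇒↭ {x = x} {y ∷ _} (there i) with ∈⇒↭ i
  ... | ys , e = y ∷ ys , ↭-trans (prep y e) (swap y x ↭-refl)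

  partition : {A : Set} (p : A → Bool) (xs : List A) → ∃[ ys ] ∃[ zs ] (xs ↭ ys ++ zs) × (length ys ≡ cnt p xs) ×
    (∀ {y} → y ∈ ys → p y ≡ true) × (∀ {z} → z ∈ zs → p z ≡ false)
  partition p [] = [] , [] , ↭-refl , refl , (λ ()) , (λ ())
  partition p (x ∷ xs) with p x in eq | partition p xs
  ... | true | ys , zs , e , l , f , g = x ∷ ys , zs , prep x e , cong suc l , (λ { (here refl) → eq ; (there i) → f i }) , g
  ... | false | ys , zs , e , l , f , g = ys , x ∷ zs , ↭-trans (prep x e) (↭-sym (shift x ys zs)) , l , f , (λ { (here refl) → eq ; (there i) → g i })

  Constant : {V : Set} → (V → Bool) → List V → Set
  Constant g W = (∀ w → w ∈ W → g w ≡ true) ⊎ (∀ w → w ∈ W → g w ≡ false)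

  constant-⊆ : {V : Set} {g : V → Bool} {W W′ : List V} → (∀ w → w ∈ W′ → w ∈ W) → Constant g W → Constant g W′
  constant-⊆ s (inj₁ h) = inj₁ (λ w i → h w (s w i))
  constant-⊆ s (inj₂ h) = inj₂ (λ w i → h w (s w i))

  -- Each vertex of `Bs` divides what is left of `W` into neighbours and non-neighbours; keeping the
  -- larger part costs a factor 2.
  homogenise : {V : Set} (G : V → V → Bool) (Bs W : List V) → ∃[ W* ] ∃[ W′ ] (W ↭ W* ++ W′) ×
    (length W ≤ 2 ^ length Bs * length W*) ×
    (∀ {b} → b ∈ Bs → Constant (G b) W*)
  homogenise G [] W = W , [] , ↭-reflexive (sym (++-identityʳ W)) , ≤-reflexive (sym (*-identityˡ _)) , λ ()
    where open import Data.List.Properties using (++-identityʳ)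
  homogenise G (b ∷ Bs) W with homogenise G Bs W
  ... | W₀ , W₁ , e , le , hom with partition (G b) W₀
  ... | ys , zs , e′ , _ , f , g with ≤-total (length ys) (length zs)
  ... | inj₁ y≤z = zs , ys ++ W₁ , ↭-trans e (↭-trans (++⁺ʳ W₁ e′) (↭-trans (++⁺ʳ W₁ (↭-++-comm ys zs)) (↭-++-assoc zs ys W₁))) ,
            ≤-trans le (≤-trans (*-monoʳ-≤ (2 ^ length Bs) (≤-trans (≤-reflexive (↭-len ys zs e′)) (+-monoˡ-≤ (length zs) y≤z))) (≤-reflexive (e₁ (2 ^ length Bs) (length zs)))) ,
            λ { (here refl) → inj₂ (λ w i → g i) ; (there i) → constant-⊆ (λ w j → ∈-sub ys zs e′ j) (hom i) }
    where
    e₁ : ∀ a z → a * (z + z) ≡ 2 * a * z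
    e₁ = solve-∀
  ... | inj₂ z≤y = ys , zs ++ W₁ , ↭-trans e (↭-trans (++⁺ʳ W₁ e′) (↭-++-assoc ys zs W₁)) ,
            ≤-trans le (≤-trans (*-monoʳ-≤ (2 ^ length Bs) (≤-trans (≤-reflexive (↭-len ys zs e′)) (+-monoʳ-≤ (length ys) z≤y))) (≤-reflexive (e₁ (2 ^ length Bs) (length ys)))) ,
            λ { (here refl) → inj₁ (λ w i → f i) ; (there i) → constant-⊆ (λ w j → ∈-subˡ ys zs e′ j) (hom i) }
    where
    e₁ : ∀ a z → a * (z + z) ≡ 2 * a * z
    e₁ = solve-∀

  allᵇ : ∀ {j} → (Fin j → Bool) → Bool
  allᵇ {zero} f = true
  allᵇ {suc j} f = f Fin.zero ∧ allᵇ (λ i → f (Fin.suc i))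

  allᵇ-true : ∀ {j} (f : Fin j → Bool) → allᵇ f ≡ true → ∀ i → f i ≡ true
  allᵇ-true f h Fin.zero = proj₁ (∧-true h)
  allᵇ-true f h (Fin.suc i) = allᵇ-true (λ i → f (Fin.suc i)) (proj₂ (∧-true h)) i

  sumFin-mono : ∀ {j} {f g : Fin j → ℕ} → (∀ i → f i ≤ g i) → sumFin f ≤ sumFin g
  sumFin-mono {zero} h = z≤n
  sumFin-mono {suc j} h = +-mono-≤ (h Fin.zero) (sumFin-mono (λ i → h (Fin.suc i)))

  sumFin-const : ∀ j k → sumFin {j} (λ _ → k) ≡ j * k
  sumFin-const zero k = refl
  sumFin-const (suc j) k = cong (k +_) (sumFin-const j k)

  sumFin-*ˡ : ∀ {j} k (f : Fin j → ℕ) → sumFin (λ i → k * f i) ≡ k * sumFin f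
  sumFin-*ˡ {zero} k f = sym (*-zeroʳ k)
  sumFin-*ˡ {suc j} k f = trans (cong (k * f Fin.zero +_) (sumFin-*ˡ k (λ i → f (Fin.suc i)))) (sym (*-distribˡ-+ k _ _))

  Σl-sumFin : {A : Set} {j : ℕ} (f : A → Fin j → ℕ) (xs : List A) →
    Σl (λ x → sumFin (f x)) xs ≡ sumFin (λ i → Σl (λ x → f x i) xs)
  Σl-sumFin {j = zero} f xs = trans (Σl-const 0 xs) (*-zeroʳ (length xs))
  Σl-sumFin {j = suc j} f xs = trans (Σl-+ (λ x → f x Fin.zero) _ xs) (cong (Σl (λ x → f x Fin.zero) xs +_) (Σl-sumFin (λ x i → f x (Fin.suc i)) xs))

  -- If one term is below `h`, the other `j` terms add at most `j * H`. The indicator keeps the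
  -- bound linear, ready to be summed over all vertices.
  sumFin-deficient : ∀ j (c : Fin (suc j) → ℕ) H h → (∀ i → c i ≤ H) →
    sumFin c ≤ suc j * H * b2n (allᵇ (λ i → h ≤ᵇ c i)) + (j * H + h)
  sumFin-deficient j c H h c≤ with allᵇ (λ i → h ≤ᵇ c i) in eq
  ... | true = ≤-trans (sumFin-mono c≤) (≤-trans (≤-reflexive (trans (sumFin-const (suc j) H) (sym (*-identityʳ _)))) (m≤m+n _ _))
  ... | false = ≤-trans (missing j c c≤ eq) (m≤n+m (j * H + h) (suc j * H * 0))
    where
    missing : ∀ j (c : Fin (suc j) → ℕ) → (∀ i → c i ≤ H) → allᵇ (λ i → h ≤ᵇ c i) ≡ false → sumFin c ≤ j * H + h
    missing j c c≤ eq with h ≤ᵇ c Fin.zero in eq₀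
    missing j c c≤ eq | false = ≤-trans (+-mono-≤ (<⇒≤ (≰⇒> {h} (λ le → true≢false (trans (sym (≤ᵇ-true le)) eq₀))))
      (≤-trans (sumFin-mono (λ i → c≤ (Fin.suc i))) (≤-reflexive (sumFin-const j H)))) (≤-reflexive (+-comm h (j * H)))
    missing (suc j) c c≤ eq | true = ≤-trans (+-mono-≤ (c≤ Fin.zero) (missing j (λ i → c (Fin.suc i)) (λ i → c≤ (Fin.suc i)) eq))
      (≤-reflexive (sym (+-assoc H (j * H) h)))

  flat : {V : Set} {j : ℕ} → (Fin j → List V) → List V
  flat Ps = concat (tabulate Ps)

  length-flat : {V : Set} {j : ℕ} (Ps : Fin j → List V) (H : ℕ) → (∀ i → length (Ps i) ≡ H) → length (flat Ps) ≡ j * H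
  length-flat {j = zero} Ps H h = refl
  length-flat {j = suc j} Ps H h = trans (length-++ (Ps Fin.zero)) (cong₂ _+_ (h Fin.zero) (length-flat (λ i → Ps (Fin.suc i)) H (λ i → h (Fin.suc i))))

  ∈-flat : {V : Set} {j : ℕ} (Ps : Fin j → List V) (i : Fin j) {x : V} → x ∈ Ps i → x ∈ flat Ps
  ∈-flat Ps Fin.zero m = ∈-++⁺ˡ m
  ∈-flat Ps (Fin.suc i) m = ∈-++⁺ʳ (Ps Fin.zero) (∈-flat (λ i → Ps (Fin.suc i)) i m)

  flat-split : {V : Set} {j : ℕ} (Ps Ps′ rest : Fin j → List V) → (∀ i → Ps i ↭ Ps′ i ++ rest i) → flat Ps ↭ flat Ps′ ++ flat rest
  flat-split {j = zero} Ps Ps′ rest h = ↭-refl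
  flat-split {j = suc j} Ps Ps′ rest h = ↭-trans (++⁺ (h Fin.zero) (flat-split (λ i → Ps (Fin.suc i)) (λ i → Ps′ (Fin.suc i)) (λ i → rest (Fin.suc i)) (λ i → h (Fin.suc i))))
    (interchange (Ps′ Fin.zero) (rest Fin.zero) _ _)
    where
    interchange : {A : Set} (a b c d : List A) → (a ++ b) ++ c ++ d ↭ (a ++ c) ++ b ++ d
    interchange a b c d = ↭-trans (↭-++-assoc a b (c ++ d)) (↭-trans (++⁺ˡ a (shifts b c)) (↭-sym (↭-++-assoc a c (b ++ d))))

  -- One step of the Erdős-Stone induction: `new` becomes a further class, and the old classes
  -- shrink to the parts joined to it.
  record Refined {V : Set} (G : V → V → Bool) {j : ℕ} (h : ℕ) (Ps : Fin j → List V) (W : List V) : Set where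
    field
      new rest : List V
      sub lost : Fin j → List V
      W↭ : W ↭ new ++ rest
      Ps↭ : ∀ i → Ps i ↭ sub i ++ lost i
      new-len : length new ≡ h
      sub-len : ∀ i → length (sub i) ≡ h
      joined : ∀ i {p w} → p ∈ sub i → w ∈ new → G p w ≡ true

  -- The hypothesis says `A / B > j / (j + 1)`. Double counting gives an average vertex of `W` at
  -- least `j * H + H / B = j * H + 2 * h` neighbours in the `j + 1` classes, whereas one with fewer
  -- than `h` in some class has less than `j * H + h`. So a positive proportion of `W` is good, and
  -- `homogenise` makes good vertices indistinguishable from the classes.
  refine : {V : Set} (G : V → V → Bool) (j A B h : ℕ) (Ps : Fin (suc j) → List V) (W : List V) → 1 ≤ h → 1 ≤ B →
    (∀ i → length (Ps i) ≡ 2 * B * h) → (∀ i {p} → p ∈ Ps i → A * length W ≤ B * cnt (G p) W) →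
    suc (j * B) ≤ suc j * A → suc j * (2 * B) * 2 ^ (suc j * (2 * B * h)) * h ≤ length W → Refined G h Ps W
  refine {V} G j A B h Ps W h≥1 B≥1 len deg AB big = result
    where
    open ≤-Reasoning
    H = 2 * B * h
    c : V → Fin (suc j) → ℕ
    c v i = cnt (λ p → G p v) (Ps i)
    good : V → Bool
    good v = allᵇ (λ i → h ≤ᵇ c v i)
    n = cnt good W
    upper : Σl (λ v → sumFin (c v)) W ≤ suc j * H * n + length W * (j * H + h)
    upper = begin
      Σl (λ v → sumFin (c v)) W ≤⟨ Σl-mono W (λ {v} _ → sumFin-deficient j (c v) H h (λ i → ≤-trans (cnt≤length _ (Ps i)) (≤-reflexive (len i)))) ⟩
      Σl (λ v → suc j * H * b2n (good v) + (j * H + h)) W ≡⟨ Σl-+ _ _ W ⟩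
      Σl (λ v → suc j * H * b2n (good v)) W + Σl (λ _ → j * H + h) W ≡⟨ cong₂ _+_ (Σl-*ˡ (suc j * H) _ W) (Σl-const (j * H + h) W) ⟩
      suc j * H * n + length W * (j * H + h) ∎
    lower : suc j * (H * (A * length W)) ≤ B * Σl (λ v → sumFin (c v)) W
    lower = begin
      suc j * (H * (A * length W)) ≡⟨ sumFin-const (suc j) _ ⟨
      sumFin {suc j} (λ _ → H * (A * length W)) ≤⟨ sumFin-mono part ⟩
      sumFin (λ i → B * Σl (λ p → cnt (G p) W) (Ps i)) ≡⟨ sumFin-*ˡ B (λ i → Σl (λ p → cnt (G p) W) (Ps i)) ⟩
      B * sumFin (λ i → Σl (λ p → cnt (G p) W) (Ps i)) ≤⟨ *-monoʳ-≤ B (sumFin-mono (λ i → ≤-reflexive (Σl-swap (λ p v → b2n (G p v)) (Ps i) W))) ⟩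
      B * sumFin (λ i → Σl (λ v → c v i) W) ≡⟨ cong (B *_) (sym (Σl-sumFin c W)) ⟩
      B * Σl (λ v → sumFin (c v)) W ∎
      where
      part : ∀ i → H * (A * length W) ≤ B * Σl (λ p → cnt (G p) W) (Ps i)
      part i = begin
        H * (A * length W) ≡⟨ cong (_* (A * length W)) (sym (len i)) ⟩
        length (Ps i) * (A * length W) ≤⟨ Σl-≥-const (Ps i) (λ p∈ → deg i p∈) ⟩
        Σl (λ p → B * cnt (G p) W) (Ps i) ≡⟨ Σl-*ˡ B _ (Ps i) ⟩
        B * Σl (λ p → cnt (G p) W) (Ps i) ∎
    many : length W ≤ suc j * (2 * B) * n
    many = cancelˡ (B * h) (*-mono-≤ B≥1 h≥1) (by-lin 0
        (+-mono-≤ (*-monoʳ-≤ (2 * B * h * length W) AB) (≤-trans lower (*-monoʳ-≤ B upper)))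
        (e₁ (length W) j A B h n))
      where
      e₁ : ∀ W j A B h n → B * h * W + (2 * B * h * W * (suc j * A) + B * (suc j * (2 * B * h) * n + W * (j * (2 * B * h) + h))) + 0
        ≡ B * h * (suc j * (2 * B) * n) + (2 * B * h * W * suc (j * B) + suc j * (2 * B * h * (A * W)))
      e₁ = solve-∀
    result : Refined G h Ps W
    result = stage₁ (partition good W)
      where
      stage₃ : ∀ Wg W₀ W₁ W₂ → W ↭ Wg ++ W₂ → (∀ {v} → v ∈ Wg → good v ≡ true) → Wg ↭ W₀ ++ W₁ →
        (∀ {b} → b ∈ flat Ps → Constant (G b) W₀) →
        (∃[ N ] ∃[ N′ ] (W₀ ↭ N ++ N′) × (length N ≡ h)) → Refined G h Ps W
      stage₃ Wg W₀ W₁ W₂ e good-all e′ hom ([] , N′ , e″ , lN) = contradiction (≤-trans h≥1 (≤-reflexive (sym lN))) λ ()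
      -- Every vertex of the classes sees all of `W₀` or nothing of it, so the neighbours of the
      -- single vertex `w₀` are joined to all of `N`.
      stage₃ Wg W₀ W₁ W₂ e good-all e′ hom (N@(w₀ ∷ _) , N′ , e″ , lN) = record
        { new = N ; rest = N′ ++ (W₁ ++ W₂) ; sub = λ i → proj₁ (sub i) ; lost = λ i → proj₁ (proj₂ (sub i))
        ; W↭ = ↭-trans e (↭-trans (++⁺ʳ W₂ (↭-trans e′ (++⁺ʳ W₁ e″))) (↭-trans (↭-++-assoc (N ++ N′) W₁ W₂) (↭-++-assoc N N′ (W₁ ++ W₂))))
        ; Ps↭ = λ i → proj₁ (proj₂ (proj₂ (sub i)))
        ; new-len = lN
        ; sub-len = λ i → proj₁ (proj₂ (proj₂ (proj₂ (sub i))))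
        ; joined = λ i {p} {w} p∈ w∈ → join i p∈ (∈-subˡ N N′ e″ w∈) (hom (∈-flat Ps i (∈-subˡ _ _ (proj₁ (proj₂ (proj₂ (sub i)))) p∈))) }
        where
        w₀∈ : w₀ ∈ W₀
        w₀∈ = ∈-subˡ N N′ e″ (here refl)
        sub : ∀ i → ∃[ ys ] ∃[ zs ] (Ps i ↭ ys ++ zs) × (length ys ≡ h) × (∀ {y} → y ∈ ys → G y w₀ ≡ true)
        sub i = pickN (λ p → G p w₀) h (Ps i) (≤ᵇ-≤ (allᵇ-true (λ i → h ≤ᵇ c w₀ i) (good-all (∈-subˡ W₀ W₁ e′ w₀∈)) i))
        join : ∀ i {p w} → p ∈ proj₁ (sub i) → w ∈ W₀ → Constant (G p) W₀ → G p w ≡ true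
        join i p∈ w∈ (inj₁ f) = f _ w∈
        join i p∈ w∈ (inj₂ f) = contradiction (trans (sym (proj₂ (proj₂ (proj₂ (proj₂ (sub i)))) p∈)) (f w₀ w₀∈)) true≢false
      stage₂ : ∀ Wg W₂ → W ↭ Wg ++ W₂ → length Wg ≡ n → (∀ {v} → v ∈ Wg → good v ≡ true) →
        (∃[ W* ] ∃[ W′ ] (Wg ↭ W* ++ W′) × (length Wg ≤ 2 ^ length (flat Ps) * length W*) ×
          (∀ {b} → b ∈ flat Ps → Constant (G b) W*)) → Refined G h Ps W
      stage₂ Wg W₂ e lg good-all (W₀ , W₁ , e′ , le , hom) = stage₃ Wg W₀ W₁ W₂ e good-all e′ hom (takeN h W₀ enough)
        where
        E = 2 ^ (suc j * (2 * B * h))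
        enough : h ≤ length W₀
        enough = cancelˡ (suc j * (2 * B) * E) (*-mono-≤ (*-mono-≤ (s≤s {0} {j} z≤n) (≤-trans B≥1 (m≤m+n B (B + 0)))) (m^n>0 2 (suc j * (2 * B * h)))) (begin
          suc j * (2 * B) * E * h ≤⟨ big ⟩
          length W ≤⟨ many ⟩
          suc j * (2 * B) * n ≡⟨ cong (suc j * (2 * B) *_) (sym lg) ⟩
          suc j * (2 * B) * length Wg ≤⟨ *-monoʳ-≤ (suc j * (2 * B)) le ⟩
          suc j * (2 * B) * (2 ^ length (flat Ps) * length W₀) ≡⟨ cong (λ k → suc j * (2 * B) * (2 ^ k * length W₀)) (length-flat Ps H len) ⟩
          suc j * (2 * B) * (E * length W₀) ≡⟨ *-assoc (suc j * (2 * B)) E _ ⟨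
          suc j * (2 * B) * E * length W₀ ∎)
      stage₁ : (∃[ ys ] ∃[ zs ] (W ↭ ys ++ zs) × (length ys ≡ n) × (∀ {y} → y ∈ ys → good y ≡ true) × (∀ {z} → z ∈ zs → good z ≡ false)) → Refined G h Ps W
      stage₁ (Wg , W₂ , e , lg , good-all , _) = stage₂ Wg W₂ e lg good-all (homogenise G (flat Ps) Wg)

  -- Each vertex of F consumes one entry of every class and takes the one from its own, so `r`
  -- entries per class keep the positions distinct for any colouring.
  transversal : {V : Set} (l r : ℕ) (Ps : Fin l → List V) (col : Fin r → Fin l) → (∀ i → length (Ps i) ≡ r) →
    ∃[ τ ] ∃[ rest ] (flat Ps ↭ tabulate τ ++ rest) × (∀ v → τ v ∈ Ps (col v))
  transversal l zero Ps col len = (λ ()) , flat Ps , ↭-refl , λ ()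
  transversal {V} l (suc r) Ps col len = result
    where
    uncons : (xs : List V) → length xs ≡ suc r → ∃[ x ] ∃[ ys ] (xs ≡ x ∷ ys) × (length ys ≡ r)
    uncons (x ∷ ys) e = x , ys , refl , suc-injective e
    hd : Fin l → V
    hd i = proj₁ (uncons (Ps i) (len i))
    tl : Fin l → List V
    tl i = proj₁ (proj₂ (uncons (Ps i) (len i)))
    eq : ∀ i → Ps i ≡ hd i ∷ tl i
    eq i = proj₁ (proj₂ (proj₂ (uncons (Ps i) (len i))))
    result : ∃[ τ ] ∃[ rest ] (flat Ps ↭ tabulate τ ++ rest) × (∀ v → τ v ∈ Ps (col v))
    result with transversal l r tl (λ v → col (Fin.suc v)) (λ i → proj₂ (proj₂ (proj₂ (uncons (Ps i) (len i)))))
      | ∈⇒↭ (∈-flat (λ i → [ hd i ]) (col Fin.zero) (here refl))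
    ... | τ , rest , e , mem | hs , e′ = (λ { Fin.zero → hd (col Fin.zero) ; (Fin.suc v) → τ v }) , hs ++ rest ,
      ↭-trans (flat-split Ps (λ i → [ hd i ]) tl (λ i → ↭-reflexive (eq i))) (↭-trans (++⁺ e′ e)
        (prep _ (shifts hs (tabulate τ)))) ,
      λ { Fin.zero → subst (hd (col Fin.zero) ∈_) (sym (eq (col Fin.zero))) (here refl)
        ; (Fin.suc v) → subst (τ v ∈_) (sym (eq (col (Fin.suc v)))) (there (mem v)) }

  Dense : {V : Set} → ℕ → (V → V → Bool) → List V → Set
  Dense M J U = length U * length U ≤ M * Σl (λ u → cnt (J u) U) U

  Symmetric : {V : Set} → (V → V → Bool) → Set
  Symmetric G = ∀ u v → G u v ≡ G v u

  refineBound : ℕ → ℕ → ℕ → ℕ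
  refineBound j B h = suc j * (2 * B) * 2 ^ (suc j * (2 * B * h)) * h

  pairBound : ℕ → ℕ → ℕ
  pairBound M h = 4 * M * (2 * (4 * M) * h) + (refineBound 0 (4 * M) h + 2 * (4 * M) * h)

  -- At least a proportion `1 / (2 * M)` of the vertices have degree at least `length U / (2 * M)`.
  -- Setting `H` of them aside leaves them density `1 / (4 * M)` to the rest, and `refine` with a
  -- single class asks only for positive density.
  densePair : {V : Set} (J : V → V → Bool) (M h : ℕ) (U : List V) → Symmetric J → 1 ≤ M → 1 ≤ h → Dense M J U →
    pairBound M h ≤ length U → ∃[ X ] ∃[ Y ] ∃[ rest ] (U ↭ X ++ (Y ++ rest)) × (length X ≡ h) × (length Y ≡ h) ×
      (∀ {x y} → x ∈ X → y ∈ Y → J x y ≡ true)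
  densePair {V} J M h U J-sym M≥1 h≥1 dense big = stage₁ (pickN large H U H≤n)
    where
    B = 4 * M
    H = 2 * (4 * M) * h
    B≥1 : 1 ≤ B
    B≥1 = ≤-trans M≥1 (m≤m+n M (3 * M))
    f : V → ℕ
    f u = cnt (J u) U
    large : V → Bool
    large u = length U ≤ᵇ 2 * M * f u
    n = cnt large U
    4MH≤ : 4 * M * H ≤ length U
    4MH≤ = ≤-trans (m≤m+n _ _) big
    U≥1 : 1 ≤ length U
    U≥1 = ≤-trans (*-mono-≤ B≥1 (*-mono-≤ (≤-trans B≥1 (m≤m+n B (B + 0))) h≥1)) 4MH≤
    U≤ : length U ≤ 2 * M * n
    U≤ = cancelˡ (length U) U≥1 (by-lin 0
      (+-mono-≤ (markov f (length U) (2 * M) U (λ {u} _ → cnt≤length (J u) U)) (*-monoʳ-≤ 2 dense))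
      (e (length U) M n (Σl f U)))
      where
      e : ∀ u M n s → u * u + (2 * M * u * n + u * u + 2 * (M * s)) + 0 ≡ u * (2 * M * n) + (2 * M * s + 2 * (u * u))
      e = solve-∀
    H≤n : H ≤ n
    H≤n = cancelˡ (2 * M) (≤-trans M≥1 (m≤m+n M (M + 0))) (≤-trans (≤-trans (*-monoˡ-≤ H (*-monoˡ-≤ M (s≤s (s≤s (z≤n {2}))))) 4MH≤) U≤)
    Pair : Set
    Pair = ∃[ X ] ∃[ Y ] ∃[ rest ] (U ↭ X ++ (Y ++ rest)) × (length X ≡ h) × (length Y ≡ h) ×
      (∀ {x y} → x ∈ X → y ∈ Y → J x y ≡ true)
    stage₂ : ∀ P₀ W → U ↭ P₀ ++ W → Refined J h (λ (_ : Fin 1) → P₀) W → Pair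
    stage₂ P₀ W e R = sub Fin.zero , new , rest ++ lost Fin.zero ,
      ↭-trans e (↭-trans (++⁺ (Ps↭ Fin.zero) W↭) (rearrange (sub Fin.zero) (lost Fin.zero) new rest)) ,
      sub-len Fin.zero , new-len , joined Fin.zero
      where
      open Refined R
      rearrange : (a b c d : List V) → (a ++ b) ++ c ++ d ↭ a ++ (c ++ (d ++ b))
      rearrange a b c d = ↭-trans (↭-++-assoc a b (c ++ d)) (++⁺ˡ a (↭-trans (↭-++-comm b (c ++ d)) (↭-++-assoc c d b)))
    stage₁ : (∃[ ys ] ∃[ zs ] (U ↭ ys ++ zs) × (length ys ≡ H) × (∀ {y} → y ∈ ys → large y ≡ true)) → Pair
    stage₁ (P₀ , W , e , lP , lg) = stage₂ P₀ W e (refine J 0 1 B h (λ _ → P₀) W h≥1 B≥1 (λ _ → lP) (λ _ p∈ → deg p∈) ≤-refl W-big)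
      where
      lenU : length U ≡ H + length W
      lenU = trans (↭-len P₀ W e) (cong (_+ length W) lP)
      W-big : refineBound 0 B h ≤ length W
      W-big = +-cancelˡ-≤ H _ _ (≤-trans (≤-trans (≤-reflexive (+-comm H _)) (≤-trans (m≤n+m _ (4 * M * H)) big)) (≤-reflexive lenU))
      deg : ∀ {p} → p ∈ P₀ → 1 * length W ≤ B * cnt (J p) W
      deg {p} p∈ = by-lin H (+-mono-≤ (≤-reflexive (sym lenU)) (+-mono-≤ 4MH≤
          (*-monoʳ-≤ 2 (≤-trans (≤ᵇ-≤ {length U} (lg p∈)) (*-monoʳ-≤ (2 * M) (≤-trans (cnt-++≤ (J p) P₀ W e) (≤-reflexive (cong (_+ cnt (J p) W) lP))))))))
          (≤-eq (length W) (length U) H M (cnt (J p) W))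
        where
        ≤-eq : ∀ w u H M c → 1 * w + (u + (u + 2 * (2 * M * (H + c)))) + H ≡ 4 * M * c + (H + w + (4 * M * H + 2 * u))
        ≤-eq = solve-∀

  -- A blow-up of a complete graph in `K` in which one pair of parts is joined in `J`: the place for
  -- the prescribed edge.
  record Blowup {V : Set} (K J : V → V → Bool) (l h : ℕ) (U : List V) : Set where
    field
      parts : Fin l → List V
      rest : List V
      U↭ : U ↭ flat parts ++ rest
      len : ∀ i → length (parts i) ≡ h
      complete : ∀ i j → i ≢ j → ∀ {p q} → p ∈ parts i → q ∈ parts j → K p q ≡ true
      i₀ i₁ : Fin l
      i₀≢i₁ : i₀ ≢ i₁
      special : ∀ {p q} → p ∈ parts i₀ → q ∈ parts i₁ → J p q ≡ true

  -- A new class divides the size of the others by `2 * Q`, so the preceding blow-up needs parts of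
  -- size `2 * Q * h`. The other summands pay for deleting that blow-up and for `refine`.
  blowBound : (Q M k h : ℕ) → ℕ
  blowBound Q M zero h = pairBound M h
  blowBound Q M (suc k) h = blowBound Q M k (2 * Q * h) + (Q * ((2 + k) * (2 * Q * h)) + ((2 + k) * (2 * Q * h) + refineBound (suc k) Q h))

  -- The special pair comes from `J` at the start and afterwards only shrinks, while new parts are
  -- found in `K`. The hypothesis on `jm` says `P / Q ≥ 1 - 1 / jm`, the density that the last part
  -- may require.
  blowup : {V : Set} (P Q M jm : ℕ) (K J : V → V → Bool) (U : List V) → 1 ≤ M → 1 ≤ Q → P ≤ Q → jm * Q ≤ jm * P + Q →
    Symmetric K → Symmetric J → (∀ u v → J u v ≡ true → K u v ≡ true) →
    (∀ {v} → v ∈ U → (2 + P) * length U ≤ Q * cnt (K v) U) → Dense M J U →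
    ∀ k h → suc k ≤ jm → 1 ≤ h → blowBound Q M k h ≤ length U → Blowup K J (2 + k) h U
  blowup {V} P Q M jm K J U M≥1 Q≥1 P≤Q jmQ K-sym J-sym J⊆K deg dense = go
    where
    two : ∀ h → (∃[ X ] ∃[ Y ] ∃[ rest ] (U ↭ X ++ (Y ++ rest)) × (length X ≡ h) × (length Y ≡ h) ×
      (∀ {x y} → x ∈ X → y ∈ Y → J x y ≡ true)) → Blowup K J 2 h U
    two h (X , Y , rest , e , lX , lY , j) = record
      { parts = pt ; rest = rest
      ; U↭ = ↭-trans e (↭-reflexive (trans (sym (++-assoc X Y rest)) (cong (λ z → (X ++ z) ++ rest) (sym (++-identityʳ Y)))))
      ; len = λ { Fin.zero → lX ; (Fin.suc Fin.zero) → lY }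
      ; complete = comp
      ; i₀ = Fin.zero ; i₁ = Fin.suc Fin.zero ; i₀≢i₁ = λ () ; special = j }
      where
      open import Data.List.Properties using (++-assoc; ++-identityʳ)
      pt : Fin 2 → List V
      pt Fin.zero = X
      pt (Fin.suc Fin.zero) = Y
      comp : ∀ i j → i ≢ j → ∀ {p q} → p ∈ pt i → q ∈ pt j → K p q ≡ true
      comp Fin.zero Fin.zero ne _ _ = contradiction refl ne
      comp Fin.zero (Fin.suc Fin.zero) _ p∈ q∈ = J⊆K _ _ (j p∈ q∈)
      comp (Fin.suc Fin.zero) Fin.zero _ {p} {q} p∈ q∈ = J⊆K _ _ (trans (J-sym p q) (j q∈ p∈))
      comp (Fin.suc Fin.zero) (Fin.suc Fin.zero) ne _ _ = contradiction refl ne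
    density : ∀ j → suc j ≤ jm → suc (j * Q) ≤ suc j * suc P
    density j j<jm = ≤-trans (s≤s le) (≤-trans (s≤s (m≤m+n _ j)) (≤-reflexive (e₂ j P)))
      where
      e₂ : ∀ j P → suc (suc j * P + j) ≡ suc j * suc P
      e₂ = solve-∀
      δ = Q ∸ P
      Q≡ : Q ≡ P + δ
      Q≡ = sym (m+[n∸m]≡n P≤Q)
      jmδ : jm * δ ≤ Q
      jmδ = +-cancelˡ-≤ (jm * P) _ _ (≤-trans (≤-reflexive (trans (sym (*-distribˡ-+ jm P δ)) (cong (jm *_) (sym Q≡)))) jmQ)
      le : j * Q ≤ suc j * P
      le = +-cancelˡ-≤ Q _ _ (begin
        Q + j * Q ≡⟨⟩
        suc j * Q ≡⟨ cong (suc j *_) Q≡ ⟩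
        suc j * (P + δ) ≡⟨ *-distribˡ-+ (suc j) P δ ⟩
        suc j * P + suc j * δ ≤⟨ +-monoʳ-≤ (suc j * P) (≤-trans (*-monoˡ-≤ δ j<jm) jmδ) ⟩
        suc j * P + Q ≡⟨ +-comm (suc j * P) Q ⟩
        Q + suc j * P ∎)
        where open ≤-Reasoning
    next : ∀ k h (Bl : Blowup K J (2 + k) (2 * Q * h) U) → Refined K h (Blowup.parts Bl) (Blowup.rest Bl) → Blowup K J (3 + k) h U
    next k h Bl R = record
      { parts = pt ; rest = R.rest ++ flat R.lost
      ; U↭ = ↭-trans Bl.U↭ (↭-trans (++⁺ (flat-split Bl.parts R.sub R.lost R.Ps↭) R.W↭) (rearrange (flat R.sub) (flat R.lost) R.new R.rest))
      ; len = λ { Fin.zero → R.new-len ; (Fin.suc i) → R.sub-len i }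
      ; complete = comp
      ; i₀ = Fin.suc Bl.i₀ ; i₁ = Fin.suc Bl.i₁
      ; i₀≢i₁ = λ { refl → Bl.i₀≢i₁ refl }
      ; special = λ p∈ q∈ → Bl.special (up Bl.i₀ p∈) (up Bl.i₁ q∈) }
      where
      module Bl = Blowup Bl
      module R = Refined R
      pt : Fin (3 + k) → List V
      pt Fin.zero = R.new
      pt (Fin.suc i) = R.sub i
      up : ∀ i {p} → p ∈ R.sub i → p ∈ Bl.parts i
      up i = ∈-subˡ (R.sub i) (R.lost i) (R.Ps↭ i)
      comp : ∀ i j → i ≢ j → ∀ {p q} → p ∈ pt i → q ∈ pt j → K p q ≡ true
      comp Fin.zero Fin.zero ne _ _ = contradiction refl ne
      comp Fin.zero (Fin.suc j) _ {p} {q} p∈ q∈ = trans (K-sym p q) (R.joined j q∈ p∈)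
      comp (Fin.suc i) Fin.zero _ p∈ q∈ = R.joined i p∈ q∈
      comp (Fin.suc i) (Fin.suc j) ne p∈ q∈ = Bl.complete i j (λ e → ne (cong Fin.suc e)) (up i p∈) (up j q∈)
      rearrange : (a b c d : List V) → (a ++ b) ++ c ++ d ↭ (c ++ a) ++ (d ++ b)
      rearrange a b c d = ↭-trans (↭-++-comm (a ++ b) (c ++ d)) (↭-trans (↭-++-assoc c d (a ++ b))
        (↭-trans (++⁺ˡ c (shifts d a)) (↭-sym (↭-++-assoc c a (d ++ b)))))
    go : ∀ k h → suc k ≤ jm → 1 ≤ h → blowBound Q M k h ≤ length U → Blowup K J (2 + k) h U
    go zero h _ h≥1 big = two h (densePair J M h U J-sym M≥1 h≥1 dense big)
    go (suc k) h k<jm h≥1 big = next k h Bl (refine K (suc k) (suc P) Q h Bl.parts Bl.rest h≥1 Q≥1 Bl.len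
        (λ i {p} p∈ → drop-degree (suc P) Q (K p) (flat Bl.parts) Bl.rest Bl.U↭ small (deg (∈-subˡ _ _ Bl.U↭ (∈-flat Bl.parts i p∈))))
        (density (suc k) k<jm) W-big)
      where
      H = 2 * Q * h
      Bl = go k H (<⇒≤ k<jm) (*-mono-≤ (≤-trans Q≥1 (m≤m+n Q (Q + 0))) h≥1) (≤-trans (m≤m+n _ _) big)
      module Bl = Blowup Bl
      lenP : length (flat Bl.parts) ≡ (2 + k) * H
      lenP = length-flat Bl.parts H Bl.len
      big′ : Q * ((2 + k) * H) + ((2 + k) * H + refineBound (suc k) Q h) ≤ length U
      big′ = ≤-trans (m≤n+m _ (blowBound Q M k H)) big
      small : Q * length (flat Bl.parts) ≤ length U
      small = ≤-trans (≤-reflexive (cong (Q *_) lenP)) (≤-trans (m≤m+n _ _) big′)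
      W-big : refineBound (suc k) Q h ≤ length Bl.rest
      W-big = +-cancelˡ-≤ ((2 + k) * H) _ _ (≤-trans (≤-trans (m≤n+m _ (Q * ((2 + k) * H))) big′)
        (≤-reflexive (trans (↭-len (flat Bl.parts) Bl.rest Bl.U↭) (cong (_+ length Bl.rest) lenP))))

  -- Copies of F through a prescribed dense graph

  module _ where
    open import Data.Fin using (_≟_)
    open import Data.Fin.Permutation.Components using (transpose; transpose-inverse)
    open import Relation.Nullary.Decidable using (dec-true; dec-false)

    transpose-here : ∀ {n} (i j : Fin n) → transpose i j i ≡ j
    transpose-here i j rewrite dec-true (i ≟ i) refl = refl

    transpose-other : ∀ {n} (i j k : Fin n) → k ≢ i → k ≢ j → transpose i j k ≡ k
    transpose-other i j k ki kj rewrite dec-false (k ≟ i) ki | dec-false (k ≟ j) kj = refl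

    transpose-injective : ∀ {n} (i j : Fin n) {k l} → transpose i j k ≡ transpose i j l → k ≡ l
    transpose-injective i j e = trans (sym (transpose-inverse j i)) (trans (cong (transpose j i) e) (transpose-inverse j i))

    -- Two transpositions of the colours: one sends the colour of `a` to `i₀`, and the other sends
    -- the new colour of `b` to `i₁` and fixes `i₀`. A permutation of colours preserves properness.
    recolour : ∀ {r l} (col : Fin r → Fin l) (a b : Fin r) (i₀ i₁ : Fin l) → col a ≢ col b → i₀ ≢ i₁ →
      ∃[ col′ ] (col′ a ≡ i₀) × (col′ b ≡ i₁) × (∀ x y → col x ≢ col y → col′ x ≢ col′ y)
    recolour col a b i₀ i₁ ab i01 = (λ x → transpose y i₁ (σ (col x))) ,
      trans (cong (transpose y i₁) (transpose-here (col a) i₀)) (transpose-other y i₁ i₀ (λ e → y≢i₀ (sym e)) i01) ,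
      transpose-here y i₁ ,
      λ x z ne e → ne (transpose-injective (col a) i₀ (transpose-injective y i₁ e))
      where
      σ = transpose (col a) i₀
      y = σ (col b)
      y≢i₀ : y ≢ i₀
      y≢i₀ e = ab (transpose-injective (col a) i₀ (trans (transpose-here (col a) i₀) (sym e)))

  -- `EF` lists the edges other than `e₀`, which is prescribed to lie in `J`. With `needK` the graph
  -- `J` lies inside `K`, as the blow-up requires; the other case is that of a bridge.
  Extends : ∀ {r} → Bool → (P Q M nE : ℕ) → Fin r × Fin r → List (Fin r × Fin r) → Set₁
  Extends {r} needK P Q M nE e₀ EF = {V : Set} (U : List V) (K J : V → V → Bool) → nE ≤ length U → Symmetric K → Symmetric J →
    (needK ≡ true → ∀ u v → J u v ≡ true → K u v ≡ true) →
    (∀ {v} → v ∈ U → (2 + P) * length U ≤ Q * cnt (K v) U) → Dense M J U →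
    Σ (Fin r → V) λ τ → ∃[ U′ ] (U ↭ tabulate τ ++ U′) × (J (τ (proj₁ e₀)) (τ (proj₂ e₀)) ≡ true) ×
      (∀ {e} → e ∈ EF → K (τ (proj₁ e)) (τ (proj₂ e)) ≡ true)

  -- A proper colouring with as many colours as parts maps F into the blow-up, and permuting the
  -- colours brings `e₀` to the special pair. Parts of size `r` hold any colour class.
  extends-partite : ∀ {r} (P Q M k : ℕ) (e₀ : Fin r × Fin r) (EF : List (Fin r × Fin r)) (col : Fin r → Fin (2 + k)) →
    1 ≤ r → 1 ≤ M → 1 ≤ Q → P ≤ Q → suc k * Q ≤ suc k * P + Q → col (proj₁ e₀) ≢ col (proj₂ e₀) →
    (∀ {e} → e ∈ EF → col (proj₁ e) ≢ col (proj₂ e)) → Extends true P Q M (blowBound Q M k r) e₀ EF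
  extends-partite {r} P Q M k e₀ EF col r≥1 M≥1 Q≥1 P≤Q kQ ne₀ proper {V} U K J big K-sym J-sym J⊆K deg dense =
    stage (blowup P Q M (suc k) K J U M≥1 Q≥1 P≤Q kQ K-sym J-sym (J⊆K refl) deg dense k r ≤-refl r≥1 big)
    where
    Result : Set
    Result = Σ (Fin r → V) λ τ → ∃[ U′ ] (U ↭ tabulate τ ++ U′) × (J (τ (proj₁ e₀)) (τ (proj₂ e₀)) ≡ true) ×
      (∀ {e} → e ∈ EF → K (τ (proj₁ e)) (τ (proj₂ e)) ≡ true)
    stage : Blowup K J (2 + k) r U → Result
    stage Bl = place (recolour col (proj₁ e₀) (proj₂ e₀) i₀ i₁ ne₀ i₀≢i₁)
      where
      open Blowup Bl
      place : (∃[ col′ ] (col′ (proj₁ e₀) ≡ i₀) × (col′ (proj₂ e₀) ≡ i₁) × (∀ x y → col x ≢ col y → col′ x ≢ col′ y)) → Result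
      place (col′ , e₁ , e₂ , pr) = final (transversal (2 + k) r parts col′ len)
        where
        final : (∃[ τ ] ∃[ left ] (flat parts ↭ tabulate τ ++ left) × (∀ v → τ v ∈ parts (col′ v))) → Result
        final (τ , left , e , mem) = τ , left ++ rest ,
          ↭-trans U↭ (↭-trans (++⁺ʳ rest e) (↭-++-assoc (tabulate τ) left rest)) ,
          special (subst (λ i → τ (proj₁ e₀) ∈ parts i) e₁ (mem (proj₁ e₀))) (subst (λ i → τ (proj₂ e₀) ∈ parts i) e₂ (mem (proj₂ e₀))) ,
          λ {e} e∈ → complete (col′ (proj₁ e)) (col′ (proj₂ e)) (pr _ _ (proper e∈)) (mem _) (mem _)

  bridgeBound : (Q M r : ℕ) → ℕ
  bridgeBound Q M r = pairBound M (2 * Q * r) + (Q * (3 * (2 * Q * r)) + (3 * (2 * Q * r) + refineBound 0 Q r))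

  -- Across the bridge there is a complete bipartite graph X–Y in J; the two sides of F − e₀ are then
  -- found in complete bipartite graphs X–X₂ and Y–Y₂ of K.
  extends-bridge : ∀ {r} (P Q M : ℕ) (e₀ : Fin r × Fin r) (EF : List (Fin r × Fin r)) (col side : Fin r → Bool) →
    1 ≤ r → 1 ≤ M → 1 ≤ Q → (side (proj₁ e₀) ≡ true) → (side (proj₂ e₀) ≡ false) →
    (∀ {e} → e ∈ EF → side (proj₁ e) ≡ side (proj₂ e)) →
    (∀ {e} → e ∈ EF → col (proj₁ e) ≡ not (col (proj₂ e))) → Extends false P Q M (bridgeBound Q M r) e₀ EF
  extends-bridge {r} P Q M e₀@(a₀ , b₀) EF col side r≥1 M≥1 Q≥1 sa sb same proper {V} U K J big K-sym J-sym _ deg dense =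
    stage₁ (densePair J M H U J-sym M≥1 H≥1 dense (≤-trans (m≤m+n _ _) big))
    where
    H = 2 * Q * r
    H≥1 : 1 ≤ H
    H≥1 = *-mono-≤ (≤-trans Q≥1 (m≤m+n Q (Q + 0))) r≥1
    r≤H : r ≤ H
    r≤H = ≤-trans (≤-reflexive (sym (*-identityˡ r))) (*-monoˡ-≤ r (≤-trans Q≥1 (m≤m+n Q (Q + 0))))
    Result : Set
    Result = Σ (Fin r → V) λ τ → ∃[ U′ ] (U ↭ tabulate τ ++ U′) × (J (τ a₀) (τ b₀) ≡ true) ×
      (∀ {e} → e ∈ EF → K (τ (proj₁ e)) (τ (proj₂ e)) ≡ true)
    big′ : Q * (3 * H) + (3 * H + refineBound 0 Q r) ≤ length U
    big′ = ≤-trans (m≤n+m _ (pairBound M H)) big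
    -- `X` and `Y` are deleted and, when `Y` is extended, also the class attached to `X`; hence
    -- `3 * H`.
    extend : ∀ Z X W → U ↭ X ++ W → length X ≤ 3 * H → length Z ≡ H → (∀ {z} → z ∈ Z → z ∈ U) → Refined K r (λ (_ : Fin 1) → Z) W
    extend Z X W e lX lZ Z⊆ = refine K 0 (suc P) Q r (λ _ → Z) W r≥1 Q≥1 (λ _ → lZ)
      (λ _ {p} p∈ → drop-degree (suc P) Q (K p) X W e (≤-trans (*-monoʳ-≤ Q lX) (≤-trans (m≤m+n _ _) big′)) (deg (Z⊆ p∈)))
      (s≤s z≤n)
      (+-cancelˡ-≤ (3 * H) _ _ (≤-trans (≤-trans (m≤n+m _ (Q * (3 * H))) big′) (≤-trans (≤-reflexive (↭-len X W e)) (+-monoˡ-≤ (length W) lX))))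
    stage₃ : ∀ X Y rest → U ↭ X ++ (Y ++ rest) → (∀ {x y} → x ∈ X → y ∈ Y → J x y ≡ true) →
      (RX : Refined K r (λ (_ : Fin 1) → X) rest) → Refined K r (λ (_ : Fin 1) → Y) (Refined.rest RX) → Result
    stage₃ X Y rest e j RX RY = final (transversal 4 r parts idx lens)
      where
      module X = Refined RX
      module Y = Refined RY
      parts : Fin 4 → List V
      parts Fin.zero = X.sub Fin.zero
      parts (Fin.suc Fin.zero) = X.new
      parts (Fin.suc (Fin.suc Fin.zero)) = Y.sub Fin.zero
      parts (Fin.suc (Fin.suc (Fin.suc Fin.zero))) = Y.new
      lens : ∀ i → length (parts i) ≡ r
      lens Fin.zero = X.sub-len Fin.zero
      lens (Fin.suc Fin.zero) = X.new-len
      lens (Fin.suc (Fin.suc Fin.zero)) = Y.sub-len Fin.zero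
      lens (Fin.suc (Fin.suc (Fin.suc Fin.zero))) = Y.new-len
      code : Bool → Bool → Fin 4
      code true true = Fin.zero
      code true false = Fin.suc Fin.zero
      code false true = Fin.suc (Fin.suc Fin.zero)
      code false false = Fin.suc (Fin.suc (Fin.suc Fin.zero))
      eqv : Bool → Bool → Bool
      eqv true b = b
      eqv false b = not b
      eqv-refl : ∀ b → eqv b b ≡ true
      eqv-refl true = refl
      eqv-refl false = refl
      eqv-not : ∀ a b → eqv a (not b) ≡ not (eqv a b)
      eqv-not true b = refl
      eqv-not false b = refl
      ref : Bool → Bool
      ref true = col a₀
      ref false = col b₀
      -- The part depends on the side and on whether the colour agrees with that of the end of the
      -- bridge on this side. So `a₀` falls into `X` and `b₀` into `Y` whatever their colours are.
      idx : Fin r → Fin 4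
      idx v = code (side v) (eqv (ref (side v)) (col v))
      idx-a : idx a₀ ≡ Fin.zero
      idx-a = trans (cong (λ s → code s (eqv (ref s) (col a₀))) sa) (cong (code true) (eqv-refl (col a₀)))
      idx-b : idx b₀ ≡ Fin.suc (Fin.suc Fin.zero)
      idx-b = trans (cong (λ s → code s (eqv (ref s) (col b₀))) sb) (cong (code false) (eqv-refl (col b₀)))
      flat↭ : ∃[ left ] (U ↭ flat parts ++ left)
      flat↭ = X.lost Fin.zero ++ (Y.lost Fin.zero ++ Y.rest) , ↭-trans e (↭-trans (++⁺ (X.Ps↭ Fin.zero) (++⁺ (Y.Ps↭ Fin.zero) (↭-trans X.W↭ (++⁺ˡ X.new Y.W↭))))
        (rearrange (X.sub Fin.zero) (X.lost Fin.zero) (Y.sub Fin.zero) (Y.lost Fin.zero) X.new Y.new Y.rest))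
        where
        open import Data.List.Properties using (++-assoc; ++-identityʳ)
        rearrange : (a b c d x y z : List V) → (a ++ b) ++ ((c ++ d) ++ (x ++ (y ++ z))) ↭ (a ++ (x ++ (c ++ (y ++ [])))) ++ (b ++ (d ++ z))
        rearrange a b c d x y z = ↭-trans (↭-++-assoc a b _) (↭-trans (++⁺ˡ a inner) (↭-sym (↭-trans (↭-reflexive (++-assoc a _ _)) (++⁺ˡ a
            (↭-trans (↭-reflexive (++-assoc x _ _)) (++⁺ˡ x (↭-trans (↭-reflexive (++-assoc c _ _)) (++⁺ˡ c (↭-reflexive (cong (_++ (b ++ (d ++ z))) (++-identityʳ y)))))))))))
          where
          inner : b ++ ((c ++ d) ++ (x ++ (y ++ z))) ↭ x ++ (c ++ (y ++ (b ++ (d ++ z))))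
          inner = ↭-trans (++⁺ˡ b (↭-trans (shifts (c ++ d) x) (++⁺ˡ x (↭-trans (↭-++-assoc c d (y ++ z)) (++⁺ˡ c (shifts d y))))))
            (↭-trans (shifts b x) (++⁺ˡ x (↭-trans (shifts b c) (++⁺ˡ c (shifts b y)))))
      upX : ∀ {p} → p ∈ X.sub Fin.zero → p ∈ X
      upX = ∈-subˡ _ _ (X.Ps↭ Fin.zero)
      upY : ∀ {p} → p ∈ Y.sub Fin.zero → p ∈ Y
      upY = ∈-subˡ _ _ (Y.Ps↭ Fin.zero)
      adjacent : ∀ s c c′ {p q} → c ≡ not c′ → p ∈ parts (code s c) → q ∈ parts (code s c′) → K p q ≡ true
      adjacent true true false {p} {q} _ p∈ q∈ = X.joined Fin.zero p∈ q∈
      adjacent true false true {p} {q} _ p∈ q∈ = trans (K-sym p q) (X.joined Fin.zero q∈ p∈)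
      adjacent false true false {p} {q} _ p∈ q∈ = Y.joined Fin.zero p∈ q∈
      adjacent false false true {p} {q} _ p∈ q∈ = trans (K-sym p q) (Y.joined Fin.zero q∈ p∈)
      final : (∃[ τ ] ∃[ left ] (flat parts ↭ tabulate τ ++ left) × (∀ v → τ v ∈ parts (idx v))) → Result
      final (τ , left , eτ , mem) = τ , left ++ proj₁ flat↭ ,
        ↭-trans (proj₂ flat↭) (↭-trans (++⁺ʳ (proj₁ flat↭) eτ) (↭-++-assoc (tabulate τ) left (proj₁ flat↭))) ,
        j (upX (subst (λ i → τ a₀ ∈ parts i) idx-a (mem a₀))) (upY (subst (λ i → τ b₀ ∈ parts i) idx-b (mem b₀))) ,
        λ {e} e∈ → adj (proj₁ e) (proj₂ e) (same e∈) (proper e∈)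
        where
        adj : ∀ x y → side x ≡ side y → col x ≡ not (col y) → K (τ x) (τ y) ≡ true
        adj x y s c = adjacent (side y) (eqv (ref (side y)) (col x)) (eqv (ref (side y)) (col y))
          (trans (cong (eqv (ref (side y))) c) (eqv-not (ref (side y)) (col y)))
          (subst (λ s′ → τ x ∈ parts (code s′ (eqv (ref s′) (col x)))) s (mem x)) (mem y)
    stage₂ : ∀ X Y rest → U ↭ X ++ (Y ++ rest) → length X ≡ H → length Y ≡ H → (∀ {x y} → x ∈ X → y ∈ Y → J x y ≡ true) →
      Refined K r (λ (_ : Fin 1) → X) rest → Result
    stage₂ X Y rest e lX lY j RX = stage₃ X Y rest e j RX (extend Y ((X ++ Y) ++ R.new) R.rest
        (↭-trans e (↭-trans (↭-sym (↭-++-assoc X Y rest)) (↭-trans (++⁺ˡ (X ++ Y) R.W↭) (↭-sym (↭-++-assoc (X ++ Y) R.new R.rest)))))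
        (≤-trans (≤-reflexive (trans (length-++ (X ++ Y)) (cong₂ _+_ (trans (length-++ X) (cong₂ _+_ lX lY)) R.new-len)))
          (≤-trans (+-monoʳ-≤ (H + H) r≤H) (≤-reflexive (e₃ H))))
        lY (λ {z} z∈ → ∈-resp-↭ (↭-sym e) (∈-++⁺ʳ X (∈-++⁺ˡ z∈))))
      where
      module R = Refined RX
      e₃ : ∀ H → H + H + H ≡ 3 * H
      e₃ = solve-∀
    stage₁ : (∃[ X ] ∃[ Y ] ∃[ rest ] (U ↭ X ++ (Y ++ rest)) × (length X ≡ H) × (length Y ≡ H) ×
      (∀ {x y} → x ∈ X → y ∈ Y → J x y ≡ true)) → Result
    stage₁ (X , Y , rest , e , lX , lY , j) = stage₂ X Y rest e lX lY j (extend X (X ++ Y) rest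
        (↭-trans e (↭-sym (↭-++-assoc X Y rest)))
        (≤-trans (≤-reflexive (trans (length-++ X) (cong₂ _+_ lX lY))) (≤-trans (m≤m+n (H + H) H) (≤-reflexive (e₃ H))))
        lX (λ {z} z∈ → ∈-resp-↭ (↭-sym e) (∈-++⁺ˡ z∈)))
      where
      e₃ : ∀ H → H + H + H ≡ 3 * H
      e₃ = solve-∀

  -- Almost-cliques of overlapping colours

  Σl-map : {A B : Set} (f : B → ℕ) (g : A → B) (xs : List A) → Σl f (map g xs) ≡ Σl (λ x → f (g x)) xs
  Σl-map f g [] = refl
  Σl-map f g (x ∷ xs) = cong (f (g x) +_) (Σl-map f g xs)

  Σl-× : {A B : Set} (f : A × B → ℕ) (xs : List A) (ys : List B) →
    Σl f (cartesianProduct xs ys) ≡ Σl (λ x → Σl (λ y → f (x , y)) ys) xs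
  Σl-× f [] ys = refl
  Σl-× f (x ∷ xs) ys = trans (Σl-++ f (map (x ,_) ys) (cartesianProduct xs ys)) (cong₂ _+_ (Σl-map f (x ,_) ys) (Σl-× f xs ys))

  -- A lost pair has its first or its second entry in `X`, which gives the factor 2.
  cnt-×-drop : {V : Set} (g : V × V → Bool) (Vs X U : List V) → Vs ↭ X ++ U →
    cnt g (cartesianProduct Vs Vs) ≤ cnt g (cartesianProduct U U) + 2 * (length X * length Vs)
  cnt-×-drop g Vs X U e = begin
    cnt g (cartesianProduct Vs Vs) ≡⟨ Σl-× _ Vs Vs ⟩
    Σl (row Vs) Vs ≡⟨ trans (Σl-↭ (row Vs) e) (Σl-++ (row Vs) X U) ⟩
    Σl (row Vs) X + Σl (row Vs) U ≤⟨ +-mono-≤ (Σl-≤-const X (λ {u} _ → cnt≤length (λ v → g (u , v)) Vs))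
                                                                (Σl-mono U (λ {u} _ → cnt-++≤ (λ v → g (u , v)) X U e)) ⟩
    length X * length Vs + Σl (λ u → length X + row U u) U ≡⟨ cong (length X * length Vs +_) (trans (Σl-+ (λ _ → length X) (row U) U) (cong (_+ Σl (row U) U) (Σl-const (length X) U))) ⟩
    length X * length Vs + (length U * length X + Σl (row U) U) ≤⟨ +-monoʳ-≤ (length X * length Vs) (+-monoˡ-≤ _ (*-monoˡ-≤ (length X) (↭-len≤ʳ X U e))) ⟩
    length X * length Vs + (length Vs * length X + Σl (row U) U) ≡⟨ e₁ (length X) (length Vs) (Σl (row U) U) ⟩
    Σl (row U) U + 2 * (length X * length Vs) ≡⟨ cong (_+ 2 * (length X * length Vs)) (Σl-× (λ x → b2n (g x)) U U) ⟨
    cnt g (cartesianProduct U U) + 2 * (length X * length Vs) ∎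
    where
    open ≤-Reasoning
    row : List _ → _ → ℕ
    row ys u = Σl (λ v → b2n (g (u , v))) ys
    e₁ : ∀ x v s → x * v + (v * x + s) ≡ s + 2 * (x * v)
    e₁ = solve-∀

  search : {A : Set} (p : A → Bool) (xs : List A) → (∃[ x ] (x ∈ xs) × (p x ≡ true)) ⊎ (∀ {x} → x ∈ xs → p x ≡ false)
  search p [] = inj₂ λ ()
  search p (x ∷ xs) with p x in eq | search p xs
  ... | true | _ = inj₁ (x , here refl , eq)
  ... | false | inj₁ (y , y∈ , py) = inj₁ (y , there y∈ , py)
  ... | false | inj₂ h = inj₂ λ { (here refl) → eq ; (there i) → h i }

  ≤ᵇ-false : ∀ a b → (a ≤ᵇ b) ≡ false → b < a
  ≤ᵇ-false a b e = ≰⇒> λ le → true≢false (trans (sym (≤ᵇ-true le)) e)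

  -- Dense sets G c cannot be pairwise almost disjoint, so repeatedly passing to the colours far from a
  -- badly connected one stops after 2Q steps.
  module NearClique {A C : Set} (Ω : List A) (G : C → A → Bool) (Cs : List C) (Q D : ℕ) where

    -- Up to `2 * Q` overlaps of density below `1 / M₁` add up to at most `1 / (2 * Q)`, half of the
    -- density guaranteed for each set.
    M₁ : ℕ
    M₁ = 2 * Q * (2 * Q)

    near : C → C → Bool
    near c z = length Ω ≤ᵇ M₁ * cnt (λ ω → G c ω ∧ G z ω) Ω

    size : (C → Bool) → ℕ
    size p = cnt p Cs

    far : (C → Bool) → C → C → Bool
    far p z c = p c ∧ not (near c z)

    Result : Set
    Result = ∃[ inB ] (length Cs ≤ D ^ (2 * Q) * size inB) × (∀ {z} → z ∈ Cs → inB z ≡ true → D * size (far inB z) ≤ size inB)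

    private
      or : ∀ x y → b2n (x ∨ y) + b2n (y ∧ x) ≡ b2n x + b2n y
      or true true = refl
      or true false = refl
      or false true = refl
      or false false = refl

      and-or : ∀ g x y → b2n (g ∧ (x ∨ y)) ≤ b2n (g ∧ x) + b2n (g ∧ y)
      and-or true true y = s≤s z≤n
      and-or true false y = ≤-refl
      and-or false x y = z≤n

    -- `Y` is the union of the `j` sets chosen so far, and `inX` holds colours far from all of them.
    -- A further set meets `Y` in at most `1 / (2 * Q)` of `Ω` and so adds at least as much; with
    -- `2 * Q + 1` sets the union would outgrow `Ω`.
    extract : 1 ≤ Q → 1 ≤ D → 1 ≤ length Ω → (∀ {c} → c ∈ Cs → length Ω ≤ Q * cnt (G c) Ω) →
      ∀ k j → j + k ≡ suc (2 * Q) → (Y : A → Bool) (inX : C → Bool) →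
      (∀ {x} → x ∈ Cs → inX x ≡ true → M₁ * cnt (λ ω → G x ω ∧ Y ω) Ω ≤ j * length Ω) →
      j * length Ω ≤ 2 * Q * cnt Y Ω → length Cs ≤ D ^ j * size inX → Result
    extract Q≥1 D≥1 Ω≥1 dense zero j jk Y inX a b c = contradiction (≤-trans b (*-monoʳ-≤ (2 * Q) (cnt≤length Y Ω)))
      (<⇒≱ (≤-trans (s≤s ≤-refl) (≤-trans (≤-reflexive (+-comm 1 (2 * Q * length Ω))) (≤-trans (+-monoʳ-≤ (2 * Q * length Ω) Ω≥1)
        (≤-reflexive (trans (+-comm (2 * Q * length Ω) (length Ω)) (cong (_* length Ω) (sym (trans (sym (+-identityʳ j)) jk)))))))))
    extract Q≥1 D≥1 Ω≥1 dense (suc k) j jk Y inX a b c with search (λ z → inX z ∧ (suc (size inX) ≤ᵇ D * size (far inX z))) Cs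
    ... | inj₂ none = inX , ≤-trans c (*-monoˡ-≤ (size inX) (^-mono (s≤s⁻¹ (≤-trans (≤-trans (s≤s (m≤m+n j k)) (≤-reflexive (sym (+-suc j k)))) (≤-reflexive jk))))) ,
          λ {z} z∈ Bz → s≤s⁻¹ (≤ᵇ-false (suc (size inX)) (D * size (far inX z)) (trans (sym (cong (_∧ (suc (size inX) ≤ᵇ D * size (far inX z))) Bz)) (none z∈)))
      where
      ^-mono : j ≤ 2 * Q → D ^ j ≤ D ^ (2 * Q)
      ^-mono le = mono D D≥1 le
        where
        mono : ∀ D → 1 ≤ D → ∀ {j k} → j ≤ k → D ^ j ≤ D ^ k
        mono (suc D) _ le = ^-monoʳ-≤ (suc D) le
    ... | inj₁ (z , z∈ , pz) = extract Q≥1 D≥1 Ω≥1 dense k (suc j) (trans (sym (+-suc j k)) jk) Y′ (far inX z) a′ b′ c′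
      where
      open ≤-Reasoning
      Xz : inX z ≡ true
      Xz = proj₁ (∧-true pz)
      many : suc (size inX) ≤ D * size (far inX z)
      many = ≤ᵇ-≤ {suc (size inX)} (proj₂ (∧-true {inX z} pz))
      Y′ : A → Bool
      Y′ ω = Y ω ∨ G z ω
      j≤ : j ≤ 2 * Q
      j≤ = s≤s⁻¹ (≤-trans (≤-trans (s≤s (m≤m+n j k)) (≤-reflexive (sym (+-suc j k)))) (≤-reflexive jk))
      a′ : ∀ {x} → x ∈ Cs → far inX z x ≡ true → M₁ * cnt (λ ω → G x ω ∧ Y′ ω) Ω ≤ suc j * length Ω
      a′ {x} x∈ fx = begin
        M₁ * cnt (λ ω → G x ω ∧ Y′ ω) Ω ≤⟨ *-monoʳ-≤ M₁ (≤-trans (Σl-mono Ω (λ {ω} _ → and-or (G x ω) (Y ω) (G z ω))) (≤-reflexive (Σl-+ _ _ Ω))) ⟩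
        M₁ * (cnt (λ ω → G x ω ∧ Y ω) Ω + cnt (λ ω → G x ω ∧ G z ω) Ω) ≡⟨ *-distribˡ-+ M₁ _ _ ⟩
        M₁ * cnt (λ ω → G x ω ∧ Y ω) Ω + M₁ * cnt (λ ω → G x ω ∧ G z ω) Ω ≤⟨ +-mono-≤ (a x∈ (proj₁ (∧-true fx))) (<⇒≤ (≤ᵇ-false (length Ω) (M₁ * cnt (λ ω → G x ω ∧ G z ω) Ω) (not-true (proj₂ (∧-true {inX x} fx))))) ⟩
        j * length Ω + length Ω ≡⟨ +-comm (j * length Ω) (length Ω) ⟩
        suc j * length Ω ∎
        where
        not-true : ∀ {b} → not b ≡ true → b ≡ false
        not-true {false} _ = refl
      I = cnt (λ ω → G z ω ∧ Y ω) Ω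
      union : cnt Y′ Ω + I ≡ cnt Y Ω + cnt (G z) Ω
      union = trans (sym (Σl-+ _ _ Ω)) (trans (Σl-cong Ω (λ ω → or (Y ω) (G z ω))) (Σl-+ _ _ Ω))
      small : 2 * Q * I ≤ length Ω
      small = cancelˡ (2 * Q) (≤-trans Q≥1 (m≤m+n Q (Q + 0))) (≤-trans (≤-reflexive (sym (*-assoc (2 * Q) (2 * Q) I))) (≤-trans (a z∈ Xz) (*-monoˡ-≤ (length Ω) j≤)))
      b′ : suc j * length Ω ≤ 2 * Q * cnt Y′ Ω
      b′ = by-lin 0 (+-mono-≤ b (+-mono-≤ (*-monoʳ-≤ 2 (dense z∈)) (+-mono-≤ small (≤-reflexive (cong (2 * Q *_) (sym union))))))
        (e₁ j (length Ω) Q (cnt Y′ Ω) I (cnt Y Ω) (cnt (G z) Ω))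
        where
        e₁ : ∀ j o Q y′ i y g → suc j * o + (2 * Q * y + (2 * (Q * g) + (o + 2 * Q * (y′ + i)))) + 0 ≡ 2 * Q * y′ + (j * o + (2 * o + (2 * Q * i + 2 * Q * (y + g))))
        e₁ = solve-∀
      c′ : length Cs ≤ D ^ suc j * size (far inX z)
      c′ = begin
        length Cs ≤⟨ c ⟩
        D ^ j * size inX ≤⟨ *-monoʳ-≤ (D ^ j) (<⇒≤ many) ⟩
        D ^ j * (D * size (far inX z)) ≡⟨ *-assoc (D ^ j) D _ ⟨
        D ^ j * D * size (far inX z) ≡⟨ cong (_* size (far inX z)) (*-comm (D ^ j) D) ⟩
        D ^ suc j * size (far inX z) ∎

    nearClique : 1 ≤ Q → 1 ≤ D → 1 ≤ length Ω → (∀ {c} → c ∈ Cs → length Ω ≤ Q * cnt (G c) Ω) → Result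
    nearClique Q≥1 D≥1 Ω≥1 dense = extract Q≥1 D≥1 Ω≥1 dense (suc (2 * Q)) 0 refl (λ _ → false) (λ _ → true)
      (λ {x} _ _ → ≤-reflexive (trans (cong (M₁ *_) (trans (Σl-cong Ω (λ ω → none (G x ω))) (trans (Σl-const 0 Ω) (*-zeroʳ (length Ω))))) (*-zeroʳ M₁)))
      z≤n (≤-reflexive (sym (trans (*-identityˡ _) (trans (Σl-const 1 Cs) (*-identityʳ _)))))
      where
      none : ∀ b → b2n (b ∧ false) ≡ 0
      none true = refl
      none false = refl

  b2n-∧ : ∀ a b → b2n a * b2n b ≡ b2n (a ∧ b)
  b2n-∧ true b = +-identityʳ (b2n b)
  b2n-∧ false b = refl

  b2n-*-≤ : ∀ a k → b2n a * k ≤ k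
  b2n-*-≤ true k = ≤-reflexive (*-identityˡ k)
  b2n-*-≤ false k = z≤n

  -- Where a prescribed colour may be placed: inside `K` for the blow-up argument, anywhere in the
  -- case of a bridge.
  host : {V : Set} → Bool → (V → V → Bool) → V × V → Bool
  host needK K ω = not needK ∨ K (proj₁ ω) (proj₂ ω)

  degrees-× : {V : Set} (g : V × V → Bool) (Q : ℕ) (U : List V) → (∀ {v} → v ∈ U → length U ≤ Q * cnt (λ u → g (v , u)) U) →
    length U * length U ≤ Q * Σl (λ u → cnt (λ v → g (u , v)) U) U
  degrees-× g Q U h = ≤-trans (Σl-≥-const U h) (≤-reflexive (Σl-*ˡ Q _ U))

  weaken : ∀ {a b c} → a ≤ b → ∀ k → b * k ≤ c → a * k ≤ c
  weaken le k h = ≤-trans (*-monoˡ-≤ k le) h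

  -- The sizes of the pieces of the construction when m tiles remain besides the absorber: ρ tiles in the
  -- reservoir R, of which g serve the g colours that the greedy tiling of the other n′ tiles leaves over.
  record Sizes (t Q β S h nE n₀ κ₁ κ₂ x₀ X g n m : ℕ) : Set where
    ρ : ℕ
    ρ = halves κ₁ m
    field
      n′ ζ : ℕ
      m≡ : m ≡ ρ + n′
      tρ≡ : t * ρ ≡ ζ + g
      x₀≤ρ : x₀ ≤ ρ
      Qρ≤ : Q * ρ ≤ m
      lo : 2 ^ κ₂ * x₀ ≤ n′
      hi : n′ ≤ 2 ^ κ₂ * X
      Qg≤ρ : Q * g ≤ ρ
      nE≤ : nE + g ≤ ρ
      n₀≤ : n₀ + g ≤ ρ
      tρ≤h : t * ρ ≤ h
      βρ≤ : β * (ρ + S) ≤ n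

  -- `S` bounds the number of absorbing tiles, which hit every target at least `h` times; each tile
  -- hits a proportion of at least `2 / (x + 1)` of the current weight. `κ₁` halvings lead to the
  -- reservoir, `κ₂` to the parts tiled greedily, of `x₀` to `X` tiles each; a halving costs
  -- `1 / (Q * T)` in density. `2 ^ w` exceeds twice the number of pairs of a colour and a vertex,
  -- which are the constraints on a halving.
  record Parameters (r t P Q nE₁ nE₂ n₀ n : ℕ) : Set where
    M₁ : ℕ
    M₁ = 2 * Q * (2 * Q)
    β : ℕ
    β = (4 * Q) ^ (2 * Q)
    field
      S h x κ₁ κ₂ T x₀ X w g : ℕ
      S₁ : 4 * M₁ * S ≤ n
      S₂ : β * (4 * Q * S) ≤ n
      S₃ : Q * S ≤ n
      S₅ : nE₁ + S ≤ n
      q≡ : 2 * (8 * Q * M₁) ≡ suc x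
      x≥1 : 1 ≤ x
      S≡ : S ≡ x * (2 * h)
      h-big : r * n * (r * n) * (t * n) < 2 ^ h
      T≥1 : 1 ≤ T
      κ₁≤T : κ₁ ≤ T
      κ₂≤T : κ₂ ≤ T
      wx₀ : 8 * (2 * (Q * T)) * (2 * (Q * T)) * w ≤ x₀
      ABx₀ : 2 * ((4 + P) * T + T + Q * T) ≤ x₀
      w-big : 2 * (t * n * (r * n)) < 2 ^ w
      n₀≤x₀ : n₀ ≤ x₀
      g≥1 : 1 ≤ g
      QtX≤g : Q * (t * X) ≤ g
      sizes : ∀ m → m ≤ n → n ≤ m + S → Sizes t Q β S h nE₂ n₀ κ₁ κ₂ x₀ X g n m

  -- Tilings and popular edges

  module Tilings (V C : Set) (adj : C → V → V → Bool) (adj-sym : ∀ c u v → adj c u v ≡ adj c v u)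
    (adj-irr : ∀ c u → adj c u u ≡ false) (r : ℕ) (e₀ : Fin r × Fin r) (EF′ : List (Fin r × Fin r)) where

    EF : List (Fin r × Fin r)
    EF = e₀ ∷ EF′

    t : ℕ
    t = length EF

    edges : List (Fin r → V) → List (V × V)
    edges = edgesOf EF

    fits : C → V × V → Bool
    fits c e = adj c (proj₁ e) (proj₂ e)

    -- Permutations instead of inclusions: every vertex of `U` is covered once and every colour of
    -- `D` is used once, so that pieces can be concatenated without further checks.
    record Tiled (U : List V) (D : List C) : Set where
      constructor tiled
      field
        tiles : List (Fin r → V)
        colours : List ((V × V) × C)
        vs : U ↭ verts tiles
        es : map proj₁ colours ↭ edges tiles
        cs : D ↭ map proj₂ colours
        ok : ∀ {x} → x ∈ colours → fits (proj₂ x) (proj₁ x) ≡ true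
    open Tiled public

    tiled-++ : ∀ {U₁ U₂ D₁ D₂} → Tiled U₁ D₁ → Tiled U₂ D₂ → Tiled (U₁ ++ U₂) (D₁ ++ D₂)
    tiled-++ T₁ T₂ = tiled (tiles T₁ ++ tiles T₂) (colours T₁ ++ colours T₂)
      (↭-trans (++⁺ (vs T₁) (vs T₂)) (↭-reflexive (sym (concatMap-++ tabulate (tiles T₁) (tiles T₂)))))
      (↭-trans (↭-reflexive (map-++ proj₁ (colours T₁) (colours T₂))) (↭-trans (++⁺ (es T₁) (es T₂))
        (↭-reflexive (sym (concatMap-++ _ (tiles T₁) (tiles T₂))))))
      (↭-trans (++⁺ (cs T₁) (cs T₂)) (↭-reflexive (sym (map-++ proj₂ (colours T₁) (colours T₂)))))
      λ {x} i → case ∈-++⁻ (colours T₁) i of λ { (inj₁ j) → ok T₁ j ; (inj₂ j) → ok T₂ j }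

    tiled-↭ : ∀ {U₁ U₂ D₁ D₂} → U₂ ↭ U₁ → D₂ ↭ D₁ → Tiled U₁ D₁ → Tiled U₂ D₂
    tiled-↭ p q (tiled T L v e c o) = tiled T L (↭-trans p v) e (↭-trans q c) o

    length-edges : ∀ Ts → length (edges Ts) ≡ length Ts * t
    length-edges [] = refl
    length-edges (τ ∷ Ts) = trans (length-++ (map (edge τ) EF)) (cong₂ _+_ (length-map _ EF) (length-edges Ts))

    popular : ℕ → List C → V → V → Bool
    popular Q D u v = length D ≤ᵇ Q * cnt (λ i → adj i u v) D

    popular-sym : ∀ Q D u v → popular Q D u v ≡ popular Q D v u
    popular-sym Q D u v = cong (λ k → length D ≤ᵇ Q * k) (Σl-cong D (λ i → cong b2n (adj-sym i u v)))

    popular-irr : ∀ Q D u → 1 ≤ length D → popular Q D u u ≡ false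
    popular-irr Q D u ne with popular Q D u u in eq
    ... | false = refl
    ... | true = contradiction (≤-trans ne (≤-trans (≤ᵇ-≤ eq) (≤-reflexive zero-cnt))) λ ()
      where
      zero-cnt : Q * cnt (λ i → adj i u u) D ≡ 0
      zero-cnt = trans (cong (Q *_) (trans (Σl-cong D (λ i → cong b2n (adj-irr i u))) (trans (Σl-const 0 D) (*-zeroʳ (length D))))) (*-zeroʳ Q)

    -- Counted over all colours, an unpopular neighbour accounts for less than `length D / Q`;
    -- together these use up one unit of `suc A`.
    popular-degree : ∀ A Q D U v → 1 ≤ length D → (∀ {i} → i ∈ D → suc A * length U ≤ Q * cnt (adj i v) U) →
      A * length U ≤ Q * cnt (popular Q D v) U
    popular-degree A Q D U v ne deg = cancelˡ (length D) ne (by-lin 0 tot (e₁ A Q (length D) (length U) (cnt (popular Q D v) U)))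
      where
      open ≤-Reasoning
      e₁ : ∀ A Q d u c → d * (A * u) + (Q * d * c + u * d) + 0 ≡ d * (Q * c) + d * (suc A * u)
      e₁ = solve-∀
      tot : length D * (suc A * length U) ≤ Q * length D * cnt (popular Q D v) U + length U * length D
      tot = begin
        length D * (suc A * length U) ≤⟨ Σl-≥-const D deg ⟩
        Σl (λ i → Q * cnt (adj i v) U) D ≡⟨ Σl-*ˡ Q _ D ⟩
        Q * Σl (λ i → cnt (adj i v) U) D ≡⟨ cong (Q *_) (Σl-swap _ D U) ⟩
        Q * Σl (λ u → cnt (λ i → adj i v u) D) U ≤⟨ markov _ (length D) Q U (λ {u} _ → cnt≤length (λ i → adj i v u) D) ⟩
        Q * length D * cnt (popular Q D v) U + length U * length D ∎

    constraints : List C → List V → List (V → Bool)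
    constraints Cs U = map (λ { (i , v) → adj i v }) (cartesianProduct Cs U)

    length-constraints : ∀ Cs U → length (constraints Cs U) ≡ length Cs * length U
    length-constraints Cs U = trans (length-map _ (cartesianProduct Cs U)) (length-× Cs U)

    ∈-constraints : ∀ {Cs U i v} → i ∈ Cs → v ∈ U → adj i v ∈ constraints Cs U
    ∈-constraints i∈ v∈ = ∈-map⁺ (λ { (i , v) → adj i v }) (∈-cartesianProduct⁺ i∈ v∈)

    constraints-All : ∀ {Cs U} {X : (V → Bool) → Set} → (∀ {i v} → i ∈ Cs → v ∈ U → X (adj i v)) → ∀ {g} → g ∈ constraints Cs U → X g
    constraints-All {Cs} {U} h g∈ with ∈-map⁻ (λ { (i , v) → adj i v }) g∈
    ... | (i , v) , m , refl with ∈-cartesianProduct⁻ Cs U m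
    ... | i∈ , v∈ = h i∈ v∈

    Degrees : ℕ → ℕ → List C → List V → Set
    Degrees A B Cs U = ∀ {i v} → i ∈ Cs → v ∈ U → A * length U ≤ B * cnt (adj i v) U

    split-degrees : ∀ A B w x Cs U → 1 ≤ r → 1 ≤ B → length U ≡ r * x →
      2 * (length Cs * length U) < 2 ^ w → 8 * (2 * B) * (2 * B) * w ≤ ⌊ x /2⌋ → 2 * (A + B) ≤ ⌊ x /2⌋ →
      Degrees (suc A) B Cs U →
      ∃[ L ] ∃[ R ] (U ↭ L ++ R) × (length L ≡ r * ⌈ x /2⌉) × (length R ≡ r * ⌊ x /2⌋) × Degrees A B Cs L × Degrees A B Cs R
    split-degrees A B w x Cs U r≥1 B≥1 lU kw wx AB deg = result
      where
      k = length Cs * length U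
      lenC : length (constraints Cs U) + length (constraints Cs U) ≡ 2 * k
      lenC = trans (cong (λ z → z + z) (length-constraints Cs U)) (cong (k +_) (sym (+-identityʳ k)))
      deg′ : ∀ {g} → g ∈ constraints Cs U → suc A * length U ≤ B * cnt g U
      deg′ = constraints-All {Cs} {U} {λ g → suc A * length U ≤ B * cnt g U} deg
      H : ∃[ L ] ∃[ R ] (U ↭ L ++ R) × (length L ≡ r * ⌈ x /2⌉) × (length R ≡ r * ⌊ x /2⌋) ×
        (∀ {g} → g ∈ constraints Cs U → (A * length L ≤ B * cnt g L) × (A * length R ≤ B * cnt g R))
      H = halve-degrees r x A B w (constraints Cs U) U r≥1 B≥1 lU (subst (_< 2 ^ w) (sym lenC) kw) wx AB deg′
      result : ∃[ L ] ∃[ R ] (U ↭ L ++ R) × (length L ≡ r * ⌈ x /2⌉) × (length R ≡ r * ⌊ x /2⌋) × Degrees A B Cs L × Degrees A B Cs R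
      result = let (L , R , e , lL , lR , f) = H in L , R , e , lL , lR ,
        (λ {i} {v} i∈ v∈ → proj₁ (f (∈-constraints {Cs} {U} {i} {v} i∈ (∈-subˡ L R e v∈)))) ,
        (λ {i} {v} i∈ v∈ → proj₂ (f (∈-constraints {Cs} {U} {i} {v} i∈ (∈-sub L R e v∈))))

    -- Tiling by repeated halving

    cancel-scale : ∀ A Q T k c → 1 ≤ T → A * T * k ≤ Q * T * c → A * k ≤ Q * c
    cancel-scale A Q T k c T≥1 h = cancelˡ T T≥1 (≤-trans (≤-reflexive (e A T k)) (≤-trans h (≤-reflexive (sym (e Q T c)))))
      where
      e : ∀ A T k → T * (A * k) ≡ A * T * k
      e = solve-∀

    module _ (P Q T x₀ w : ℕ) (r≥1 : 1 ≤ r) (Q≥1 : 1 ≤ Q) (T≥1 : 1 ≤ T)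
      (wx₀ : 8 * (2 * (Q * T)) * (2 * (Q * T)) * w ≤ x₀) (ABx₀ : 2 * ((2 + P) * T + T + Q * T) ≤ x₀) (Cs : List C) where

      level≤ : ∀ κ → suc κ ≤ T → 2 * ((2 + P) * T + κ + Q * T) ≤ x₀
      level≤ κ κ<T = ≤-trans (*-monoʳ-≤ 2 (+-monoˡ-≤ (Q * T) (+-monoʳ-≤ ((2 + P) * T) (<⇒≤ κ<T)))) ABx₀

      QT≥1 : 1 ≤ Q * T
      QT≥1 = *-mono-≤ Q≥1 T≥1

      -- Over the denominator `Q * T` a halving costs one unit, so `T` nested halvings cost no more
      -- than a single `1 / Q`.
      split-level : ∀ κ x U → suc κ ≤ T → x₀ ≤ ⌊ x /2⌋ → length U ≡ r * x → 2 * (length Cs * length U) < 2 ^ w →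
        Degrees ((2 + P) * T + suc κ) (Q * T) Cs U →
        ∃[ L ] ∃[ R ] (U ↭ L ++ R) × (length L ≡ r * ⌈ x /2⌉) × (length R ≡ r * ⌊ x /2⌋) ×
          Degrees ((2 + P) * T + κ) (Q * T) Cs L × Degrees ((2 + P) * T + κ) (Q * T) Cs R
      split-level κ x U κ<T big lU kw deg = split-degrees ((2 + P) * T + κ) (Q * T) w x Cs U r≥1 QT≥1 lU kw
        (≤-trans wx₀ big) (≤-trans (level≤ κ κ<T) big)
        (λ {i} {v} i∈ v∈ → subst (λ a → a * length U ≤ Q * T * cnt (adj i v) U) (+-suc ((2 + P) * T) κ) (deg i∈ v∈))

      fewer : ∀ {U : List V} (L : List V) → length L ≤ length U → 2 * (length Cs * length U) < 2 ^ w → 2 * (length Cs * length L) < 2 ^ w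
      fewer L le h = ≤-trans (s≤s (*-monoʳ-≤ 2 (*-monoʳ-≤ (length Cs) le))) h

      shrink : ∀ κ x U → κ ≤ T → x₀ ≤ halves κ x → length U ≡ r * x → 2 * (length Cs * length U) < 2 ^ w →
        Degrees ((2 + P) * T + κ) (Q * T) Cs U →
        ∃[ R ] ∃[ U′ ] (U ↭ R ++ U′) × (length R ≡ r * halves κ x) × Degrees ((2 + P) * T) (Q * T) Cs R
      shrink zero x U _ _ lU _ deg = U , [] , ↭-reflexive (sym (++-identityʳ U)) , lU ,
        (λ {i} {v} i∈ v∈ → subst (λ a → a * length U ≤ Q * T * cnt (adj i v) U) (+-identityʳ ((2 + P) * T)) (deg i∈ v∈))
        where open import Data.List.Properties using (++-identityʳ)
      shrink (suc κ) x U κ<T big lU kw deg =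
        let (L , R , e , _ , lR , _ , dR) = split-level κ x U κ<T (≤-trans big (halves≤ κ ⌊ x /2⌋)) lU kw deg
            (R′ , U′ , e′ , lR′ , dR′) = shrink κ ⌊ x /2⌋ R (<⇒≤ κ<T) big lR (fewer {U} R (↭-len≤ʳ L R e) kw) dR
        in R′ , L ++ U′ , ↭-trans e (↭-trans (++⁺ˡ L e′) (shifts L R′)) , lR′ , dR′

      module _ (n₀ X g : ℕ) (bb : BlackBox V r EF (suc P) Q n₀) (n₀≤x₀ : n₀ ≤ x₀) (g≥1 : 1 ≤ g) (QtX≤g : Q * (t * X) ≤ g) where

        Tiling-of : List V → ℕ → List C → Set
        Tiling-of U x D = ∃[ cs ] ∃[ D′ ] (D ↭ cs ++ D′) × (length cs ≡ t * x) × Tiled U cs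

        -- The `g` colours in excess make the greedy choice work: a popular edge has at least
        -- `length D / Q ≥ g / Q` colours, and the part has at most `t * X ≤ g / Q` edges.
        leaf : ∀ x U D → length U ≡ r * x → x₀ ≤ x → x ≤ X → t * x + g ≤ length D → (∀ {i} → i ∈ D → i ∈ Cs) →
          Degrees ((2 + P) * T) (Q * T) Cs U → Tiling-of U x D
        leaf x U D lU x₀≤x x≤X big D⊆ deg = result
          where
          ne : 1 ≤ length D
          ne = ≤-trans g≥1 (≤-trans (m≤n+m g (t * x)) big)
          K = popular Q D
          degK : ∀ {v} → v ∈ U → suc P * length U ≤ Q * cnt (K v) U
          degK {v} v∈ = popular-degree (suc P) Q D U v ne λ {i} i∈ →
            cancel-scale (2 + P) Q T (length U) (cnt (adj i v) U) T≥1 (deg (D⊆ i∈) v∈)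
          n₀≤ : n₀ ≤ length U
          n₀≤ = ≤-trans n₀≤x₀ (≤-trans x₀≤x (≤-trans (≤-trans (≤-reflexive (sym (*-identityˡ x))) (*-monoˡ-≤ x r≥1)) (≤-reflexive (sym lU))))
          box = bb U x K (popular-sym Q D) (λ u → popular-irr Q D u ne) lU n₀≤ degK
          Ts = proj₁ box
          lenE : length (edges Ts) ≡ t * x
          lenE = trans (length-edges Ts) (trans (cong (_* t) (proj₁ (proj₂ (proj₂ box)))) (*-comm x t))
          enough : ∀ {e} → e ∈ edges Ts → length (edges Ts) ≤ cnt (λ c → fits c e) D
          enough {e} e∈ = cancelˡ Q Q≥1 (begin
            Q * length (edges Ts) ≡⟨ cong (Q *_) lenE ⟩
            Q * (t * x) ≤⟨ *-monoʳ-≤ Q (*-monoʳ-≤ t x≤X) ⟩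
            Q * (t * X) ≤⟨ QtX≤g ⟩
            g ≤⟨ m≤n+m g (t * x) ⟩
            t * x + g ≤⟨ big ⟩
            length D ≤⟨ ≤ᵇ-≤ (proj₂ (proj₂ (proj₂ box)) e∈) ⟩
            Q * cnt (λ c → fits c e) D ∎)
            where open ≤-Reasoning
          col = greedy fits (edges Ts) D enough
          L = proj₁ col
          result : Tiling-of U x D
          result = map proj₂ L , proj₁ (proj₂ col) , proj₁ (proj₂ (proj₂ col)) ,
            trans (length-map proj₂ L) (trans (sym (length-map proj₁ L)) (trans (cong length (proj₁ (proj₂ (proj₂ (proj₂ col))))) lenE)) ,
            tiled Ts L (proj₁ (proj₂ box)) (↭-reflexive (proj₁ (proj₂ (proj₂ (proj₂ col))))) ↭-refl (proj₂ (proj₂ (proj₂ (proj₂ col))))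

        -- Which colours survive until a part is reached depends on the parts before it. Therefore
        -- the degrees are controlled for all of `Cs`, while of `D` only the number of colours is
        -- tracked.
        tile : ∀ κ x U D → κ ≤ T → length U ≡ r * x → 2 ^ κ * x₀ ≤ x → x ≤ 2 ^ κ * X → t * x + g ≤ length D →
          (∀ {i} → i ∈ D → i ∈ Cs) → 2 * (length Cs * length U) < 2 ^ w →
          Degrees ((2 + P) * T + κ) (Q * T) Cs U → Tiling-of U x D
        tile zero x U D _ lU lo hi big D⊆ kw deg = leaf x U D lU (≤-trans (≤-reflexive (sym (*-identityˡ x₀))) lo)
          (≤-trans hi (≤-reflexive (*-identityˡ X))) big D⊆
          (λ {i} {v} i∈ v∈ → subst (λ a → a * length U ≤ Q * T * cnt (adj i v) U) (+-identityʳ ((2 + P) * T)) (deg i∈ v∈))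
        tile (suc κ) x U D κ<T lU lo hi big D⊆ kw deg = result
          where
          x₁ = ⌈ x /2⌉
          x₂ = ⌊ x /2⌋
          -- Both bounds on `x` are even, so they survive halving with either rounding.
          lo₂ : 2 ^ κ * x₀ ≤ x₂
          lo₂ = ≤-trans (≤-reflexive (sym (⌊2*n/2⌋ (2 ^ κ * x₀)))) (⌊n/2⌋-mono (≤-trans (≤-reflexive (sym (*-assoc 2 (2 ^ κ) x₀))) lo))
          hi₁ : x₁ ≤ 2 ^ κ * X
          hi₁ = ≤-trans (⌈n/2⌉-mono (≤-trans hi (≤-reflexive (*-assoc 2 (2 ^ κ) X)))) (≤-reflexive (⌈2*n/2⌉ (2 ^ κ * X)))
          x₂≤x₁ : x₂ ≤ x₁
          x₂≤x₁ = ⌊n/2⌋≤⌈n/2⌉ x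
          x₀≤x₂ : x₀ ≤ x₂
          x₀≤x₂ = ≤-trans (≤-trans (≤-reflexive (sym (*-identityˡ x₀))) (*-monoˡ-≤ x₀ (m^n>0 2 κ))) lo₂
          sum : t * x ≡ t * x₁ + t * x₂
          sum = trans (cong (t *_) (trans (sym (⌊n/2⌋+⌈n/2⌉≡n x)) (+-comm x₂ x₁))) (*-distribˡ-+ t x₁ x₂)
          big₁ : t * x₁ + g ≤ length D
          big₁ = ≤-trans (+-monoˡ-≤ g (≤-trans (m≤m+n (t * x₁) (t * x₂)) (≤-reflexive (sym sum)))) big
          big₂ : ∀ cs₁ D₁ → D ↭ cs₁ ++ D₁ → length cs₁ ≡ t * x₁ → t * x₂ + g ≤ length D₁
          big₂ cs₁ D₁ e₁ lc₁ = +-cancelˡ-≤ (t * x₁) _ _ (begin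
              t * x₁ + (t * x₂ + g) ≡⟨ +-assoc (t * x₁) (t * x₂) g ⟨
              t * x₁ + t * x₂ + g ≡⟨ cong (_+ g) sum ⟨
              t * x + g ≤⟨ big ⟩
              length D ≡⟨ ↭-len cs₁ D₁ e₁ ⟩
              length cs₁ + length D₁ ≡⟨ cong (_+ length D₁) lc₁ ⟩
              t * x₁ + length D₁ ∎)
              where open ≤-Reasoning
          join : ∀ U₁ U₂ → U ↭ U₁ ++ U₂ → ∀ cs₁ D₁ → D ↭ cs₁ ++ D₁ → length cs₁ ≡ t * x₁ → Tiled U₁ cs₁ →
            Tiling-of U₂ x₂ D₁ → Tiling-of U x D
          join U₁ U₂ eU cs₁ D₁ e₁ lc₁ T₁ (cs₂ , D₂ , e₂ , lc₂ , T₂) = cs₁ ++ cs₂ , D₂ ,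
            ↭-trans e₁ (↭-trans (++⁺ˡ cs₁ e₂) (↭-sym (↭-++-assoc cs₁ cs₂ D₂))) ,
            trans (length-++ cs₁) (trans (cong₂ _+_ lc₁ lc₂) (sym sum)) ,
            tiled-↭ eU ↭-refl (tiled-++ T₁ T₂)
          second : ∀ U₁ U₂ → U ↭ U₁ ++ U₂ → length U₂ ≡ r * x₂ → Degrees ((2 + P) * T + κ) (Q * T) Cs U₂ →
            Tiling-of U₁ x₁ D → Tiling-of U x D
          second U₁ U₂ eU l₂ d₂ (cs₁ , D₁ , e₁ , lc₁ , T₁) = join U₁ U₂ eU cs₁ D₁ e₁ lc₁ T₁
            (tile κ x₂ U₂ D₁ (<⇒≤ κ<T) l₂ lo₂ (≤-trans x₂≤x₁ hi₁) (big₂ cs₁ D₁ e₁ lc₁)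
              (λ {i} i∈ → D⊆ (∈-sub cs₁ D₁ e₁ i∈)) (fewer {U} U₂ (↭-len≤ʳ U₁ U₂ eU) kw) d₂)
          first : (∃[ U₁ ] ∃[ U₂ ] (U ↭ U₁ ++ U₂) × (length U₁ ≡ r * x₁) × (length U₂ ≡ r * x₂) ×
            Degrees ((2 + P) * T + κ) (Q * T) Cs U₁ × Degrees ((2 + P) * T + κ) (Q * T) Cs U₂) → Tiling-of U x D
          first (U₁ , U₂ , eU , l₁ , l₂ , d₁ , d₂) = second U₁ U₂ eU l₂ d₂
            (tile κ x₁ U₁ D (<⇒≤ κ<T) l₁ (≤-trans lo₂ x₂≤x₁) hi₁ big₁ D⊆
              (fewer {U} U₁ (≤-trans (m≤m+n _ _) (≤-reflexive (sym (↭-len U₁ U₂ eU)))) kw) d₁)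
          result : Tiling-of U x D
          result = first (split-level κ x U κ<T x₀≤x₂ lU kw deg)

    -- Covering the remaining colours

    -- Every leftover colour occupies the edge `e₀` of its own copy, recorded in `LD`. The other
    -- edges `esD` are merely popular and get their colours through the absorber.
    record Cover (KB : V → V → Bool) (D : List C) (W : List V) : Set where
      field
        TsD : List (Fin r → V)
        LD : List ((V × V) × C)
        esD : List (V × V)
        W′ : List V
        W↭ : W ↭ verts TsD ++ W′
        esD↭ : map proj₁ LD ++ esD ↭ edges TsD
        D≡ : map proj₂ LD ≡ D
        okD : ∀ {y} → y ∈ LD → fits (proj₂ y) (proj₁ y) ≡ true
        popD : ∀ {e} → e ∈ esD → KB (proj₁ e) (proj₂ e) ≡ true
        lenD : length TsD ≡ length D

    Coloured : Set
    Coloured = List ((V × V) × C)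

    Proper : Coloured → Set
    Proper L = ∀ {x} → x ∈ L → fits (proj₂ x) (proj₁ x) ≡ true

    -- The edges of `LA` give up their colours: `L` recolours them together with the pending edges,
    -- using the colours of `LA` and the spare ones `Z`. The rest is accounting for four families of
    -- tiles.
    glue : ∀ {Vs Cs U′ cs} (Ts TsD Ts₂ : List (Fin r → V)) (L LA LO LD : Coloured) (esD : List (V × V)) (U₀ R W′ : List V) (pool Z D : List C) →
      Vs ↭ verts Ts ++ U₀ → U₀ ↭ R ++ U′ → R ↭ verts TsD ++ W′ → W′ ↭ verts Ts₂ →
      map proj₁ LA ++ map proj₁ LO ↭ edges Ts → map proj₁ LD ++ esD ↭ edges TsD →
      Cs ↭ (map proj₂ LA ++ map proj₂ LO) ++ pool → pool ↭ Z ++ (cs ++ D) → map proj₂ LD ≡ D →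
      map proj₁ L ↭ (esD ++ edges Ts₂) ++ map proj₁ LA → map proj₂ L ↭ Z ++ map proj₂ LA →
      Proper L → Proper LO → Proper LD → Tiled U′ cs → Tiled Vs Cs
    glue {Vs} {Cs} {U′} {cs} Ts TsD Ts₂ L LA LO LD esD U₀ R W′ pool Z D U↭ R↭ W↭ W′↭ es↭ esD↭ pool↭ Z↭ D≡ L₁ L₂ okL okO okD T′ =
      tiled-↭ V↭ C↭ (tiled-++ T″ T′)
      where
      tl = Ts ++ (TsD ++ Ts₂)
      cl = L ++ (LO ++ LD)
      rearrange₁ : (a b c d e : List (V × V)) → ((a ++ b) ++ c) ++ (d ++ e) ↭ (c ++ d) ++ ((e ++ a) ++ b)
      rearrange₁ a b c d e = ↭-trans (++⁺ʳ (d ++ e) (↭-++-comm (a ++ b) c)) (↭-trans (↭-++-assoc c (a ++ b) (d ++ e))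
        (↭-trans (++⁺ˡ c (↭-trans (shifts (a ++ b) d) (++⁺ˡ d (↭-trans (↭-++-comm (a ++ b) e) (↭-sym (↭-++-assoc e a b))))))
          (↭-sym (↭-++-assoc c d ((e ++ a) ++ b)))))
      rearrange₂ : (a b z c d : List C) → (a ++ b) ++ (z ++ (c ++ d)) ↭ ((z ++ a) ++ (b ++ d)) ++ c
      rearrange₂ a b z c d = ↭-trans (shifts (a ++ b) z) (↭-trans (++⁺ˡ z (↭-trans (↭-++-assoc a b (c ++ d))
          (++⁺ˡ a (↭-trans (++⁺ˡ b (↭-++-comm c d)) (↭-sym (↭-++-assoc b d c))))))
        (↭-trans (↭-sym (↭-++-assoc z a ((b ++ d) ++ c))) (↭-sym (↭-++-assoc (z ++ a) (b ++ d) c))))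
      T″ : Tiled (verts Ts ++ R) (map proj₂ cl)
      T″ = tiled tl cl
        (↭-trans (++⁺ˡ (verts Ts) (↭-trans W↭ (↭-trans (++⁺ˡ (verts TsD) W′↭) (↭-reflexive (sym (concatMap-++ tabulate TsD Ts₂))))))
          (↭-reflexive (sym (concatMap-++ tabulate Ts (TsD ++ Ts₂)))))
        (↭-trans (↭-reflexive (trans (map-++ proj₁ L (LO ++ LD)) (cong (map proj₁ L ++_) (map-++ proj₁ LO LD))))
          (↭-trans (++⁺ʳ (map proj₁ LO ++ map proj₁ LD) L₁)
          (↭-trans (rearrange₁ esD (edges Ts₂) (map proj₁ LA) (map proj₁ LO) (map proj₁ LD))
          (↭-trans (++⁺ es↭ (++⁺ʳ (edges Ts₂) esD↭))
            (↭-reflexive (sym (trans (concatMap-++ _ Ts (TsD ++ Ts₂)) (cong (edges Ts ++_) (concatMap-++ _ TsD Ts₂)))))))))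
        ↭-refl
        (λ y∈ → case ∈-++⁻ L y∈ of λ { (inj₁ j) → okL j ; (inj₂ j) → case ∈-++⁻ LO j of λ { (inj₁ k) → okO k ; (inj₂ k) → okD k } })
      V↭ : Vs ↭ (verts Ts ++ R) ++ U′
      V↭ = ↭-trans U↭ (↭-trans (++⁺ˡ (verts Ts) R↭) (↭-sym (↭-++-assoc (verts Ts) R U′)))
      C↭ : Cs ↭ map proj₂ cl ++ cs
      C↭ = ↭-trans pool↭ (↭-trans (++⁺ˡ (map proj₂ LA ++ map proj₂ LO) Z↭)
        (↭-trans (rearrange₂ (map proj₂ LA) (map proj₂ LO) Z cs D) (++⁺ʳ cs
          (↭-trans (++⁺ (↭-sym L₂) (↭-reflexive (trans (cong (map proj₂ LO ++_) (sym D≡)) (sym (map-++ proj₂ LO LD)))))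
            (↭-reflexive (sym (map-++ proj₂ L (LO ++ LD))))))))

    module Covering (needK : Bool) (P Q : ℕ) (half : needK ≡ true → Q ≤ 2 * P) where

      -- The place where 1/2 matters: for `Q ≤ 2 * P` two neighbourhoods of density at least
      -- `(2 + P) / Q` have to overlap. Otherwise the colour class alone is dense enough.
      host-degree : (needK ≡ true → Q ≤ 2 * P) → ∀ (K′ : V → V → Bool) c v U → (2 + P) * length U ≤ Q * cnt (K′ v) U →
        (2 + P) * length U ≤ Q * cnt (adj c v) U → length U ≤ Q * cnt (λ u → fits c (v , u) ∧ host needK K′ (v , u)) U
      host-degree half K′ c v U dK dc = go needK half
        where
        u = length U
        go : ∀ b → (b ≡ true → Q ≤ 2 * P) → length U ≤ Q * cnt (λ u → adj c v u ∧ (not b ∨ K′ v u)) U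
        go false _ = ≤-trans (≤-trans (≤-reflexive (sym (*-identityˡ u))) (*-monoˡ-≤ u (s≤s (z≤n {1 + P})))) (≤-trans dc
          (*-monoʳ-≤ Q (cnt-mono U (λ _ h → ∧-intro h refl))))
        go true h = by-lin (3 * u) (+-mono-≤ dK (+-mono-≤ dc (+-mono-≤ (*-monoʳ-≤ Q (cnt-∧ (adj c v) (K′ v) U)) (*-monoˡ-≤ u (h refl)))))
          (e₂ u P Q (cnt (K′ v) U) (cnt (adj c v) U) (cnt (λ u → adj c v u ∧ K′ v u) U))
          where
          e₂ : ∀ u P Q k a z → u + (Q * k + (Q * a + (Q * (z + u) + 2 * P * u))) + 3 * u ≡ Q * z + ((2 + P) * u + ((2 + P) * u + (Q * (a + k) + Q * u)))
          e₂ = solve-∀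

      module Cover-within (Bs : List C) (R : List V) (ρ g nE : ℕ) (r≥1 : 1 ≤ r) (Bs≥1 : 1 ≤ length Bs)
        (lenR : length R ≡ r * ρ) (Qg≤ρ : Q * g ≤ ρ) (nE≤ : nE + g ≤ ρ)
        (degR : ∀ i {v} → v ∈ R → (4 + P) * length R ≤ Q * cnt (adj i v) R) (ext : Extends needK P Q Q nE e₀ EF′) where

        KB : V → V → Bool
        KB = popular Q Bs

        KB-deg : ∀ {v} → v ∈ R → (3 + P) * length R ≤ Q * cnt (KB v) R
        KB-deg {v} v∈ = popular-degree (3 + P) Q Bs R v Bs≥1 (λ {i} _ → degR i v∈)

        -- `X` holds the copies placed so far, at most `r * g ≤ length R / Q` vertices. The degree
        -- loss is measured against `R` each time, so it stays one unit instead of accumulating.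
        cover : ∀ D X W → R ↭ X ++ W → length X + r * length D ≤ r * g → Cover KB D W
        cover [] X W e le = record { TsD = [] ; LD = [] ; esD = [] ; W′ = W ; W↭ = ↭-refl ; esD↭ = ↭-refl ; D≡ = refl
          ; okD = λ () ; popD = λ () ; lenD = refl }
        cover (i ∷ D) X W e le = stage (ext W KB J W-big (popular-sym Q Bs) J-sym J⊆ degW J-dense)
          where
          J : V → V → Bool
          J u v = fits i (u , v) ∧ host needK KB (u , v)
          J-sym : Symmetric J
          J-sym u v = cong₂ _∧_ (adj-sym i u v) (cong (not needK ∨_) (popular-sym Q Bs u v))
          J⊆ : needK ≡ true → ∀ u v → J u v ≡ true → KB u v ≡ true
          J⊆ nk u v j = trans (sym (cong (λ b → not b ∨ KB u v) nk)) (proj₂ (∧-true {fits i (u , v)} j))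
          X≤ : length X ≤ r * g
          X≤ = ≤-trans (m≤m+n _ _) le
          smallX : Q * length X ≤ length R
          smallX = ≤-trans (*-monoʳ-≤ Q X≤) (≤-trans (≤-reflexive (e₁ Q r g)) (≤-trans (*-monoʳ-≤ r Qg≤ρ) (≤-reflexive (sym lenR))))
            where
            e₁ : ∀ Q r p → Q * (r * p) ≡ r * (Q * p)
            e₁ = solve-∀
          degW : ∀ {v} → v ∈ W → (2 + P) * length W ≤ Q * cnt (KB v) W
          degW {v} v∈ = drop-degree (2 + P) Q (KB v) X W e smallX (KB-deg (∈-sub X W e v∈))
          J-dense : Dense Q J W
          J-dense = degrees-× (λ ω → J (proj₁ ω) (proj₂ ω)) Q W λ {v} v∈ → host-degree half KB i v W (degW v∈)
            (weaken (s≤s (s≤s (n≤1+n P))) (length W) (drop-degree (3 + P) Q (adj i v) X W e smallX (degR i (∈-sub X W e v∈))))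
          W-big : nE ≤ length W
          W-big = +-cancelʳ-≤ (r * g) _ _ (begin
            nE + r * g ≤⟨ +-monoˡ-≤ (r * g) (≤-trans (≤-reflexive (sym (*-identityˡ nE))) (*-monoˡ-≤ nE r≥1)) ⟩
            r * nE + r * g ≡⟨ *-distribˡ-+ r nE g ⟨
            r * (nE + g) ≤⟨ *-monoʳ-≤ r nE≤ ⟩
            r * ρ ≡⟨ lenR ⟨
            length R ≡⟨ ↭-len X W e ⟩
            length X + length W ≤⟨ +-monoˡ-≤ (length W) X≤ ⟩
            r * g + length W ≡⟨ +-comm (r * g) _ ⟩
            length W + r * g ∎)
            where open ≤-Reasoning
          stage : (Σ (Fin r → V) λ τ → ∃[ U′ ] (W ↭ tabulate τ ++ U′) × (J (τ (proj₁ e₀)) (τ (proj₂ e₀)) ≡ true) ×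
            (∀ {e} → e ∈ EF′ → KB (τ (proj₁ e)) (τ (proj₂ e)) ≡ true)) → Cover KB (i ∷ D) W
          stage (τ , W₁ , eτ , Jτ , Kτ) = record
            { TsD = τ ∷ A.TsD ; LD = (edge τ e₀ , i) ∷ A.LD ; esD = map (edge τ) EF′ ++ A.esD ; W′ = A.W′
            ; W↭ = ↭-trans eτ (↭-trans (++⁺ˡ (tabulate τ) A.W↭) (↭-sym (↭-++-assoc (tabulate τ) (verts A.TsD) A.W′)))
            ; esD↭ = prep (edge τ e₀) (↭-trans (shifts (map proj₁ A.LD) (map (edge τ) EF′)) (++⁺ˡ (map (edge τ) EF′) A.esD↭))
            ; D≡ = cong (i ∷_) A.D≡
            ; okD = λ { (here refl) → proj₁ (∧-true {fits i (edge τ e₀)} Jτ) ; (there j) → A.okD j }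
            ; popD = λ {y} y∈ → case ∈-++⁻ (map (edge τ) EF′) y∈ of λ { (inj₁ j) → new j ; (inj₂ j) → A.popD j }
            ; lenD = cong suc A.lenD }
            where
            rec : Cover KB D W₁
            rec = cover D (X ++ tabulate τ) W₁ (↭-trans e (↭-trans (++⁺ˡ X eτ) (↭-sym (↭-++-assoc X (tabulate τ) W₁))))
              (≤-trans (≤-reflexive (trans (cong (_+ r * length D) (trans (length-++ X) (cong (length X +_) (length-tabulate τ))))
                (trans (+-assoc (length X) r _) (cong (length X +_) (sym (*-suc r (length D))))))) le)
            module A = Cover rec
            new : ∀ {y} → y ∈ map (edge τ) EF′ → KB (proj₁ y) (proj₂ y) ≡ true
            new y∈ with ∈-map⁻ (edge τ) y∈
            ... | e , e∈ , refl = Kτ e∈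

    -- Colour absorbers

    module Absorbers (needK : Bool) (P Q : ℕ) (Vs : List V) (Cs : List C) where

      K : V → V → Bool
      K = popular Q Cs

      -- Overlaps of colours are measured inside the host graph, so that an edge shared by two
      -- colours may serve as the prescribed edge of a copy.
      Ĝ : C → V × V → Bool
      Ĝ c ω = fits c ω ∧ host needK K ω

      Ĝ-sym : ∀ c u v → Ĝ c (u , v) ≡ Ĝ c (v , u)
      Ĝ-sym c u v = cong₂ _∧_ (adj-sym c u v) (cong (not needK ∨_) (popular-sym Q Cs u v))

      Ω : List (V × V)
      Ω = cartesianProduct Vs Vs

      open NearClique Ω Ĝ Cs Q (4 * Q) public using (near; far; M₁; size)

      -- For the best colour an average pair of vertices scores `1 / (4 * Q * M₁)` of the weight;
      -- passing from this average to a dense set of edges costs another factor 2. With `q = 2 * M`,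
      -- halving the weight of what is hit multiplies the total by at most `1 - 1 / q`.
      M q : ℕ
      M = 8 * Q * M₁
      q = 2 * M

      Constraint : Set
      Constraint = (V × V) × C

      -- The exchange made by `absorb` is possible: the pending edge `e` can take over `c`, and the
      -- absorbing edge `f` can receive `z`.
      hit : Constraint → Constraint → Bool
      hit (f , c) (e , z) = fits c e ∧ fits z f

      record NewTile (Ps : List Constraint) (U : List V) (pool : List C) (w : Constraint → ℕ) : Set where
        field
          τ : Fin r → V
          U′ : List V
          c : C
          others : List Constraint
          pool′ : List C
          U↭ : U ↭ tabulate τ ++ U′
          pool↭ : pool ↭ (c ∷ map proj₂ others) ++ pool′
          others≡ : map proj₁ others ≡ map (edge τ) EF′
          ok₀ : fits c (edge τ e₀) ≡ true
          okT : ∀ {y} → y ∈ others → fits (proj₂ y) (proj₁ y) ≡ true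
          gain : 2 * Σl w Ps ≤ q * Σl (λ p → w p * b2n (hit (edge τ e₀ , c) p)) Ps

      module _ (inB : C → Bool) (B-near : ∀ {z} → z ∈ Cs → inB z ≡ true → 4 * Q * size (far inB z) ≤ size inB)
        (Q≥1 : 1 ≤ Q) (N≥1 : 1 ≤ length Vs) (B≥1 : 1 ≤ size inB) where

        B N : ℕ
        B = size inB
        N = length Vs

        popB : V × V → Bool
        popB e = B ≤ᵇ Q * cnt (λ c → inB c ∧ fits c e) Cs

        Valid : Constraint → Set
        Valid (e , z) = (popB e ≡ true) × (z ∈ Cs) × (inB z ≡ true)

        module Step (nE : ℕ) (ext : Extends needK P Q M nE e₀ EF′)
          (K-deg : ∀ {v} → v ∈ Vs → (3 + P) * N ≤ Q * cnt (K v) Vs)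
          (Ps : List Constraint) (valid : ∀ {p} → p ∈ Ps → Valid p)
          (X U : List V) (eV : Vs ↭ X ++ U) (used pool : List C) (eC : Cs ↭ used ++ pool)
          (s₁ : 4 * M₁ * length X ≤ N) (s₂ : 4 * Q * length used ≤ B) (s₃ : Q * (length used + t) ≤ length Cs)
          (s₄ : Q * length X ≤ N) (s₅ : nE ≤ length U) (w : Constraint → ℕ) (W≥1 : 1 ≤ Σl w Ps) where

          W : ℕ
          W = Σl w Ps

          ΩU : List (V × V)
          ΩU = cartesianProduct U U

          x : C → Constraint → V × V → Bool
          x c p ω = fits c (proj₁ p) ∧ Ĝ (proj₂ p) ω

          -- `score` is the weight of the targets that would be hit if the edge `ω` of the host
          -- graph received the colour `c`; `sc` discards the edges that may not have this colour.
          score sc : C → V × V → ℕ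
          score c ω = Σl (λ p → w p * b2n (x c p ω)) Ps
          sc c ω = b2n (Ĝ c ω) * score c ω

          T : Constraint → C → ℕ
          T p c = Σl (λ ω → b2n (Ĝ c ω) * b2n (x c p ω)) ΩU

          sum-sc : ∀ c → Σl (sc c) ΩU ≡ Σl (λ p → w p * T p c) Ps
          sum-sc c = begin
            Σl (sc c) ΩU ≡⟨ Σl-cong ΩU (λ ω → sym (Σl-*ˡ (b2n (Ĝ c ω)) (λ p → w p * b2n (x c p ω)) Ps)) ⟩
            Σl (λ ω → Σl (λ p → b2n (Ĝ c ω) * (w p * b2n (x c p ω))) Ps) ΩU ≡⟨ Σl-swap (λ ω p → b2n (Ĝ c ω) * (w p * b2n (x c p ω))) ΩU Ps ⟩
            Σl (λ p → Σl (λ ω → b2n (Ĝ c ω) * (w p * b2n (x c p ω))) ΩU) Ps ≡⟨ Σl-cong Ps (λ p → trans (Σl-cong ΩU (λ ω → e₁ (b2n (Ĝ c ω)) (w p) (b2n (x c p ω)))) (Σl-*ˡ (w p) (λ ω → b2n (Ĝ c ω) * b2n (x c p ω)) ΩU)) ⟩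
            Σl (λ p → w p * T p c) Ps ∎
            where
            open ≡-Reasoning
            e₁ : ∀ a b c → a * (b * c) ≡ b * (a * c)
            e₁ = solve-∀

          good : Constraint → C → Bool
          good p c = (inB c ∧ fits c (proj₁ p)) ∧ near c (proj₂ p)

          -- Popularity supplies `B / Q` colours of `B` at the edge. At most `B / (4 * Q)` of them
          -- are far from the spare colour and at most as many are used already.
          many-good : ∀ {p} → p ∈ Ps → B ≤ 2 * Q * cnt (good p) pool
          many-good {p@(e , z)} p∈ = *-cancelˡ-≤ 2 (by-lin 0 (+-mono-≤ (*-monoʳ-≤ 4 pop) (+-mono-≤ (*-monoʳ-≤ (4 * Q) split) (+-mono-≤ (B-near z∈ Bz) (+-mono-≤ (*-monoʳ-≤ (4 * Q) in-pool) s₂))))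
              (e₁ B Q (cnt (good p) pool) (cnt bf Cs) (cnt (good p) Cs) (size (far inB z)) (length used)))
            where
            bf : C → Bool
            bf c = inB c ∧ fits c e
            z∈ = proj₁ (proj₂ (valid p∈))
            Bz = proj₂ (proj₂ (valid p∈))
            pop : B ≤ Q * cnt bf Cs
            pop = ≤ᵇ-≤ {B} (proj₁ (valid p∈))
            split : cnt bf Cs ≤ cnt (good p) Cs + size (far inB z)
            split = ≤-trans (≤-reflexive (cnt-split bf (λ c → near c z) Cs)) (+-monoʳ-≤ (cnt (good p) Cs)
              (cnt-mono Cs (λ {c} _ h → ∧-intro (proj₁ (∧-true {inB c} (proj₁ (∧-true {bf c} h)))) (proj₂ (∧-true {bf c} h)))))
            in-pool : cnt (good p) Cs ≤ length used + cnt (good p) pool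
            in-pool = cnt-++≤ (good p) used pool eC
            e₁ : ∀ B Q gp bf gc fr u → 2 * B + (4 * (Q * bf) + (4 * Q * (gc + fr) + (B + (4 * Q * (u + gp) + B)))) + 0
              ≡ 2 * (2 * Q * gp) + (4 * B + (4 * Q * bf + (4 * Q * fr + (4 * Q * gc + 4 * Q * u))))
            e₁ = solve-∀

          -- Nearness gives an overlap of `N * N / M₁`; pairs meeting the used vertices `X` take
          -- away at most half of it.
          T-large : ∀ {p c} → good p c ≡ true → N * N ≤ 2 * M₁ * T p c
          T-large {p@(e , z)} {c} gd = by-lin 0 (+-mono-≤ (*-monoʳ-≤ 2 full) (+-mono-≤ (*-monoʳ-≤ (2 * M₁) drop) (*-monoˡ-≤ N s₁))) (e₁ N M₁ D₂ D₁ (length X))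
              ▸ cong (2 * M₁ *_) (sym T≡)
            where
            _▸_ : ∀ {a b c} → a ≤ b → b ≡ c → a ≤ c
            le ▸ refl = le
            D₁ = cnt (λ ω → Ĝ c ω ∧ Ĝ z ω) Ω
            D₂ = cnt (λ ω → Ĝ c ω ∧ Ĝ z ω) ΩU
            full : N * N ≤ M₁ * D₁
            full = ≤-trans (≤-reflexive (sym (length-× Vs Vs))) (≤ᵇ-≤ {length Ω} (proj₂ (∧-true {inB c ∧ fits c e} gd)))
            drop : D₁ ≤ D₂ + 2 * (length X * N)
            drop = cnt-×-drop (λ ω → Ĝ c ω ∧ Ĝ z ω) Vs X U eV
            fe : fits c e ≡ true
            fe = proj₂ (∧-true {inB c} (proj₁ (∧-true {inB c ∧ fits c e} gd)))
            T≡ : T p c ≡ D₂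
            T≡ = Σl-cong ΩU λ ω → trans (b2n-∧ (Ĝ c ω) (x c p ω)) (cong (λ b → b2n (Ĝ c ω ∧ (b ∧ Ĝ z ω))) fe)
            e₁ : ∀ N M D₂ D₁ X → N * N + (2 * (M * D₁) + (2 * M * (D₂ + 2 * (X * N)) + N * N)) + 0 ≡ 2 * M * D₂ + (2 * (N * N) + (2 * M * D₁ + 4 * M * X * N))
            e₁ = solve-∀

          k : ℕ
          k = 4 * Q * M₁

          per-constraint : ∀ {p} → p ∈ Ps → B * (N * N) ≤ k * Σl (λ c → b2n (inB c) * T p c) pool
          per-constraint {p} p∈ = begin
            B * (N * N) ≤⟨ *-monoˡ-≤ (N * N) (many-good p∈) ⟩
            2 * Q * cnt (good p) pool * (N * N) ≡⟨ *-assoc (2 * Q) _ _ ⟩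
            2 * Q * (cnt (good p) pool * (N * N)) ≡⟨ cong (2 * Q *_) (sym (Σl-*ʳ (N * N) (λ c → b2n (good p c)) pool)) ⟩
            2 * Q * Σl (λ c → b2n (good p c) * (N * N)) pool ≤⟨ *-monoʳ-≤ (2 * Q) (Σl-mono pool (λ {c} _ → each c)) ⟩
            2 * Q * Σl (λ c → 2 * M₁ * (b2n (inB c) * T p c)) pool ≡⟨ cong (2 * Q *_) (Σl-*ˡ (2 * M₁) (λ c → b2n (inB c) * T p c) pool) ⟩
            2 * Q * (2 * M₁ * Σl (λ c → b2n (inB c) * T p c) pool) ≡⟨ e₁ Q M₁ (Σl (λ c → b2n (inB c) * T p c) pool) ⟩
            k * Σl (λ c → b2n (inB c) * T p c) pool ∎
            where
            open ≤-Reasoning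
            e₁ : ∀ Q M s → 2 * Q * (2 * M * s) ≡ 4 * Q * M * s
            e₁ = solve-∀
            each : ∀ c → b2n (good p c) * (N * N) ≤ 2 * M₁ * (b2n (inB c) * T p c)
            each c with good p c in eq
            ... | false = z≤n
            ... | true = ≤-trans (≤-reflexive (*-identityˡ (N * N))) (≤-trans (T-large {p} {c} eq)
                  (≤-reflexive (cong (2 * M₁ *_) (trans (sym (*-identityˡ (T p c))) (cong (λ b → b2n b * T p c) (sym Bc))))))
              where
              Bc : inB c ≡ true
              Bc = proj₁ (∧-true {inB c} (proj₁ (∧-true {inB c ∧ fits c (proj₁ p)} eq)))

          total : W * (N * N) * B ≤ Σl (λ c → b2n (inB c) * (k * Σl (sc c) ΩU)) pool
          total = begin
            W * (N * N) * B ≡⟨ e₁ W (N * N) B ⟩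
            W * (B * (N * N)) ≡⟨ Σl-*ʳ (B * (N * N)) w Ps ⟨
            Σl (λ p → w p * (B * (N * N))) Ps ≤⟨ Σl-mono Ps (λ {p} p∈ → *-monoʳ-≤ (w p) (per-constraint p∈)) ⟩
            Σl (λ p → w p * (k * Σl (λ c → b2n (inB c) * T p c) pool)) Ps ≡⟨ Σl-cong Ps (λ p → trans (sym (*-assoc (w p) k _)) (sym (Σl-*ˡ (w p * k) (λ c → b2n (inB c) * T p c) pool))) ⟩
            Σl (λ p → Σl (λ c → w p * k * (b2n (inB c) * T p c)) pool) Ps ≡⟨ Σl-swap (λ p c → w p * k * (b2n (inB c) * T p c)) Ps pool ⟩
            Σl (λ c → Σl (λ p → w p * k * (b2n (inB c) * T p c)) Ps) pool ≡⟨ Σl-cong pool (λ c → trans (Σl-cong Ps (λ p → e₂ (w p) k (b2n (inB c)) (T p c))) (trans (Σl-*ˡ (b2n (inB c) * k) (λ p → w p * T p c) Ps) (trans (*-assoc (b2n (inB c)) k _) (cong (λ s → b2n (inB c) * (k * s)) (sym (sum-sc c)))))) ⟩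
            Σl (λ c → b2n (inB c) * (k * Σl (sc c) ΩU)) pool ∎
            where
            open ≤-Reasoning
            e₁ : ∀ a b c → a * b * c ≡ a * (c * b)
            e₁ = solve-∀
            e₂ : ∀ w k b t → w * k * (b * t) ≡ b * k * (w * t)
            e₂ = solve-∀

          Chosen : Set
          Chosen = ∃[ c ] (c ∈ pool) × (inB c ≡ true) × (W * (N * N) ≤ k * Σl (sc c) ΩU)

          -- The bound `total` is averaged over the colours of `inB` that are left in the pool, at
          -- most `B` in number.
          chosen : Chosen
          chosen = averaging inB (λ c → k * Σl (sc c) ΩU) (W * (N * N)) B pool (*-mono-≤ W≥1 (*-mono-≤ N≥1 N≥1)) B≥1
            (≤-trans (m≤n+m (cnt inB pool) (cnt inB used)) (≤-reflexive (sym (trans (Σl-↭ _ eC) (Σl-++ _ used pool))))) total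

          module With (c : C) (c∈ : c ∈ pool) (avg : W * (N * N) ≤ k * Σl (sc c) ΩU) where

            -- Edges on which `c` hits at least `1 / M` of the weight. They are dense by `markov`,
            -- the average score being at least `2 / M`, and as the weight is positive they all lie
            -- in `Ĝ c`.
            Jω : V × V → Bool
            Jω ω = W ≤ᵇ M * sc c ω
            J : V → V → Bool
            J u v = Jω (u , v)

            sc≤W : ∀ ω → sc c ω ≤ W
            sc≤W ω = ≤-trans (b2n-*-≤ (Ĝ c ω) (score c ω)) (Σl-mono Ps (λ {p} _ → ≤-trans (≤-reflexive (*-comm (w p) _)) (b2n-*-≤ (x c p ω) (w p))))

            J-sym : Symmetric J
            J-sym u v = cong (λ s → W ≤ᵇ M * s) (cong₂ _*_ (cong b2n (Ĝ-sym c u v))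
              (Σl-cong Ps (λ p → cong (λ g → w p * b2n (fits c (proj₁ p) ∧ g)) (Ĝ-sym (proj₂ p) u v))))

            J-Ĝ : ∀ ω → Jω ω ≡ true → Ĝ c ω ≡ true
            J-Ĝ ω h with Ĝ c ω
            ... | true = refl
            ... | false = contradiction (≤-trans W≥1 (≤-trans (≤ᵇ-≤ {W} h) (≤-reflexive (*-zeroʳ M)))) λ ()

            J⊆K : needK ≡ true → ∀ u v → J u v ≡ true → K u v ≡ true
            J⊆K nk u v h = trans (sym (cong (λ b → not b ∨ K u v) nk)) (proj₂ (∧-true {fits c (u , v)} (J-Ĝ (u , v) h)))

            J-dense : Dense M J U
            J-dense = ≤-trans (*-mono-≤ U≤N U≤N) (≤-trans (cancelˡ W W≥1 (by-lin 0 (+-mono-≤ (*-monoʳ-≤ 2 avg) (+-mono-≤ mk (*-monoˡ-≤ W ΩU≤)))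
                (e₁ W N Q M₁ (Σl (sc c) ΩU) (length ΩU) (cnt Jω ΩU)))) (≤-reflexive (cong (M *_) (Σl-× (λ ω → b2n (Jω ω)) U U))))
              where
              U≤N : length U ≤ N
              U≤N = ↭-len≤ʳ X U eV
              ΩU≤ : length ΩU ≤ N * N
              ΩU≤ = ≤-trans (≤-reflexive (length-× U U)) (*-mono-≤ U≤N U≤N)
              mk : M * Σl (sc c) ΩU ≤ M * W * cnt Jω ΩU + length ΩU * W
              mk = markov (sc c) W M ΩU (λ {ω} _ → sc≤W ω)
              e₁ : ∀ W N Q M₁ s l j → W * (N * N) + (2 * (4 * Q * M₁ * s) + (8 * Q * M₁ * W * j + l * W + N * N * W)) + 0
                ≡ W * (8 * Q * M₁ * j) + (2 * (W * (N * N)) + (8 * Q * M₁ * s + l * W))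
              e₁ = solve-∀

            K-degU : ∀ {v} → v ∈ U → (2 + P) * length U ≤ Q * cnt (K v) U
            K-degU {v} v∈ = drop-degree (2 + P) Q (K v) X U eV s₄ (K-deg (∈-sub X U eV v∈))

            Placed : Set
            Placed = Σ (Fin r → V) λ τ → ∃[ U′ ] (U ↭ tabulate τ ++ U′) × (J (τ (proj₁ e₀)) (τ (proj₂ e₀)) ≡ true) ×
              (∀ {e} → e ∈ EF′ → K (τ (proj₁ e)) (τ (proj₂ e)) ≡ true)

            placed : Placed
            placed = ext U K J s₅ (popular-sym Q Cs) J-sym J⊆K K-degU J-dense

          newTile : NewTile Ps U pool w
          newTile = stage₁ chosen
            where
            stage₁ : Chosen → NewTile Ps U pool w
            stage₁ (c , c∈ , _ , avg) = stage₂ placed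
              where
              open With c c∈ avg
              stage₂ : Placed → NewTile Ps U pool w
              stage₂ (τ , U′ , e , Jf , Kf) = stage₃ (∈⇒↭ c∈)
                where
                f = edge τ e₀
                Ĝf : Ĝ c f ≡ true
                Ĝf = J-Ĝ f Jf
                gn : 2 * W ≤ q * Σl (λ p → w p * b2n (hit (f , c) p)) Ps
                gn = ≤-trans (*-monoʳ-≤ 2 (≤-trans (≤ᵇ-≤ {W} Jf) (*-monoʳ-≤ M (≤-trans (b2n-*-≤ (Ĝ c f) (score c f))
                    (Σl-mono Ps (λ {p} _ → *-monoʳ-≤ (w p) (b2n-mono (fits c (proj₁ p)) (fits (proj₂ p) f) (host needK K f)))))))) (≤-reflexive (sym (*-assoc 2 M _)))
                  where
                  b2n-mono : ∀ a b c → b2n (a ∧ (b ∧ c)) ≤ b2n (a ∧ b)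
                  b2n-mono false b c = z≤n
                  b2n-mono true false c = z≤n
                  b2n-mono true true c = b2n≤1 c
                stage₃ : (∃[ pool₁ ] pool ↭ c ∷ pool₁) → NewTile Ps U pool w
                stage₃ (pool₁ , e₁) = stage₄ (greedy fits (map (edge τ) EF′) pool₁ enough)
                  where
                  t′ = length EF′
                  lenE : length (map (edge τ) EF′) ≡ t′
                  lenE = length-map (edge τ) EF′
                  Cs↭ : Cs ↭ (used ++ [ c ]) ++ pool₁
                  Cs↭ = ↭-trans eC (↭-trans (++⁺ˡ used e₁) (↭-sym (↭-++-assoc used [ c ] pool₁)))
                  -- A popular edge has at least `length Cs / Q` colours, which covers those already
                  -- used and the `t` of the present copy.
                  enough′ : ∀ y → K (proj₁ y) (proj₂ y) ≡ true → t′ ≤ cnt (λ c → fits c y) pool₁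
                  enough′ y Ky = +-cancelˡ-≤ (length used + 1) _ _ (cancelˡ Q Q≥1 (begin
                    Q * (length used + 1 + t′) ≡⟨ cong (Q *_) (+-assoc (length used) 1 t′) ⟩
                    Q * (length used + t) ≤⟨ s₃ ⟩
                    length Cs ≤⟨ ≤ᵇ-≤ {length Cs} Ky ⟩
                    Q * cnt (λ c → fits c y) Cs ≤⟨ *-monoʳ-≤ Q (cnt-++≤ (λ c → fits c y) (used ++ [ c ]) pool₁ Cs↭) ⟩
                    Q * (length (used ++ [ c ]) + cnt (λ c → fits c y) pool₁) ≡⟨ cong (λ l → Q * (l + cnt (λ c → fits c y) pool₁)) (length-++ used) ⟩
                    Q * (length used + 1 + cnt (λ c → fits c y) pool₁) ∎))
                    where open ≤-Reasoning
                  enough : ∀ {y} → y ∈ map (edge τ) EF′ → length (map (edge τ) EF′) ≤ cnt (λ c → fits c y) pool₁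
                  enough {y} y∈ with ∈-map⁻ (edge τ) y∈
                  ... | e , e∈ , refl = ≤-trans (≤-reflexive lenE) (enough′ (edge τ e) (Kf e∈))
                  stage₄ : (∃[ L ] ∃[ D′ ] (pool₁ ↭ map proj₂ L ++ D′) × (map proj₁ L ≡ map (edge τ) EF′) × (∀ {x} → x ∈ L → fits (proj₂ x) (proj₁ x) ≡ true)) → NewTile Ps U pool w
                  stage₄ (L , D′ , e₂ , eL , okL) = record
                    { τ = τ ; U′ = U′ ; c = c ; others = L ; pool′ = D′ ; U↭ = e
                    ; pool↭ = ↭-trans e₁ (prep c e₂) ; others≡ = eL ; ok₀ = proj₁ (∧-true {fits c f} Ĝf) ; okT = okL ; gain = gn }

      -- An uncoloured edge e takes over the colour c of an absorbing edge f, which receives the spare colour z.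
      absorb : (LA : List Constraint) (es : List (V × V)) (zs : List C) → length es ≡ length zs →
        (∀ {x} → x ∈ LA → fits (proj₂ x) (proj₁ x) ≡ true) →
        (∀ {e z} → e ∈ es → z ∈ zs → length es ≤ cnt (λ x → hit x (e , z)) LA) →
        ∃[ L ] (map proj₁ L ↭ es ++ map proj₁ LA) × (map proj₂ L ↭ zs ++ map proj₂ LA) ×
          (∀ {x} → x ∈ L → fits (proj₂ x) (proj₁ x) ≡ true)
      absorb LA [] [] _ ok enough = LA , ↭-refl , ↭-refl , ok
      absorb LA (e ∷ es) (z ∷ zs) le ok enough with pick (λ x → hit x (e , z)) LA (≤-trans (s≤s z≤n) (enough (here refl) (here refl)))
      ... | (f , c) , LA₁ , p , h with absorb LA₁ es zs (suc-injective le) (λ i → ok (∈-sub [ (f , c) ] LA₁ p i))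
            (λ {e′} {z′} i j → s≤s⁻¹ (≤-trans (enough (there i) (there j)) (cnt-++≤ (λ x → hit x (e′ , z′)) [ (f , c) ] LA₁ p)))
      ... | L , p₁ , p₂ , okL = (e , c) ∷ (f , z) ∷ L ,
              prep e (↭-trans (prep f p₁) (↭-trans (↭-sym (shift f es (map proj₁ LA₁))) (++⁺ˡ es (↭-sym (map⁺ proj₁ p))))) ,
              ↭-trans (swap c z p₂) (prep z (↭-trans (↭-sym (shift c zs (map proj₂ LA₁))) (++⁺ˡ zs (↭-sym (map⁺ proj₂ p))))) ,
              λ { (here refl) → proj₁ (∧-true {fits c e} h) ; (there (here refl)) → proj₂ (∧-true {fits c e} h) ; (there (there i)) → okL i }

      hits : List Constraint → Constraint → ℕ
      hits LA p = cnt (λ x → hit x p) LA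

      -- Halving the weight of what is hit, scaled by 2 to stay in ℕ.
      reweigh : Constraint → (Constraint → ℕ) → Constraint → ℕ
      reweigh y w p = if hit y p then w p else 2 * w p

      record Reserve (S h : ℕ) (Ps : List Constraint) : Set where
        field
          Ts : List (Fin r → V)
          LA LO : List Constraint
          U₀ : List V
          pool : List C
          U↭ : Vs ↭ verts Ts ++ U₀
          pool↭ : Cs ↭ (map proj₂ LA ++ map proj₂ LO) ++ pool
          es↭ : map proj₁ LA ++ map proj₁ LO ↭ edges Ts
          okA : ∀ {y} → y ∈ LA → fits (proj₂ y) (proj₁ y) ≡ true
          okO : ∀ {y} → y ∈ LO → fits (proj₂ y) (proj₁ y) ≡ true
          few : length Ts ≤ S
          enough : ∀ {p} → p ∈ Ps → h ≤ hits LA p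

      -- After division by `(2 * q) ^ k` the field `bound` says that halving a weight at every hit
      -- leaves at most the fraction `(1 - 1 / q) ^ k` of the total, where `q = suc x`.
      record Absorber (Ps : List Constraint) (x k : ℕ) (U : List V) (pool : List C) (w : Constraint → ℕ) : Set where
        field
          Ts : List (Fin r → V)
          LA LO : List Constraint
          U′ : List V
          pool′ : List C
          U↭ : U ↭ verts Ts ++ U′
          pool↭ : pool ↭ (map proj₂ LA ++ map proj₂ LO) ++ pool′
          es↭ : map proj₁ LA ++ map proj₁ LO ↭ edges Ts
          okA : ∀ {y} → y ∈ LA → fits (proj₂ y) (proj₁ y) ≡ true
          okO : ∀ {y} → y ∈ LO → fits (proj₂ y) (proj₁ y) ≡ true
          few : length Ts ≤ k
          bound : q ^ k * Σl (λ p → w p * 2 ^ (k ∸ hits LA p)) Ps ≤ (2 * x) ^ k * Σl w Ps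

      -- The end of the construction: either the `k` tiles are exhausted, or the total weight is 0
      -- and there is nothing to average over.
      stop : ∀ {Ps x U pool w} k → q ^ k * Σl (λ p → w p * 2 ^ k) Ps ≤ (2 * x) ^ k * Σl w Ps → Absorber Ps x k U pool w
      stop {U = U} {pool} k bd = record { Ts = [] ; LA = [] ; LO = [] ; U′ = U ; pool′ = pool ; U↭ = ↭-refl ; pool↭ = ↭-refl ; es↭ = ↭-refl
        ; okA = λ () ; okO = λ () ; few = z≤n ; bound = bd }

      module Iterated (Ps : List Constraint) (x : ℕ) (q≡ : q ≡ suc x) where

        module Prepend (k : ℕ) {U : List V} {pool : List C} {w : Constraint → ℕ} (NT : NewTile Ps U pool w) where
          open NewTile NT
          f : V × V
          f = edge τ e₀
          w′ : Constraint → ℕ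
          w′ = reweigh (f , c) w
          hitW : ℕ
          hitW = Σl (λ p → w p * b2n (hit (f , c) p)) Ps
          new-sum : Σl w′ Ps + hitW ≡ 2 * Σl w Ps
          new-sum = trans (sym (Σl-+ w′ (λ p → w p * b2n (hit (f , c) p)) Ps)) (trans (Σl-cong Ps (λ p → each (hit (f , c) p) (w p))) (Σl-*ˡ 2 w Ps))
            where
            e₁ : ∀ u → u + u * 1 ≡ 2 * u
            e₁ = solve-∀
            e₂ : ∀ u → 2 * u + u * 0 ≡ 2 * u
            e₂ = solve-∀
            each : ∀ h u → (if h then u else 2 * u) + u * b2n h ≡ 2 * u
            each true u = e₁ u
            each false u = e₂ u
          -- The new sum is twice the old one minus the weight hit, and the tile was chosen to hit
          -- at least `2 / q` of the old one.
          decrease : q * Σl w′ Ps ≤ 2 * x * Σl w Ps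
          decrease = by-lin 0 (+-mono-≤ gain (≤-reflexive (cong (suc x *_) new-sum)))
            (trans (cong (λ z → z * Σl w′ Ps + (z * hitW + suc x * (2 * Σl w Ps)) + 0) q≡) (e₁ x (Σl w′ Ps) hitW (Σl w Ps)))
            where
            e₁ : ∀ x a h W → suc x * a + (suc x * h + suc x * (2 * W)) + 0 ≡ 2 * x * W + (2 * W + suc x * (a + h))
            e₁ = solve-∀
          prepend : Absorber Ps x k U′ pool′ w′ → Absorber Ps x (suc k) U pool w
          prepend A = record
            { Ts = τ ∷ A.Ts ; LA = (f , c) ∷ A.LA ; LO = others ++ A.LO ; U′ = A.U′ ; pool′ = A.pool′
            ; U↭ = ↭-trans U↭ (↭-trans (++⁺ˡ (tabulate τ) A.U↭) (↭-sym (↭-++-assoc (tabulate τ) (verts A.Ts) A.U′)))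
            ; pool↭ = ↭-trans pool↭ (prep c (↭-trans (++⁺ˡ (map proj₂ others) A.pool↭)
                (↭-trans (↭-sym (↭-++-assoc (map proj₂ others) (map proj₂ A.LA ++ map proj₂ A.LO) A.pool′)) (++⁺ʳ A.pool′ (↭-trans (shifts (map proj₂ others) (map proj₂ A.LA))
                  (++⁺ˡ (map proj₂ A.LA) (↭-reflexive (sym (map-++ proj₂ others A.LO)))))))))
            ; es↭ = prep f (↭-trans (++⁺ˡ (map proj₁ A.LA) (↭-reflexive (map-++ proj₁ others A.LO)))
                (↭-trans (shifts (map proj₁ A.LA) (map proj₁ others)) (++⁺ (↭-reflexive others≡) A.es↭)))
            ; okA = λ { (here refl) → ok₀ ; (there i) → A.okA i }
            ; okO = λ i → case ∈-++⁻ others i of λ { (inj₁ j) → okT j ; (inj₂ j) → A.okO j }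
            ; few = s≤s A.few
            ; bound = bd }
            where
            module A = Absorber A
            open ≤-Reasoning
            each : ∀ p → w p * 2 ^ (suc k ∸ (b2n (hit (f , c) p) + hits A.LA p)) ≤ w′ p * 2 ^ (k ∸ hits A.LA p)
            each p with hit (f , c) p
            ... | true = ≤-refl
            ... | false = ≤-trans (*-monoʳ-≤ (w p) (pow (hits A.LA p))) (≤-reflexive (e₁ (w p) (2 ^ (k ∸ hits A.LA p))))
              where
              e₁ : ∀ w z → w * (2 * z) ≡ 2 * w * z
              e₁ = solve-∀
              -- For `h > k` both truncated exponents are 0, so only an inequality holds.
              pow : ∀ h → 2 ^ (suc k ∸ h) ≤ 2 * 2 ^ (k ∸ h)
              pow h with h ≤? k
              ... | yes le = ≤-reflexive (cong (2 ^_) (+-∸-assoc 1 le))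
              ... | no nle = ≤-trans (≤-reflexive (cong (2 ^_) (m≤n⇒m∸n≡0 (≰⇒> nle)))) (≤-trans (m^n>0 2 (k ∸ h)) (m≤m+n _ _))
            bd : q ^ suc k * Σl (λ p → w p * 2 ^ (suc k ∸ hits ((f , c) ∷ A.LA) p)) Ps ≤ (2 * x) ^ suc k * Σl w Ps
            bd = begin
              q ^ suc k * Σl (λ p → w p * 2 ^ (suc k ∸ hits ((f , c) ∷ A.LA) p)) Ps ≤⟨ *-monoʳ-≤ (q ^ suc k) (Σl-mono Ps (λ {p} _ → each p)) ⟩
              q * q ^ k * Σl (λ p → w′ p * 2 ^ (k ∸ hits A.LA p)) Ps ≡⟨ *-assoc q (q ^ k) _ ⟩
              q * (q ^ k * Σl (λ p → w′ p * 2 ^ (k ∸ hits A.LA p)) Ps) ≤⟨ *-monoʳ-≤ q A.bound ⟩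
              q * ((2 * x) ^ k * Σl w′ Ps) ≡⟨ e₁ q ((2 * x) ^ k) (Σl w′ Ps) ⟩
              (2 * x) ^ k * (q * Σl w′ Ps) ≤⟨ *-monoʳ-≤ ((2 * x) ^ k) decrease ⟩
              (2 * x) ^ k * (2 * x * Σl w Ps) ≡⟨ e₂ ((2 * x) ^ k) (2 * x) (Σl w Ps) ⟩
              (2 * x) ^ suc k * Σl w Ps ∎
              where
              e₁ : ∀ a b c → a * (b * c) ≡ b * (a * c)
              e₁ = solve-∀
              e₂ : ∀ a b c → a * (b * c) ≡ b * a * c
              e₂ = solve-∀

        -- A target hit fewer than `h` times keeps a term of at least `2 ^ (S - h)`, so the bound
        -- gives `(q / x) ^ S ≤ 2 ^ h * length Ps`. But `S = x * (2 * h)` and `(1 + 1 / x) ^ x ≥ 2`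
        -- make the left side at least `2 ^ (2 * h)`.
        many-hits : ∀ S h → 1 ≤ x → S ≡ x * (2 * h) → length Ps < 2 ^ h → (A : Absorber Ps x S Vs Cs (λ _ → 1)) →
          ∀ {p} → p ∈ Ps → h ≤ hits (Absorber.LA A) p
        many-hits S h x≥1 S≡ Ps< A {p} p∈ with h ≤? hits (Absorber.LA A) p
        ... | yes le = le
        ... | no nle = contradiction 2^h≤ (<⇒≱ Ps<)
          where
          open Absorber A
          open ≤-Reasoning
          h≤S : h ≤ S
          h≤S = ≤-trans (m≤m+n h (h + 0)) (≤-trans (≤-trans (≤-reflexive (sym (*-identityˡ (2 * h)))) (*-monoˡ-≤ (2 * h) x≥1)) (≤-reflexive (sym S≡)))
          main : q ^ S * 2 ^ (S ∸ h) ≤ 2 ^ S * x ^ S * length Ps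
          main = begin
            q ^ S * 2 ^ (S ∸ h) ≤⟨ *-monoʳ-≤ (q ^ S) (^-monoʳ-≤ 2 (∸-monoʳ-≤ S (<⇒≤ (≰⇒> nle)))) ⟩
            q ^ S * 2 ^ (S ∸ hits LA p) ≤⟨ *-monoʳ-≤ (q ^ S) (≤-trans (≤-reflexive (sym (*-identityˡ _))) (Σl-∈ (λ p → 1 * 2 ^ (S ∸ hits LA p)) p∈)) ⟩
            q ^ S * Σl (λ p → 1 * 2 ^ (S ∸ hits LA p)) Ps ≤⟨ bound ⟩
            (2 * x) ^ S * Σl (λ _ → 1) Ps ≡⟨ cong₂ _*_ (^-distribʳ-* S 2 x) (trans (Σl-const 1 Ps) (*-identityʳ _)) ⟩
            2 ^ S * x ^ S * length Ps ∎
          2^S : 2 ^ S ≡ 2 ^ h * 2 ^ (S ∸ h)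
          2^S = trans (cong (2 ^_) (sym (m+[n∸m]≡n h≤S))) (^-distribˡ-+-* 2 h (S ∸ h))
          main₂ : q ^ S ≤ 2 ^ h * x ^ S * length Ps
          main₂ = cancelˡ (2 ^ (S ∸ h)) (m^n>0 2 (S ∸ h)) (begin
            2 ^ (S ∸ h) * q ^ S ≡⟨ *-comm (2 ^ (S ∸ h)) _ ⟩
            q ^ S * 2 ^ (S ∸ h) ≤⟨ main ⟩
            2 ^ S * x ^ S * length Ps ≡⟨ cong (λ z → z * x ^ S * length Ps) 2^S ⟩
            2 ^ h * 2 ^ (S ∸ h) * x ^ S * length Ps ≡⟨ e₁ (2 ^ h) (2 ^ (S ∸ h)) (x ^ S) (length Ps) ⟩
            2 ^ (S ∸ h) * (2 ^ h * x ^ S * length Ps) ∎)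
            where
            e₁ : ∀ a b c d → a * b * c * d ≡ b * (a * c * d)
            e₁ = solve-∀
          growth : 2 ^ h * (2 ^ h * x ^ S) ≤ q ^ S
          growth = begin
            2 ^ h * (2 ^ h * x ^ S) ≡⟨ *-assoc (2 ^ h) (2 ^ h) (x ^ S) ⟨
            2 ^ h * 2 ^ h * x ^ S ≡⟨ cong (_* x ^ S) (trans (sym (^-distribˡ-+-* 2 h h)) (cong (λ z → 2 ^ (h + z)) (sym (+-identityʳ h)))) ⟩
            2 ^ (2 * h) * x ^ S ≡⟨ cong (λ s → 2 ^ (2 * h) * x ^ s) S≡ ⟩
            2 ^ (2 * h) * x ^ (x * (2 * h)) ≤⟨ double-pow-* x (2 * h) x≥1 ⟩
            suc x ^ (x * (2 * h)) ≡⟨ cong₂ _^_ (sym q≡) (sym S≡) ⟩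
            q ^ S ∎
          2^h≤ : 2 ^ h ≤ length Ps
          2^h≤ = cancelˡ (2 ^ h * x ^ S) (*-mono-≤ (m^n>0 2 h) (1≤^ x S x≥1)) (≤-trans (≤-reflexive (*-comm (2 ^ h * x ^ S) (2 ^ h))) (≤-trans growth main₂))

      module _ (inB : C → Bool) (B-near : ∀ {z} → z ∈ Cs → inB z ≡ true → 4 * Q * size (far inB z) ≤ size inB)
        (Q≥1 : 1 ≤ Q) (N≥1 : 1 ≤ length Vs) (B≥1 : 1 ≤ size inB)
        (nE : ℕ) (ext : Extends needK P Q M nE e₀ EF′)
        (K-deg : ∀ {v} → v ∈ Vs → (3 + P) * length Vs ≤ Q * cnt (K v) Vs)
        (Ps : List Constraint) (valid : ∀ {p} → p ∈ Ps → Valid inB B-near Q≥1 N≥1 B≥1 p)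
        (S : ℕ) (S₁ : 4 * M₁ * (r * S) ≤ length Vs) (S₂ : 4 * Q * (t * S) ≤ size inB) (S₃ : Q * (t * S) ≤ length Cs)
        (S₄ : Q * (r * S) ≤ length Vs) (S₅ : nE + r * S ≤ length Vs) (x : ℕ) (q≡ : q ≡ suc x) where
        next-tile : ∀ k (X U : List V) → Vs ↭ X ++ U → ∀ used pool → Cs ↭ used ++ pool → length X + r * suc k ≤ r * S →
          length used + t * suc k ≤ t * S → (w : Constraint → ℕ) → 1 ≤ Σl w Ps → NewTile Ps U pool w
        next-tile k X U eV used pool eC invV invC w W≥1 = Step.newTile inB B-near Q≥1 N≥1 B≥1 nE ext K-deg Ps valid X U eV used pool eC
            (≤-trans (*-monoʳ-≤ (4 * M₁) X≤) S₁) (≤-trans (*-monoʳ-≤ (4 * Q) used≤) S₂) (≤-trans (*-monoʳ-≤ Q used+t≤) S₃)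
            (≤-trans (*-monoʳ-≤ Q X≤) S₄) U-big w W≥1
          where
          X≤ : length X ≤ r * S
          X≤ = ≤-trans (m≤m+n (length X) _) invV
          used+t≤ : length used + t ≤ t * S
          used+t≤ = ≤-trans (+-monoʳ-≤ (length used) (≤-trans (m≤m+n t (t * k)) (≤-reflexive (sym (*-suc t k))))) invC
          used≤ : length used ≤ t * S
          used≤ = ≤-trans (m≤m+n _ _) invC
          U-big : nE ≤ length U
          U-big = +-cancelʳ-≤ (r * S) _ _ (≤-trans S₅ (≤-trans (≤-reflexive (↭-len X U eV)) (≤-trans (+-monoˡ-≤ (length U) X≤) (≤-reflexive (+-comm (r * S) (length U))))))

        -- The vertices and colours consumed stay within the totals `r * S` and `t * S`, so the
        -- smallness conditions are stated once for the complete absorber.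
        build : ∀ k (X U : List V) → Vs ↭ X ++ U → ∀ used pool → Cs ↭ used ++ pool → length X + r * k ≤ r * S →
          length used + t * k ≤ t * S → (w : Constraint → ℕ) → Absorber Ps x k U pool w
        build zero X U eV used pool eC iV iC w = stop 0 (≤-reflexive (cong (1 *_) (Σl-cong Ps (λ p → *-identityʳ (w p)))))
        build (suc k) X U eV used pool eC iV iC w = decide (1 ≤? Σl w Ps)
          where
          zeros : ¬ (1 ≤ Σl w Ps) → q ^ suc k * Σl (λ p → w p * 2 ^ suc k) Ps ≡ 0
          zeros W≡0 = trans (cong (q ^ suc k *_) (trans (Σl-*ʳ (2 ^ suc k) w Ps) (cong (_* 2 ^ suc k) (n<1⇒n≡0 (≰⇒> W≡0))))) (*-zeroʳ (q ^ suc k))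
          next : NewTile Ps U pool w → Absorber Ps x (suc k) U pool w
          next NT = Iterated.Prepend.prepend Ps x q≡ k NT (build k (X ++ tabulate τ) U′
              (↭-trans eV (↭-trans (++⁺ˡ X U↭) (↭-sym (↭-++-assoc X (tabulate τ) U′))))
              (used ++ newC) pool′ (↭-trans eC (↭-trans (++⁺ˡ used pool↭) (↭-sym (↭-++-assoc used newC pool′))))
              (≤-trans (≤-reflexive lenV) iV) (≤-trans (≤-reflexive lenC) iC) (reweigh (edge τ e₀ , c) w))
            where
            open NewTile NT
            newC = c ∷ map proj₂ others
            lenV : length (X ++ tabulate τ) + r * k ≡ length X + r * suc k
            lenV = trans (cong (_+ r * k) (trans (length-++ X) (cong (length X +_) (length-tabulate τ)))) (trans (+-assoc (length X) r (r * k)) (cong (length X +_) (sym (*-suc r k))))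
            len-new : length newC ≡ t
            len-new = cong suc (trans (length-map proj₂ others) (trans (sym (length-map proj₁ others)) (trans (cong length others≡) (length-map (edge τ) EF′))))
            lenC : length (used ++ newC) + t * k ≡ length used + t * suc k
            lenC = trans (cong (_+ t * k) (trans (length-++ used) (cong (length used +_) len-new))) (trans (+-assoc (length used) t (t * k)) (cong (length used +_) (sym (*-suc t k))))

          decide : Dec (1 ≤ Σl w Ps) → Absorber Ps x (suc k) U pool w
          decide (no W≡0) = stop (suc k) (≤-trans (≤-reflexive (zeros W≡0)) z≤n)
          decide (yes W≥1) = next (next-tile k X U eV used pool eC iV iC w W≥1)

        absorber : Absorber Ps x S Vs Cs (λ _ → 1)
        absorber = build S [] Vs ↭-refl [] Cs ↭-refl ≤-refl ≤-refl (λ _ → 1)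

        reserve : ∀ h → 1 ≤ x → S ≡ x * (2 * h) → length Ps < 2 ^ h → Reserve S h Ps
        reserve h x≥1 S≡ Ps< = record { Ts = A.Ts ; LA = A.LA ; LO = A.LO ; U₀ = A.U′ ; pool = A.pool′ ; U↭ = A.U↭ ; pool↭ = A.pool↭
          ; es↭ = A.es↭ ; okA = A.okA ; okO = A.okO ; few = A.few ; enough = Iterated.many-hits Ps x q≡ S h x≥1 S≡ Ps< absorber }
          where
          module A = Absorber absorber

      -- Putting the pieces together

      module Assembly (half : needK ≡ true → Q ≤ 2 * P) (Vs-all : ∀ v → v ∈ Vs) (Cs-all : ∀ c → c ∈ Cs) (r≥1 : 1 ≤ r) (Q≥1 : 1 ≤ Q)
        (nE₁ nE₂ n₀ n : ℕ) (n≥1 : 1 ≤ n) (prm : Parameters r t P Q nE₁ nE₂ n₀ n)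
        (lenV : length Vs ≡ r * n) (lenC : length Cs ≡ t * n) where
        open Parameters prm hiding (M₁)

        -- The degree budget towards the reservoir: `6 + P` on `Vs`, `5 + P` without the absorbing
        -- tiles, `4 + P` in the reservoir after the halvings, `3 + P` for popular edges, `2 + P`
        -- beside the copies for leftover colours. `Extends` asks for `2 + P`, the black box for
        -- `1 + P`.
        module _ (ext₁ : Extends needK P Q M nE₁ e₀ EF′) (ext₂ : Extends needK P Q Q nE₂ e₀ EF′)
          (bb : BlackBox V r EF (suc P) Q n₀) (deg : Degrees (6 + P) Q Cs Vs) where

          N≥1 : 1 ≤ length Vs
          N≥1 = ≤-trans (*-mono-≤ r≥1 n≥1) (≤-reflexive (sym lenV))

          Cs≥1 : 1 ≤ length Cs
          Cs≥1 = ≤-trans (*-mono-≤ (s≤s {0} {length EF′} z≤n) n≥1) (≤-reflexive (sym lenC))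

          K-deg : ∀ {v} → v ∈ Vs → (5 + P) * length Vs ≤ Q * cnt (K v) Vs
          K-deg {v} v∈ = popular-degree (5 + P) Q Cs Vs v Cs≥1 (λ i∈ → deg i∈ v∈)

          Clique : Set
          Clique = NearClique.Result Ω Ĝ Cs Q (4 * Q)

          clique : Clique
          clique = NearClique.nearClique Ω Ĝ Cs Q (4 * Q) Q≥1 (≤-trans Q≥1 (m≤m+n Q (3 * Q)))
            (≤-trans (*-mono-≤ N≥1 N≥1) (≤-reflexive (sym (length-× Vs Vs)))) λ {c} c∈ →
              ≤-trans (≤-reflexive (length-× Vs Vs)) (≤-trans (degrees-× (Ĝ c) Q Vs (λ {v} v∈ → Covering.host-degree needK P Q half half K c v Vs
                (weaken (s≤s (s≤s (m≤n+m P 3))) (length Vs) (K-deg v∈)) (weaken (s≤s (s≤s (m≤n+m P 4))) (length Vs) (deg c∈ v∈))))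
                (≤-reflexive (cong (Q *_) (sym (Σl-× (λ ω → b2n (Ĝ c ω)) Vs Vs)))))

          toV : ∀ {a} → a ≤ r * n → a ≤ length Vs
          toV le = ≤-trans le (≤-reflexive (sym lenV))
          toC : ∀ {a} → a ≤ t * n → a ≤ length Cs
          toC le = ≤-trans le (≤-reflexive (sym lenC))
          scale : ∀ a k b → a * S ≤ b → a * (k * S) ≤ k * b
          scale a k b le = ≤-trans (≤-reflexive (e₁ a k S)) (*-monoʳ-≤ k le)
            where
            e₁ : ∀ a r S → a * (r * S) ≡ r * (a * S)
            e₁ = solve-∀
          ≤r* : ∀ k → k ≤ r * k
          ≤r* k = ≤-trans (≤-reflexive (sym (*-identityˡ k))) (*-monoˡ-≤ k r≥1)

          module WithClique (cl : Clique) where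
            inB : C → Bool
            inB = proj₁ cl
            Cs≤ : length Cs ≤ β * size inB
            Cs≤ = proj₁ (proj₂ cl)
            B-near : ∀ {z} → z ∈ Cs → inB z ≡ true → 4 * Q * size (far inB z) ≤ size inB
            B-near = proj₂ (proj₂ cl)

            β≥1 : 1 ≤ β
            β≥1 = 1≤^ (4 * Q) (2 * Q) (≤-trans Q≥1 (m≤m+n Q (3 * Q)))

            B≥1 : 1 ≤ size inB
            B≥1 = positive (size inB) Cs≤
              where
              positive : ∀ k → length Cs ≤ β * k → 1 ≤ k
              positive (suc _) _ = s≤s z≤n
              positive zero le = contradiction (≤-trans Cs≥1 (≤-trans le (≤-reflexive (*-zeroʳ β)))) λ ()

            ≤B : ∀ a → β * a ≤ length Cs → a ≤ size inB
            ≤B a h = cancelˡ β β≥1 (≤-trans h Cs≤)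

            pop : V × V → Bool
            pop = popB inB B-near Q≥1 N≥1 B≥1

            valid? : Constraint → Bool
            valid? (e , z) = pop e ∧ inB z

            -- The absorption needs every valid pair of an edge and a spare colour, the potential
            -- argument fewer than `2 ^ h` of them; both hold since their number is polynomial in
            -- `n`.
            record Targets : Set where
              field
                Ps : List Constraint
                Ps< : length Ps < 2 ^ h
                Ps-valid : ∀ {y} → y ∈ Ps → valid? y ≡ true
                Ps-all : ∀ {y} → valid? y ≡ true → y ∈ Ps

            targets : Targets
            targets = go (partition valid? (cartesianProduct Ω Cs))
              where
              go : (∃[ ys ] ∃[ zs ] (cartesianProduct Ω Cs ↭ ys ++ zs) × (length ys ≡ cnt valid? (cartesianProduct Ω Cs)) ×
                (∀ {y} → y ∈ ys → valid? y ≡ true) × (∀ {z} → z ∈ zs → valid? z ≡ false)) → Targets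
              go (Ps , rest , e , l , f , f′) = record { Ps = Ps ; Ps< = Ps< ; Ps-valid = f ; Ps-all = Ps-all }
                where
                Ps< : length Ps < 2 ^ h
                Ps< = ≤-trans (s≤s (≤-trans (≤-reflexive l) (≤-trans (cnt≤length valid? (cartesianProduct Ω Cs))
                  (≤-reflexive (trans (length-× Ω Cs) (cong₂ _*_ (trans (length-× Vs Vs) (cong₂ _*_ lenV lenV)) lenC)))))) h-big
                Ps-all : ∀ {y} → valid? y ≡ true → y ∈ Ps
                Ps-all {y@((u , v) , z)} vy = case ∈-++⁻ Ps (∈-resp-↭ e (∈-cartesianProduct⁺ (∈-cartesianProduct⁺ (Vs-all u) (Vs-all v)) (Cs-all z))) of
                  λ { (inj₁ i) → i ; (inj₂ i) → contradiction (trans (sym vy) (f′ i)) true≢false }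

            record Flexible : Set where
              field
                Bs : List C
                lenB : length Bs ≡ size inB
                B-fits : ∀ e → cnt (λ c → fits c e) Bs ≤ cnt (λ c → inB c ∧ fits c e) Cs

            flexible : Flexible
            flexible = go (partition inB Cs)
              where
              go : (∃[ ys ] ∃[ zs ] (Cs ↭ ys ++ zs) × (length ys ≡ cnt inB Cs) ×
                (∀ {y} → y ∈ ys → inB y ≡ true) × (∀ {z} → z ∈ zs → inB z ≡ false)) → Flexible
              go (Bs , rest , e , l , f , _) = record { Bs = Bs ; lenB = l ; B-fits = λ y → ≤-trans (cnt-mono Bs (λ i h → ∧-intro (f i) h))
                (≤-trans (m≤m+n _ _) (≤-reflexive (sym (trans (Σl-↭ _ e) (Σl-++ _ Bs rest))))) }

            reserved : (tg : Targets) → Reserve S h (Targets.Ps tg)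
            reserved tg = reserve inB B-near Q≥1 N≥1 B≥1 nE₁ ext₁
                (λ v∈ → weaken (s≤s (s≤s (s≤s (m≤n+m P 2)))) (length Vs) (K-deg v∈)) Ps valid S
                (toV (scale (4 * M₁) r n S₁)) S₂′ (toC (scale Q t n S₃)) (toV (scale Q r n S₃)) (toV S₅′) x q≡ h x≥1 S≡ Ps<
              where
              open Targets tg
              valid : ∀ {p} → p ∈ Ps → Valid inB B-near Q≥1 N≥1 B≥1 p
              valid {e , z} p∈ = proj₁ (∧-true {pop e} (Ps-valid p∈)) , Cs-all z , proj₂ (∧-true {pop e} (Ps-valid p∈))
              S₂′ : 4 * Q * (t * S) ≤ size inB
              S₂′ = ≤B _ (toC (≤-trans (≤-reflexive (e₁ β (4 * Q) t S)) (*-monoʳ-≤ t S₂)))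
                where
                e₁ : ∀ b q t S → b * (q * (t * S)) ≡ t * (b * (q * S))
                e₁ = solve-∀
              S₅′ : nE₁ + r * S ≤ r * n
              S₅′ = ≤-trans (+-monoˡ-≤ (r * S) (≤r* nE₁)) (≤-trans (≤-reflexive (sym (*-distribˡ-+ r nE₁ S))) (*-monoʳ-≤ r S₅))

            module WithReserve (tg : Targets) (fl : Flexible) (rs : Reserve S h (Targets.Ps tg)) where
              open Targets tg
              open Flexible fl
              open Reserve rs

              m : ℕ
              m = n ∸ length Ts
              S≤n : S ≤ n
              S≤n = ≤-trans (m≤n+m S nE₁) S₅
              Ts+m : length Ts + m ≡ n
              Ts+m = m+[n∸m]≡n (≤-trans few S≤n)
              size-m : Sizes t Q β S h nE₂ n₀ κ₁ κ₂ x₀ X g n m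
              size-m = sizes m (m∸n≤m n (length Ts)) (≤-trans (≤-reflexive (sym Ts+m)) (≤-trans (≤-reflexive (+-comm (length Ts) m)) (+-monoʳ-≤ m few)))
              open Sizes size-m

              split-len : ∀ k a b → a + b ≡ k * n → a ≡ length Ts * k → b ≡ k * m
              split-len k a b e e′ = +-cancelˡ-≡ (length Ts * k) _ _ (trans (cong (_+ b) (sym e′)) (trans e (trans (cong (k *_) (sym Ts+m)) (e₁ k (length Ts) m))))
                where
                e₁ : ∀ r a m → r * (a + m) ≡ a * r + r * m
                e₁ = solve-∀
              lenU₀ : length U₀ ≡ r * m
              lenU₀ = split-len r (length (verts Ts)) (length U₀) (trans (sym (↭-len (verts Ts) U₀ U↭)) lenV) (length-verts Ts)
              lenUsed : length (map proj₂ LA ++ map proj₂ LO) ≡ length Ts * t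
              lenUsed = trans (trans (length-++ (map proj₂ LA)) (trans (cong₂ _+_ (trans (length-map proj₂ LA) (sym (length-map proj₁ LA))) (trans (length-map proj₂ LO) (sym (length-map proj₁ LO))))
                (sym (length-++ (map proj₁ LA))))) (trans (↭-length es↭) (length-edges Ts))
              lenPool : length pool ≡ t * m
              lenPool = split-len t (length (map proj₂ LA ++ map proj₂ LO)) (length pool) (trans (sym (↭-len (map proj₂ LA ++ map proj₂ LO) pool pool↭)) lenC) lenUsed
              small₀ : Q * length (verts Ts) ≤ length Vs
              small₀ = begin
                Q * length (verts Ts) ≡⟨ cong (Q *_) (length-verts Ts) ⟩
                Q * (length Ts * r) ≤⟨ *-monoʳ-≤ Q (*-monoˡ-≤ r few) ⟩
                Q * (S * r) ≡⟨ cong (Q *_) (*-comm S r) ⟩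
                Q * (r * S) ≤⟨ toV (scale Q r n S₃) ⟩
                length Vs ∎
                where open ≤-Reasoning
              deg₀ : Degrees (5 + P) Q Cs U₀
              deg₀ {i} {v} i∈ v∈ = drop-degree (5 + P) Q (adj i v) (verts Ts) U₀ U↭ small₀ (deg i∈ (Vs-all v))

              rescale : ∀ {A A′ U} → A′ ≤ A * T → Degrees A Q Cs U → Degrees A′ (Q * T) Cs U
              rescale {A} {A′} {U} le d {i} {v} i∈ v∈ = begin
                A′ * length U ≤⟨ *-monoˡ-≤ (length U) le ⟩
                A * T * length U ≡⟨ e₁ A T (length U) ⟩
                T * (A * length U) ≤⟨ *-monoʳ-≤ T (d i∈ v∈) ⟩
                T * (Q * cnt (adj i v) U) ≡⟨ e₂ T Q (cnt (adj i v) U) ⟩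
                Q * T * cnt (adj i v) U ∎
                where
                open ≤-Reasoning
                e₁ : ∀ A T u → A * T * u ≡ T * (A * u)
                e₁ = solve-∀
                e₂ : ∀ T Q c → T * (Q * c) ≡ Q * T * c
                e₂ = solve-∀

              U₀≤ : length U₀ ≤ length Vs
              U₀≤ = ↭-len≤ʳ (verts Ts) U₀ U↭
              w-big′ : ∀ (U : List V) → length U ≤ length Vs → 2 * (length Cs * length U) < 2 ^ w
              w-big′ U le = ≤-trans (s≤s (*-monoʳ-≤ 2 (*-mono-≤ (≤-reflexive lenC) (≤-trans le (≤-reflexive lenV))))) w-big

              record Reservoir : Set where
                field
                  R U′ : List V
                  R↭ : U₀ ↭ R ++ U′
                  lenR : length R ≡ r * ρ
                  degR : ∀ i {v} → v ∈ R → (4 + P) * length R ≤ Q * cnt (adj i v) R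

              reservoir : Reservoir
              reservoir = go (shrink (2 + P) Q T x₀ w r≥1 Q≥1 T≥1 wx₀ ABx₀ Cs κ₁ m U₀ κ₁≤T x₀≤ρ lenU₀ (w-big′ U₀ U₀≤)
                  (λ {i} {v} → rescale {5 + P} {(4 + P) * T + κ₁} {U₀} (≤-trans (+-monoʳ-≤ ((4 + P) * T) κ₁≤T) (≤-reflexive (+-comm ((4 + P) * T) T))) deg₀ {i} {v}))
                where
                go : (∃[ R ] ∃[ U′ ] (U₀ ↭ R ++ U′) × (length R ≡ r * ρ) × Degrees ((4 + P) * T) (Q * T) Cs R) → Reservoir
                go (R , U′ , e , l , d) = record { R = R ; U′ = U′ ; R↭ = e ; lenR = l
                  ; degR = λ i {v} v∈ → cancel-scale (4 + P) Q T (length R) (cnt (adj i v) R) T≥1 (d (Cs-all i) v∈) }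

              module WithReservoir (rv : Reservoir) where
                open Reservoir rv

                lenU′ : length U′ ≡ r * n′
                lenU′ = +-cancelˡ-≡ (r * ρ) _ _ (trans (cong (_+ length U′) (sym lenR)) (trans (sym (↭-len R U′ R↭))
                  (trans lenU₀ (trans (cong (r *_) m≡) (*-distribˡ-+ r ρ n′)))))
                deg′ : Degrees (4 + P) Q Cs U′
                deg′ {i} {v} i∈ v∈ = drop-degree (4 + P) Q (adj i v) R U′ R↭
                  (≤-trans (≤-reflexive (trans (cong (Q *_) lenR) (e₁ Q r ρ))) (≤-trans (*-monoʳ-≤ r Qρ≤) (≤-reflexive (sym lenU₀))))
                  (deg₀ i∈ (∈-sub R U′ R↭ v∈))
                  where
                  e₁ : ∀ Q r p → Q * (r * p) ≡ r * (Q * p)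
                  e₁ = solve-∀

                Bs≥1 : 1 ≤ length Bs
                Bs≥1 = ≤-trans B≥1 (≤-reflexive (sym lenB))

                KB : V → V → Bool
                KB = popular Q Bs

                KB-deg : ∀ {v} → v ∈ R → (3 + P) * length R ≤ Q * cnt (KB v) R
                KB-deg {v} v∈ = popular-degree (3 + P) Q Bs R v Bs≥1 (λ {i} _ → degR i v∈)

                -- Links popularity among the list `Bs`, used inside the reservoir, with the
                -- popularity for which the absorber was prepared.
                KB-pop : ∀ e → KB (proj₁ e) (proj₂ e) ≡ true → pop e ≡ true
                KB-pop e h = ≤ᵇ-true (≤-trans (≤-reflexive (sym lenB)) (≤-trans (≤ᵇ-≤ {length Bs} h) (*-monoʳ-≤ Q (B-fits e))))

                g+ : g + (ρ ∸ g) ≡ ρ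
                g+ = m+[n∸m]≡n (≤-trans (m≤n+m g n₀) n₀≤)

                Boxed : List V → Set
                Boxed W = ∃[ Ts ] (W ↭ verts Ts) × (length Ts ≡ ρ ∸ g) × (∀ {e} → e ∈ edges Ts → KB (proj₁ e) (proj₂ e) ≡ true)

                boxed : ∀ D (Cv : Cover KB D R) → length D ≡ g → Boxed (Cover.W′ Cv)
                boxed D Cv lD = bb W′ (ρ ∸ g) KB (popular-sym Q Bs) (λ u → popular-irr Q Bs u Bs≥1) lenW′ n₀≤W′ λ {v} v∈ →
                    weaken (s≤s (n≤1+n P)) (length W′) (drop-degree (2 + P) Q (KB v) (verts TsD) W′ W↭ smallD (KB-deg (∈-sub (verts TsD) W′ W↭ v∈)))
                  where
                  open Cover Cv
                  lenTs : length (verts TsD) ≡ g * r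
                  lenTs = trans (length-verts TsD) (cong (_* r) (trans lenD lD))
                  lenW′ : length W′ ≡ r * (ρ ∸ g)
                  lenW′ = +-cancelˡ-≡ (g * r) _ _ (trans (cong (_+ length W′) (sym lenTs))
                    (trans (sym (↭-len (verts TsD) W′ W↭)) (trans lenR (trans (cong (r *_) (sym g+)) (e₁ r g (ρ ∸ g))))))
                    where
                    e₁ : ∀ r g k → r * (g + k) ≡ g * r + r * k
                    e₁ = solve-∀
                  n₀≤W′ : n₀ ≤ length W′
                  n₀≤W′ = ≤-trans (+-cancelʳ-≤ g n₀ (ρ ∸ g) (≤-trans n₀≤ (≤-reflexive (trans (sym g+) (+-comm g (ρ ∸ g))))))
                    (≤-trans (≤r* (ρ ∸ g)) (≤-reflexive (sym lenW′)))
                  smallD : Q * length (verts TsD) ≤ length R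
                  smallD = ≤-trans (≤-reflexive (trans (cong (Q *_) lenTs) (e₁ Q g r))) (≤-trans (*-monoʳ-≤ r Qg≤ρ) (≤-reflexive (sym lenR)))
                    where
                    e₁ : ∀ Q g r → Q * (g * r) ≡ r * (Q * g)
                    e₁ = solve-∀

                ζ≤h : ζ ≤ h
                ζ≤h = ≤-trans (≤-trans (m≤m+n ζ g) (≤-reflexive (sym tρ≡))) tρ≤h

                -- The pending edges number `t * ρ - g = ζ`, exactly as many as the spare colours.
                -- Each pair of them is hit at least `h ≥ ζ` times, so the exchanges never run out
                -- of absorbing edges.
                finish : ∀ Z cs D → pool ↭ Z ++ (cs ++ D) → length Z ≡ ζ → (∀ {z} → z ∈ Z → inB z ≡ true) → length D ≡ g →
                  Tiled U′ cs → (Cv : Cover KB D R) → Boxed (Cover.W′ Cv) → Tiled Vs Cs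
                finish Z cs D Z↭ lenZ Z-in lD T′ Cv (Ts₂ , W′↭ , len₂ , pop₂) = go (absorb LA pend Z (trans len-pend (sym lenZ)) okA λ {e} {z} e∈ z∈ →
                    ≤-trans (≤-reflexive len-pend) (≤-trans ζ≤h (enough (Ps-all (∧-intro (KB-pop e (pend-pop e∈)) (Z-in z∈))))))
                  where
                  open Cover Cv
                  pend : List (V × V)
                  pend = esD ++ edges Ts₂
                  pend-pop : ∀ {e} → e ∈ pend → KB (proj₁ e) (proj₂ e) ≡ true
                  pend-pop {e} e∈ = case ∈-++⁻ esD e∈ of λ { (inj₁ j) → popD j ; (inj₂ j) → pop₂ j }
                  lenLD : length (map proj₁ LD) ≡ g
                  lenLD = trans (length-map proj₁ LD) (trans (sym (length-map proj₂ LD)) (trans (cong length D≡) lD))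
                  len-pend : length pend ≡ ζ
                  len-pend = +-cancelʳ-≡ g _ _ (begin
                    length pend + g ≡⟨ cong₂ _+_ (length-++ esD) (sym lenLD) ⟩
                    length esD + length (edges Ts₂) + length (map proj₁ LD) ≡⟨ e₁ (length esD) (length (edges Ts₂)) (length (map proj₁ LD)) ⟩
                    length (map proj₁ LD) + length esD + length (edges Ts₂) ≡⟨ cong (_+ length (edges Ts₂)) (trans (sym (length-++ (map proj₁ LD))) (trans (↭-length esD↭) (length-edges TsD))) ⟩
                    length TsD * t + length (edges Ts₂) ≡⟨ cong₂ _+_ (cong (_* t) (trans lenD lD)) (trans (length-edges Ts₂) (cong (_* t) len₂)) ⟩
                    g * t + (ρ ∸ g) * t ≡⟨ *-distribʳ-+ t g (ρ ∸ g) ⟨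
                    (g + (ρ ∸ g)) * t ≡⟨ cong (_* t) g+ ⟩
                    ρ * t ≡⟨ *-comm ρ t ⟩
                    t * ρ ≡⟨ tρ≡ ⟩
                    ζ + g ∎)
                    where
                    open ≡-Reasoning
                    e₁ : ∀ a b c → a + b + c ≡ c + a + b
                    e₁ = solve-∀
                  go : (∃[ L ] (map proj₁ L ↭ pend ++ map proj₁ LA) × (map proj₂ L ↭ Z ++ map proj₂ LA) × Proper L) → Tiled Vs Cs
                  go (L , L₁ , L₂ , okL) = glue Ts TsD Ts₂ L LA LO LD esD U₀ R W′ pool Z D U↭ R↭ W↭ W′↭ es↭ esD↭ pool↭ Z↭ D≡ L₁ L₂ okL okO okD T′

                ABx₀′ : 2 * ((2 + P) * T + T + Q * T) ≤ x₀
                ABx₀′ = ≤-trans (*-monoʳ-≤ 2 (+-monoˡ-≤ (Q * T) (+-monoˡ-≤ T (*-monoˡ-≤ T (s≤s (s≤s (m≤n+m P 2))))))) ABx₀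

                -- `B` has at least `t * (ρ + S)` colours, and the absorber has consumed at most
                -- `t * S`.
                Z-room : ζ ≤ cnt inB pool
                Z-room = +-cancelˡ-≤ (length Ts * t) _ _ (begin
                  length Ts * t + ζ ≤⟨ +-mono-≤ (*-monoˡ-≤ t few) (≤-trans (m≤m+n ζ g) (≤-reflexive (sym tρ≡))) ⟩
                  S * t + t * ρ ≡⟨ e₁ S t ρ ⟩
                  t * (ρ + S) ≤⟨ ≤B (t * (ρ + S)) (toC (≤-trans (≤-reflexive (e₂ β t (ρ + S))) (*-monoʳ-≤ t βρ≤))) ⟩
                  size inB ≤⟨ cnt-++≤ inB (map proj₂ LA ++ map proj₂ LO) pool pool↭ ⟩
                  length (map proj₂ LA ++ map proj₂ LO) + cnt inB pool ≡⟨ cong (_+ cnt inB pool) lenUsed ⟩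
                  length Ts * t + cnt inB pool ∎)
                  where
                  open ≤-Reasoning
                  e₁ : ∀ S t p → S * t + t * p ≡ t * (p + S)
                  e₁ = solve-∀
                  e₂ : ∀ b t k → b * (t * k) ≡ t * (b * k)
                  e₂ = solve-∀

                tiling : Tiled Vs Cs
                -- The spare colours must lie in `B`, so they are reserved before the greedy tiling,
                -- which works with any sufficiently large supply of colours and leaves exactly `g`
                -- of the others.
                tiling = stage₁ (pickN inB ζ pool Z-room)
                  where
                  stage₂ : ∀ Z D₀ → pool ↭ Z ++ D₀ → length Z ≡ ζ → (∀ {z} → z ∈ Z → inB z ≡ true) → length D₀ ≡ t * n′ + g →
                    (∃[ cs ] ∃[ D ] (D₀ ↭ cs ++ D) × (length cs ≡ t * n′) × Tiled U′ cs) → Tiled Vs Cs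
                  stage₂ Z D₀ Z↭ lenZ Z-in lenD₀ (cs , D , D↭ , lcs , T′) =
                      finish Z cs D (↭-trans Z↭ (++⁺ˡ Z D↭)) lenZ Z-in lenD T′ Cv (boxed D Cv lenD)
                    where
                    lenD : length D ≡ g
                    lenD = +-cancelˡ-≡ (t * n′) _ _ (trans (cong (_+ length D) (sym lcs)) (trans (sym (↭-len cs D D↭)) lenD₀))
                    Cv : Cover KB D R
                    Cv = Covering.Cover-within.cover needK P Q half Bs R ρ g nE₂ r≥1 Bs≥1 lenR Qg≤ρ nE≤ degR ext₂ D [] R ↭-refl (≤-reflexive (cong (r *_) lenD))
                  stage₁ : (∃[ Z ] ∃[ D₀ ] (pool ↭ Z ++ D₀) × (length Z ≡ ζ) × (∀ {z} → z ∈ Z → inB z ≡ true)) → Tiled Vs Cs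
                  stage₁ (Z , D₀ , Z↭ , lenZ , Z-in) = stage₂ Z D₀ Z↭ lenZ Z-in lenD₀
                    (tile P Q T x₀ w r≥1 Q≥1 T≥1 wx₀ ABx₀′ Cs n₀ X g bb n₀≤x₀ g≥1 QtX≤g κ₂ n′ U′ D₀ κ₂≤T lenU′ lo hi (≤-reflexive (sym lenD₀))
                      (λ {i} _ → Cs-all i) (w-big′ U′ (≤-trans (↭-len≤ʳ R U′ R↭) U₀≤))
                      (λ {i} {v} → rescale {4 + P} {(2 + P) * T + κ₂} {U′} (≤-trans (+-monoʳ-≤ ((2 + P) * T) κ₂≤T) (≤-trans (≤-reflexive (+-comm ((2 + P) * T) T)) (*-monoˡ-≤ T (s≤s (s≤s (s≤s (n≤1+n P))))))) deg′ {i} {v}))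
                    where
                    lenD₀ : length D₀ ≡ t * n′ + g
                    lenD₀ = +-cancelˡ-≡ ζ _ _ (trans (cong (_+ length D₀) (sym lenZ)) (trans (sym (↭-len Z D₀ Z↭)) (trans lenPool
                      (trans (cong (t *_) m≡) (trans (*-distribˡ-+ t ρ n′) (trans (cong (_+ t * n′) tρ≡) (e₁ ζ g (t * n′))))))))
                      where
                      e₁ : ∀ a b c → a + b + c ≡ a + (c + b)
                      e₁ = solve-∀

          assembled : Tiled Vs Cs
          assembled = WithClique.WithReserve.WithReservoir.tiling clique tg fl rs (WithClique.WithReserve.reservoir clique tg fl rs)
            where
            tg = WithClique.targets clique
            fl = WithClique.flexible clique
            rs = WithClique.reserved clique tg

  -- Choice of the parameters

  quotient : ∀ k n → 1 ≤ k → ∃[ w ] (k * w ≤ n) × (n < k * suc w)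
  quotient k zero k≥1 = 0 , ≤-reflexive (*-zeroʳ k) , ≤-trans k≥1 (≤-reflexive (sym (*-identityʳ k)))
  quotient k (suc n) k≥1 with quotient k n k≥1
  ... | w , lo , hi with suc n <? k * suc w
  ... | yes lt = w , m≤n⇒m≤1+n lo , lt
  ... | no nlt = suc w , ≮⇒≥ nlt , ≤-trans (s≤s hi) (≤-trans (+-monoˡ-≤ (k * suc w) k≥1) (≤-reflexive (sym (*-suc k (suc w)))))

  -- With `v` the quotient of `w` by 7, both `F ≤ v` and `w ≤ v * v` hold, hence
  -- `F * w ^ 3 ≤ v ^ 7 < 2 ^ (7 * v)`.
  cubic<exponential : ∀ F w → 7 * (14 + F) ≤ w → F * (w * w * w) < 2 ^ w
  cubic<exponential F w big = go (quotient 7 w (s≤s z≤n))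
    where
    open ≤-Reasoning
    go : (∃[ v ] (7 * v ≤ w) × (w < 7 * suc v)) → F * (w * w * w) < 2 ^ w
    go (v , lo , hi) = begin-strict
      F * (w * w * w) ≤⟨ *-mono-≤ F≤v (*-mono-≤ (*-mono-≤ w≤v² w≤v²) w≤v²) ⟩
      v * (v * v * (v * v) * (v * v)) ≡⟨ e₁ v ⟩
      v ^ 7 <⟨ ^-monoˡ-< 7 (n<2^n v) ⟩
      (2 ^ v) ^ 7 ≡⟨ ^-*-assoc 2 v 7 ⟩
      2 ^ (v * 7) ≤⟨ ^-monoʳ-≤ 2 (≤-trans (≤-reflexive (*-comm v 7)) lo) ⟩
      2 ^ w ∎
      where
      e₁ : ∀ v → v * (v * v * (v * v) * (v * v)) ≡ v * (v * (v * (v * (v * (v * (v * 1))))))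
      e₁ = solve-∀
      14+F≤v : 14 + F ≤ v
      14+F≤v = s≤s⁻¹ (*-cancelˡ-< 7 (14 + F) (suc v) (≤-trans (s≤s big) hi))
      F≤v : F ≤ v
      F≤v = ≤-trans (m≤n+m F 14) 14+F≤v
      14≤v : 14 ≤ v
      14≤v = ≤-trans (m≤m+n 14 F) 14+F≤v
      w≤v² : w ≤ v * v
      w≤v² = begin
        w ≤⟨ <⇒≤ hi ⟩
        7 * suc v ≡⟨ e₂ v ⟩
        7 * v + 7 * 1 ≤⟨ +-monoʳ-≤ (7 * v) (*-monoʳ-≤ 7 (≤-trans (s≤s {0} {13} z≤n) 14≤v)) ⟩
        7 * v + 7 * v ≡⟨ e₃ v ⟩
        14 * v ≤⟨ *-monoˡ-≤ v 14≤v ⟩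
        v * v ∎
        where
        e₂ : ∀ v → 7 * suc v ≡ 7 * v + 7 * 1
        e₂ = solve-∀
        e₃ : ∀ v → 7 * v + 7 * v ≡ 14 * v
        e₃ = solve-∀

  module Choice (r t P Q nE₁ nE₂ n₀ : ℕ) (r≥1 : 1 ≤ r) (t≥1 : 1 ≤ t) (Q≥1 : 1 ≤ Q) where

    M₁ β q x : ℕ
    M₁ = 2 * Q * (2 * Q)
    β = (4 * Q) ^ (2 * Q)
    q = 2 * (8 * Q * M₁)
    x = q ∸ 1

    2Q≥1 : 1 ≤ 2 * Q
    2Q≥1 = ≤-trans Q≥1 (m≤m+n Q (Q + 0))
    q≥2 : 2 ≤ q
    q≥2 = *-monoʳ-≤ 2 (*-mono-≤ (≤-trans Q≥1 (m≤m+n Q (7 * Q))) (*-mono-≤ 2Q≥1 2Q≥1))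
    q≡ : q ≡ suc x
    q≡ = sym (m+[n∸m]≡n (≤-trans (s≤s z≤n) q≥2))
    x≥1 : 1 ≤ x
    x≥1 = s≤s⁻¹ (≤-trans q≥2 (≤-reflexive q≡))

    -- The conditions on `S`, and the one on `ρ + S`, reduce to bounding `a * y` times one of these
    -- coefficients by `n`.
    k₁ k₂ k₃ k₄ k₅ : ℕ
    k₁ = 16 * M₁ * x * t
    k₂ = β * (16 * Q * x * t)
    k₃ = 4 * Q * x * t
    k₄ = 8 * x * t
    k₅ = β * (2 + 4 * x * t)

    -- `n` will lie between `A * y` and `2 * A * y`, where `y` is the largest number of tiles in a
    -- part tiled greedily. `κ₁` is chosen so that `p = 2 ^ κ₁` exceeds all coefficients; `a` gives
    -- the reservoir at least `2 * Q * g` tiles; `κ₂ = 2 * A` lets `2 ^ κ₂` parts of `y` tiles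
    -- exhaust `n`. `F` adds the coefficients of the two polynomials in `w` that have to stay below
    -- `2 ^ w`.
    κ₁ p a A κ₂ T cc G F k W₀ : ℕ
    κ₁ = k₁ + (k₂ + (k₃ + (k₄ + (k₅ + (Q + 2)))))
    p = 2 ^ κ₁
    a = 4 * (Q * Q * t)
    A = p * a
    κ₂ = 2 * A
    T = suc (κ₁ + κ₂)
    cc = suc (8 * (2 * (Q * T)) * (2 * (Q * T)) + (2 * ((4 + P) * T + T + Q * T) + n₀))
    k = A * (2 ^ κ₂ * cc)
    G = 2 * k
    F = 2 * (t * G * (r * G)) + r * G * (r * G) * (t * G)
    W₀ = 7 * (14 + F) + (nE₁ + nE₁ + (nE₂ + n₀))

    κ₁≤p : κ₁ ≤ p
    κ₁≤p = <⇒≤ (n<2^n κ₁)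
    k₁≤p : k₁ ≤ p
    k₁≤p = ≤-trans (m≤m+n k₁ _) κ₁≤p
    r₁≤p : k₂ + (k₃ + (k₄ + (k₅ + (Q + 2)))) ≤ p
    r₁≤p = ≤-trans (m≤n+m _ k₁) κ₁≤p
    k₂≤p : k₂ ≤ p
    k₂≤p = ≤-trans (m≤m+n k₂ _) r₁≤p
    r₂≤p : k₃ + (k₄ + (k₅ + (Q + 2))) ≤ p
    r₂≤p = ≤-trans (m≤n+m _ k₂) r₁≤p
    k₃≤p : k₃ ≤ p
    k₃≤p = ≤-trans (m≤m+n k₃ _) r₂≤p
    r₃≤p : k₄ + (k₅ + (Q + 2)) ≤ p
    r₃≤p = ≤-trans (m≤n+m _ k₃) r₂≤p
    k₄≤p : k₄ ≤ p
    k₄≤p = ≤-trans (m≤m+n k₄ _) r₃≤p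
    r₄≤p : k₅ + (Q + 2) ≤ p
    r₄≤p = ≤-trans (m≤n+m _ k₄) r₃≤p
    k₅≤p : k₅ ≤ p
    k₅≤p = ≤-trans (m≤m+n k₅ _) r₄≤p
    Q+2≤p : Q + 2 ≤ p
    Q+2≤p = ≤-trans (m≤n+m _ k₅) r₄≤p
    Q≤p : Q ≤ p
    Q≤p = ≤-trans (m≤m+n Q 2) Q+2≤p
    2≤p : 2 ≤ p
    2≤p = ≤-trans (m≤n+m 2 Q) Q+2≤p
    p≥1 : 1 ≤ p
    p≥1 = m^n>0 2 κ₁
    QQt≥1 : 1 ≤ Q * Q * t
    QQt≥1 = *-mono-≤ (*-mono-≤ Q≥1 Q≥1) t≥1
    a≥1 : 1 ≤ a
    a≥1 = ≤-trans QQt≥1 (m≤m+n (Q * Q * t) (3 * (Q * Q * t)))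
    A≥1 : 1 ≤ A
    A≥1 = *-mono-≤ p≥1 a≥1
    k≥1 : 1 ≤ k
    k≥1 = *-mono-≤ A≥1 (*-mono-≤ (m^n>0 2 κ₂) (s≤s {0} z≤n))
    cc₁ : 8 * (2 * (Q * T)) * (2 * (Q * T)) ≤ cc
    cc₁ = ≤-trans (m≤m+n _ _) (n≤1+n _)
    cc₂ : 2 * ((4 + P) * T + T + Q * T) ≤ cc
    cc₂ = ≤-trans (≤-trans (m≤m+n _ n₀) (m≤n+m _ (8 * (2 * (Q * T)) * (2 * (Q * T))))) (n≤1+n _)

    ≤* : ∀ b c → 1 ≤ c → b ≤ c * b
    ≤* b c c≥1 = ≤-trans (≤-reflexive (sym (*-identityˡ b))) (*-monoˡ-≤ b c≥1)

    module _ (n w : ℕ) (W₀≤w : W₀ ≤ w) (k-lo : k * w ≤ n) (k-hi : n < k * suc w) where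

      x₀ y h S g : ℕ
      x₀ = cc * w
      y = 2 ^ κ₂ * x₀
      h = 2 * a * t * y
      S = x * (2 * h)
      g = Q * (t * y)

      w-large : 7 * (14 + F) ≤ w
      w-large = ≤-trans (m≤m+n _ _) W₀≤w
      w≥1 : 1 ≤ w
      w≥1 = ≤-trans (≤-trans (s≤s {0} {13 + F} z≤n) (≤* (14 + F) 7 (s≤s z≤n))) w-large
      w≤x₀ : w ≤ x₀
      w≤x₀ = ≤* w cc (s≤s z≤n)
      x₀≤y : x₀ ≤ y
      x₀≤y = ≤* x₀ (2 ^ κ₂) (m^n>0 2 κ₂)
      w≤y : w ≤ y
      w≤y = ≤-trans w≤x₀ x₀≤y
      rest≤w : nE₁ + nE₁ + (nE₂ + n₀) ≤ w
      rest≤w = ≤-trans (m≤n+m _ (7 * (14 + F))) W₀≤w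
      nE₂≤y : nE₂ ≤ y
      nE₂≤y = ≤-trans (≤-trans (≤-trans (m≤m+n nE₂ n₀) (m≤n+m _ (nE₁ + nE₁))) rest≤w) w≤y
      n₀≤y : n₀ ≤ y
      n₀≤y = ≤-trans (≤-trans (≤-trans (m≤n+m n₀ nE₂) (m≤n+m _ (nE₁ + nE₁))) rest≤w) w≤y
      kw≡ : k * w ≡ A * y
      kw≡ = e₁ A (2 ^ κ₂) cc w
        where
        e₁ : ∀ A p c w → A * (p * c) * w ≡ A * (p * (c * w))
        e₁ = solve-∀
      Ay≤n : A * y ≤ n
      Ay≤n = ≤-trans (≤-reflexive (sym kw≡)) k-lo
      n≤Gw : n ≤ G * w
      n≤Gw = ≤-trans (<⇒≤ k-hi) (≤-trans (*-monoʳ-≤ k (≤-trans (+-monoˡ-≤ w w≥1) (≤-reflexive (cong (w +_) (sym (+-identityʳ w)))))) (≤-reflexive (e₁ k w)))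
        where
        e₁ : ∀ k w → k * (2 * w) ≡ 2 * k * w
        e₁ = solve-∀
      n≤2Ay : n ≤ 2 * (A * y)
      n≤2Ay = ≤-trans n≤Gw (≤-reflexive (trans (*-assoc 2 k w) (cong (2 *_) kw≡)))
      y≤n : y ≤ n
      y≤n = ≤-trans (≤* y A A≥1) Ay≤n

      lift : ∀ c → c ≤ p → a * y * c ≤ n
      lift c le = ≤-trans (*-monoʳ-≤ (a * y) le) (≤-trans (≤-reflexive (e₁ a y p)) Ay≤n)
        where
        e₁ : ∀ a y p → a * y * p ≡ p * a * y
        e₁ = solve-∀

      S₁ : 4 * M₁ * S ≤ n
      S₁ = ≤-trans (≤-reflexive (e₁ M₁ x a t y)) (lift k₁ k₁≤p)
        where
        e₁ : ∀ M x a t y → 4 * M * (x * (2 * (2 * a * t * y))) ≡ a * y * (16 * M * x * t)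
        e₁ = solve-∀
      S₂ : β * (4 * Q * S) ≤ n
      S₂ = ≤-trans (≤-reflexive (e₁ β Q x a t y)) (lift k₂ k₂≤p)
        where
        e₁ : ∀ β Q x a t y → β * (4 * Q * (x * (2 * (2 * a * t * y)))) ≡ a * y * (β * (16 * Q * x * t))
        e₁ = solve-∀
      S₃ : Q * S ≤ n
      S₃ = ≤-trans (≤-reflexive (e₁ Q x a t y)) (lift k₃ k₃≤p)
        where
        e₁ : ∀ Q x a t y → Q * (x * (2 * (2 * a * t * y))) ≡ a * y * (4 * Q * x * t)
        e₁ = solve-∀
      2S≤n : 2 * S ≤ n
      2S≤n = ≤-trans (≤-reflexive (e₁ x a t y)) (lift k₄ k₄≤p)
        where
        e₁ : ∀ x a t y → 2 * (x * (2 * (2 * a * t * y))) ≡ a * y * (8 * x * t)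
        e₁ = solve-∀
      S₅ : nE₁ + S ≤ n
      S₅ = *-cancelˡ-≤ 2 (≤-trans (≤-reflexive (e₁ nE₁ S)) (≤-trans (+-mono-≤ (≤-trans (m≤m+n (nE₁ + nE₁) _) (≤-trans rest≤w (≤-trans w≤y y≤n))) 2S≤n)
          (≤-reflexive (cong (n +_) (sym (+-identityʳ n))))))
        where
        e₁ : ∀ e S → 2 * (e + S) ≡ e + e + 2 * S
        e₁ = solve-∀

      w-big : 2 * (t * n * (r * n)) < 2 ^ w
      w-big = ≤-trans (s≤s (begin
          2 * (t * n * (r * n)) ≤⟨ *-monoʳ-≤ 2 (*-mono-≤ (*-monoʳ-≤ t n≤Gw) (*-monoʳ-≤ r n≤Gw)) ⟩
          2 * (t * (G * w) * (r * (G * w))) ≡⟨ e₁ t r G w ⟩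
          2 * (t * G * (r * G)) * (w * w * 1) ≤⟨ *-mono-≤ (m≤m+n (2 * (t * G * (r * G))) (r * G * (r * G) * (t * G))) (*-monoʳ-≤ (w * w) w≥1) ⟩
          F * (w * w * w) ∎)) (cubic<exponential F w w-large)
        where
        open ≤-Reasoning
        e₁ : ∀ t r G w → 2 * (t * (G * w) * (r * (G * w))) ≡ 2 * (t * G * (r * G)) * (w * w * 1)
        e₁ = solve-∀
      w≤h : w ≤ h
      w≤h = ≤-trans w≤y (≤* y (2 * a * t) (*-mono-≤ (≤-trans a≥1 (m≤m+n a (a + 0))) t≥1))
      h-big : r * n * (r * n) * (t * n) < 2 ^ h
      h-big = ≤-trans (≤-trans (s≤s (begin
          r * n * (r * n) * (t * n) ≤⟨ *-mono-≤ (*-mono-≤ (*-monoʳ-≤ r n≤Gw) (*-monoʳ-≤ r n≤Gw)) (*-monoʳ-≤ t n≤Gw) ⟩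
          r * (G * w) * (r * (G * w)) * (t * (G * w)) ≡⟨ e₁ t r G w ⟩
          r * G * (r * G) * (t * G) * (w * w * w) ≤⟨ *-monoˡ-≤ (w * w * w) (m≤n+m (r * G * (r * G) * (t * G)) (2 * (t * G * (r * G)))) ⟩
          F * (w * w * w) ∎)) (cubic<exponential F w w-large)) (^-monoʳ-≤ 2 w≤h)
        where
        open ≤-Reasoning
        e₁ : ∀ t r G w → r * (G * w) * (r * (G * w)) * (t * (G * w)) ≡ r * G * (r * G) * (t * G) * (w * w * w)
        e₁ = solve-∀

      sizes : ∀ m → m ≤ n → n ≤ m + S → Sizes t Q β S h nE₂ n₀ κ₁ κ₂ x₀ y g n m
      sizes m m≤n n≤ = record
        { n′ = m ∸ ρ ; ζ = t * ρ ∸ g ; m≡ = sym ρ+n′ ; tρ≡ = sym (m∸n+n≡m g≤tρ) ; x₀≤ρ = ≤-trans x₀≤y y≤ρ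
        ; Qρ≤ = ≤-trans (*-monoˡ-≤ ρ Q≤p) pρ≤m ; lo = ≤-trans y≤ρ ρ≤n′ ; hi = hi
        ; Qg≤ρ = ≤-trans Qg≤u u≤ρ ; nE≤ = plus-g nE₂ nE₂≤y ; n₀≤ = plus-g n₀ n₀≤y ; tρ≤h = tρ≤h ; βρ≤ = βρ≤ }
        where
        open ≤-Reasoning
        ρ = halves κ₁ m
        -- Equal to `2 * Q * g`, and a lower bound for `ρ`, since `2 * p * u = A * y ≤ n ≤ 2 * m < 2
        -- * p * (ρ + 1)`.
        u = 2 * (Q * Q * t) * y
        pρ≤m : p * ρ ≤ m
        pρ≤m = halves-upper κ₁ m
        ρ+n′ : ρ + (m ∸ ρ) ≡ m
        ρ+n′ = m+[n∸m]≡n (halves≤ κ₁ m)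
        n≤2m : n ≤ 2 * m
        n≤2m = by-lin 0 (+-mono-≤ (*-monoʳ-≤ 2 n≤) 2S≤n) (e₁ n m S)
          where
          e₁ : ∀ n m S → n + (2 * (m + S) + n) + 0 ≡ 2 * m + (2 * n + 2 * S)
          e₁ = solve-∀
        ρ≤ : ρ ≤ 2 * a * y
        ρ≤ = cancelˡ p p≥1 (≤-trans pρ≤m (≤-trans m≤n (≤-trans n≤2Ay (≤-reflexive (e₁ p a y)))))
          where
          e₁ : ∀ p a y → 2 * (p * a * y) ≡ p * (2 * a * y)
          e₁ = solve-∀
        u≤ρ : u ≤ ρ
        u≤ρ = s≤s⁻¹ (*-cancelˡ-< (2 * p) u (suc ρ) (begin-strict
          2 * p * u ≡⟨ e₁ p (Q * Q * t) y ⟩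
          A * y ≤⟨ Ay≤n ⟩
          n ≤⟨ n≤2m ⟩
          2 * m <⟨ *-monoʳ-< 2 (halves-lower κ₁ m) ⟩
          2 * (p * suc ρ) ≡⟨ *-assoc 2 p (suc ρ) ⟨
          2 * p * suc ρ ∎))
          where
          e₁ : ∀ p c y → 2 * p * (2 * c * y) ≡ p * (4 * c) * y
          e₁ = solve-∀
        Qg≤u : Q * g ≤ u
        Qg≤u = ≤-trans (≤-trans (≤-reflexive (e₁ Q t y)) (m≤m+n (Q * Q * t * y) (Q * Q * t * y))) (≤-reflexive (e₂ (Q * Q * t) y))
          where
          e₁ : ∀ Q t y → Q * (Q * (t * y)) ≡ Q * Q * t * y
          e₁ = solve-∀
          e₂ : ∀ c y → c * y + c * y ≡ 2 * c * y
          e₂ = solve-∀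
        y≤g : y ≤ g
        y≤g = ≤-trans (≤* y t t≥1) (≤* (t * y) Q Q≥1)
        2g≤u : g + g ≤ u
        2g≤u = ≤-trans (≤-reflexive (e₁ Q t y)) (≤-trans (*-monoʳ-≤ 2 (≤* (Q * (t * y)) Q Q≥1)) (≤-reflexive (e₂ Q t y)))
          where
          e₁ : ∀ Q t y → Q * (t * y) + Q * (t * y) ≡ 2 * (Q * (t * y))
          e₁ = solve-∀
          e₂ : ∀ Q t y → 2 * (Q * (Q * (t * y))) ≡ 2 * (Q * Q * t) * y
          e₂ = solve-∀
        y≤ρ : y ≤ ρ
        y≤ρ = ≤-trans y≤g (≤-trans (m≤m+n g g) (≤-trans 2g≤u u≤ρ))
        plus-g : ∀ c → c ≤ y → c + g ≤ ρ
        plus-g c le = ≤-trans (+-monoˡ-≤ g (≤-trans le y≤g)) (≤-trans 2g≤u u≤ρ)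
        g≤tρ : g ≤ t * ρ
        g≤tρ = ≤-trans (≤-trans (m≤m+n g g) (≤-trans 2g≤u u≤ρ)) (≤* ρ t t≥1)
        ρ≤n′ : ρ ≤ m ∸ ρ
        ρ≤n′ = +-cancelˡ-≤ ρ _ _ (≤-trans (≤-trans (≤-reflexive (cong (ρ +_) (sym (+-identityʳ ρ)))) (*-monoˡ-≤ ρ 2≤p)) (≤-trans pρ≤m (≤-reflexive (sym ρ+n′))))
        hi : m ∸ ρ ≤ 2 ^ κ₂ * y
        hi = ≤-trans (≤-trans (m∸n≤m m ρ) m≤n) (≤-trans n≤2Ay (≤-trans (≤-reflexive (sym (*-assoc 2 A y))) (*-monoˡ-≤ y (<⇒≤ (n<2^n κ₂)))))
        tρ≤h : t * ρ ≤ h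
        tρ≤h = ≤-trans (*-monoʳ-≤ t ρ≤) (≤-reflexive (e₁ t a y))
          where
          e₁ : ∀ t a y → t * (2 * a * y) ≡ 2 * a * t * y
          e₁ = solve-∀
        βρ≤ : β * (ρ + S) ≤ n
        βρ≤ = ≤-trans (*-monoʳ-≤ β (+-monoˡ-≤ S ρ≤)) (≤-trans (≤-reflexive (e₁ β a y x t)) (lift k₅ k₅≤p))
          where
          e₁ : ∀ β a y x t → β * (2 * a * y + x * (2 * (2 * a * t * y))) ≡ a * y * (β * (2 + 4 * x * t))
          e₁ = solve-∀

      params : Parameters r t P Q nE₁ nE₂ n₀ n
      params = record
        { S = S ; h = h ; x = x ; κ₁ = κ₁ ; κ₂ = κ₂ ; T = T ; x₀ = x₀ ; X = y ; w = w ; g = g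
        ; S₁ = S₁ ; S₂ = S₂ ; S₃ = S₃ ; S₅ = S₅ ; q≡ = q≡ ; x≥1 = x≥1 ; S≡ = refl ; h-big = h-big
        ; T≥1 = s≤s z≤n ; κ₁≤T = ≤-trans (m≤m+n κ₁ κ₂) (n≤1+n _) ; κ₂≤T = ≤-trans (m≤n+m κ₂ κ₁) (n≤1+n _)
        ; wx₀ = *-monoˡ-≤ w cc₁
        ; ABx₀ = ≤-trans (≤-trans cc₂ (≤-reflexive (sym (*-identityʳ cc)))) (*-monoʳ-≤ cc w≥1)
        ; w-big = w-big ; n₀≤x₀ = ≤-trans (≤-trans (≤-trans (m≤n+m n₀ nE₂) (m≤n+m _ (nE₁ + nE₁))) rest≤w) w≤x₀
        ; g≥1 = *-mono-≤ Q≥1 (*-mono-≤ t≥1 (≤-trans w≥1 w≤y)) ; QtX≤g = ≤-refl ; sizes = sizes }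

    n₁ : ℕ
    n₁ = k * W₀

    parameters : ∀ n → n₁ ≤ n → Parameters r t P Q nE₁ nE₂ n₀ n
    parameters n n₁≤n = go (quotient k n k≥1)
      where
      go : (∃[ w ] (k * w ≤ n) × (n < k * suc w)) → Parameters r t P Q nE₁ nE₂ n₀ n
      go (w , lo , hi) = params n w (s≤s⁻¹ (*-cancelˡ-< k W₀ (suc w) (≤-trans (s≤s n₁≤n) hi))) lo hi

  -- From lists to graphs

  open import Defs using (Graph; count; deg; edgeCount; Edge; IsFactor; IsTransversal; Collection; AdmissibleδF; HasBridge; Reach; deleteEdge; δT≤; MinDegAtLeast; ℕ→ℚ)

  module _ where
    open import Data.List.Relation.Unary.Unique.Propositional public using (Unique)
    open import Data.List.Relation.Unary.Unique.Propositional.Properties public using (allFin⁺; cartesianProduct⁺; Unique[x∷xs]⇒x∉xs) renaming (tabulate⁺ to Unique-tabulate⁺; ++⁺ to Unique-++⁺)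
    open import Data.List.Relation.Unary.AllPairs public using (AllPairs; []; _∷_)
    open import Data.List.Relation.Unary.All public using (All; []; _∷_)
    open import Data.List.Relation.Unary.All.Properties public using (¬Any⇒All¬)
    open import Data.List.Relation.Binary.Permutation.Propositional using (↭⇒↭ₛ)
    open import Relation.Binary.PropositionalEquality.Properties using (setoid)
    import Data.List.Relation.Binary.Permutation.Setoid.Properties as SetoidPerm

    Unique-↭ : {A : Set} {xs ys : List A} → xs ↭ ys → Unique xs → Unique ys
    Unique-↭ {A} p = SetoidPerm.Unique-resp-↭ (setoid A) (↭⇒↭ₛ p)

  Unique-++ˡ : {A : Set} (xs : List A) {ys : List A} → Unique (xs ++ ys) → Unique xs
  Unique-++ˡ [] u = []
  Unique-++ˡ (x ∷ xs) u@(_ ∷ us) = ¬Any⇒All¬ xs (λ i → Unique[x∷xs]⇒x∉xs u (∈-++⁺ˡ i)) ∷ Unique-++ˡ xs us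

  Unique-++ʳ : {A : Set} (xs : List A) {ys : List A} → Unique (xs ++ ys) → Unique ys
  Unique-++ʳ [] u = u
  Unique-++ʳ (x ∷ xs) (_ ∷ us) = Unique-++ʳ xs us

  Unique-disjoint : {A : Set} (xs : List A) {ys : List A} → Unique (xs ++ ys) → ∀ {v} → v ∈ xs → v ∈ ys → ⊥
  Unique-disjoint (x ∷ xs) u (here refl) j = Unique[x∷xs]⇒x∉xs u (∈-++⁺ʳ xs j)
  Unique-disjoint (x ∷ xs) (_ ∷ us) (there i) j = Unique-disjoint xs us i j

  Unique-map-on : {A B : Set} (f : A → B) (xs : List A) → (∀ {x y} → x ∈ xs → y ∈ xs → f x ≡ f y → x ≡ y) → Unique xs → Unique (map f xs)
  Unique-map-on f [] inj u = []
  Unique-map-on f (x ∷ xs) inj u@(_ ∷ us) = ¬Any⇒All¬ (map f xs) bad ∷ Unique-map-on f xs (λ i j → inj (there i) (there j)) us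
    where
    bad : ¬ (f x ∈ map f xs)
    bad i with ∈-map⁻ f i
    ... | y , y∈ , e = Unique[x∷xs]⇒x∉xs u (subst (_∈ xs) (sym (inj (here refl) (there y∈) e)) y∈)

  unique-injective : {A B : Set} (f : A → B) (xs : List A) → Unique (map f xs) → ∀ {x y} → x ∈ xs → y ∈ xs → f x ≡ f y → x ≡ y
  unique-injective f (z ∷ xs) u (here refl) (here refl) e = refl
  unique-injective f (z ∷ xs) u (here refl) (there j) e = ⊥-elim (Unique[x∷xs]⇒x∉xs u (subst (_∈ map f xs) (sym e) (∈-map⁺ f j)))
  unique-injective f (z ∷ xs) u (there i) (here refl) e = ⊥-elim (Unique[x∷xs]⇒x∉xs u (subst (_∈ map f xs) e (∈-map⁺ f i)))
  unique-injective f (z ∷ xs) (_ ∷ us) (there i) (there j) e = unique-injective f xs us i j e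

  unique-set⇒↭ : {A : Set} (xs ys : List A) → Unique xs → Unique ys → (∀ {x} → x ∈ xs → x ∈ ys) → (∀ {x} → x ∈ ys → x ∈ xs) → xs ↭ ys
  unique-set⇒↭ [] [] _ _ _ _ = ↭-refl
  unique-set⇒↭ [] (y ∷ ys) _ _ _ g with g (here refl)
  ... | ()
  unique-set⇒↭ (x ∷ xs) ys u@(_ ∷ us) v f g with ∈⇒↭ (f (here refl))
  ... | ys′ , e with Unique-↭ e v
  ... | v′@(_ ∷ vs) = ↭-trans (prep x (unique-set⇒↭ xs ys′ us vs f′ g′)) (↭-sym e)
    where
    f′ : ∀ {z} → z ∈ xs → z ∈ ys′
    f′ i with ∈-resp-↭ e (f (there i))
    ... | here refl = ⊥-elim (Unique[x∷xs]⇒x∉xs u i)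
    ... | there j = j
    g′ : ∀ {z} → z ∈ ys′ → z ∈ xs
    g′ i with g (∈-resp-↭ (↭-sym e) (there i))
    ... | here refl = ⊥-elim (Unique[x∷xs]⇒x∉xs v′ i)
    ... | there j = j

  Σl-tabulate : {A : Set} {n : ℕ} (f : A → ℕ) (g : Fin n → A) → Σl f (tabulate g) ≡ sumFin (λ i → f (g i))
  Σl-tabulate {n = zero} f g = refl
  Σl-tabulate {n = suc n} f g = cong (f (g Fin.zero) +_) (Σl-tabulate f (λ i → g (Fin.suc i)))

  sumFin-cong : {n : ℕ} {f g : Fin n → ℕ} → (∀ i → f i ≡ g i) → sumFin f ≡ sumFin g
  sumFin-cong {zero} h = refl
  sumFin-cong {suc n} h = cong₂ _+_ (h Fin.zero) (sumFin-cong (λ i → h (Fin.suc i)))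

  count≡cnt : {A : Set} {n : ℕ} (p : A → Bool) (g : Fin n → A) → count (λ i → p (g i)) ≡ cnt p (tabulate g)
  count≡cnt p g = trans (sumFin-cong (λ i → if-b2n (p (g i)))) (sym (Σl-tabulate (λ x → b2n (p x)) g))
    where
    if-b2n : ∀ b → (if b then 1 else 0) ≡ b2n b
    if-b2n true = refl
    if-b2n false = refl

  inhabited : ∀ {k} → Fin k → 1 ≤ k
  inhabited Fin.zero = s≤s z≤n
  inhabited (Fin.suc _) = s≤s z≤n

  element : ∀ {k} → 1 ≤ k → Fin k
  element {suc k} _ = Fin.zero

  toℕ-cmp : ∀ {n} (a b : Fin n) → toℕ a < toℕ b ⊎ toℕ b < toℕ a ⊎ a ≡ b
  toℕ-cmp a b with toℕ a <? toℕ b | toℕ b <? toℕ a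
  ... | yes l | _ = inj₁ l
  ... | no _ | yes l = inj₂ (inj₁ l)
  ... | no x | no y = inj₂ (inj₂ (toℕ-injective (≤-antisym (≮⇒≥ y) (≮⇒≥ x))))
    where open import Data.Fin.Properties using (toℕ-injective)

  record EdgeList {n : ℕ} (G : Graph n) : Set where
    field
      es : List (Fin n × Fin n)
      len : length es ≡ edgeCount G
      sorted : ∀ {u v} → (u , v) ∈ es → toℕ u < toℕ v
      sound : ∀ {u v} → (u , v) ∈ es → Graph.adj G u v ≡ true
      complete : ∀ {u v} → toℕ u < toℕ v → Graph.adj G u v ≡ true → (u , v) ∈ es
      unique : Unique es

  edgeList : ∀ {n} (G : Graph n) → EdgeList G
  edgeList {n} G = go (partition π pairs)
    where
    pairs : List (Fin n × Fin n)
    pairs = cartesianProduct (allFin n) (allFin n)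
    π : Fin n × Fin n → Bool
    π (u , v) = (toℕ u <ᵇ toℕ v) ∧ Graph.adj G u v
    counted : cnt π pairs ≡ edgeCount G
    counted = trans (Σl-× (λ e → b2n (π e)) (allFin n) (allFin n)) (trans (Σl-tabulate (λ u → cnt (λ v → π (u , v)) (allFin n)) id)
      (sumFin-cong (λ u → sym (count≡cnt (λ v → π (u , v)) id))))
    go : (∃[ ys ] ∃[ zs ] (pairs ↭ ys ++ zs) × (length ys ≡ cnt π pairs) × (∀ {y} → y ∈ ys → π y ≡ true) × (∀ {z} → z ∈ zs → π z ≡ false)) → EdgeList G
    go (ys , zs , e , l , f , g) = record
      { es = ys ; len = trans l counted
      ; sorted = λ {u} {v} i → <ᵇ-< (proj₁ (∧-true (f i)))
      ; sound = λ {u} {v} i → proj₂ (∧-true {toℕ u <ᵇ toℕ v} (f i))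
      ; complete = λ {u} {v} lt a → case ∈-++⁻ ys (∈-resp-↭ e (∈-cartesianProduct⁺ (∈-allFin u) (∈-allFin v))) of
          λ { (inj₁ i) → i ; (inj₂ i) → contradiction (trans (sym (∧-intro (<-<ᵇ lt) a)) (g i)) true≢false }
      ; unique = Unique-++ˡ ys (Unique-↭ e (cartesianProduct⁺ (allFin⁺ n) (allFin⁺ n))) }
      where
      <ᵇ-< : ∀ {a b} → (a <ᵇ b) ≡ true → a < b
      <ᵇ-< {a} h = ≤ᵇ-≤ {suc a} h
      <-<ᵇ : ∀ {a b} → a < b → (a <ᵇ b) ≡ true
      <-<ᵇ {a} h = ≤ᵇ-true {suc a} h

  -- `FactorThreshold` for the minimum degree `A / Q`, free of rationals.
  FactorsAbove : {r : ℕ} → Graph r → (A Q n₀ : ℕ) → Set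
  FactorsAbove {r} F A Q n₀ = ∀ n → n₀ ≤ n → r ∣ n → (G : Graph n) → (∀ v → A * n ≤ Q * deg G v) →
    ∃[ H ] (IsFactor F H × (∀ u v → Graph.adj H u v ≡ true → Graph.adj G u v ≡ true))

  module FactorBox {r : ℕ} (F : Graph r) (V : Set) (EF : List (Fin r × Fin r))
    (EF-sound : ∀ {a b} → (a , b) ∈ EF → Graph.adj F a b ≡ true) (r≥1 : 1 ≤ r) where

    -- The graph lives on the positions in `U`, and its factor is carried to `V` by `lookup U`. The
    -- copies meet every position exactly once, which is what the permutation expresses.
    blackBox : ∀ A Q n₀ → FactorsAbove F A Q n₀ → BlackBox V r EF A Q n₀
    blackBox A Q n₀ box U x K K-sym K-irr lenU big degK = go (box n big (divides x (trans lenU (*-comm r x))) G deg-G)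
      where
      n = length U
      G : Graph n
      G = record { adj = λ i j → K (lookup U i) (lookup U j) ; sym = λ i j → K-sym (lookup U i) (lookup U j) ; irrfl = λ i → K-irr (lookup U i) }
      deg-G : ∀ v → A * n ≤ Q * deg G v
      deg-G v = ≤-trans (degK (∈-lookup v)) (≤-reflexive (cong (Q *_) (trans (cong (cnt (K (lookup U v))) (sym (tabulate-lookup U)))
        (sym (count≡cnt (K (lookup U v)) (lookup U))))))
      go : (∃[ H ] (IsFactor F H × (∀ u v → Graph.adj H u v ≡ true → Graph.adj G u v ≡ true))) →
        Σ (List (Fin r → V)) λ Ts → (U ↭ verts Ts) × (length Ts ≡ x) × (∀ {e} → e ∈ edgesOf EF Ts → K (proj₁ e) (proj₂ e) ≡ true)
      go (H , (k , φ , inj , surj , _ , emb) , sub) = Ts , ↭-sym U↭ , lenTs , inK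
        where
        open import Data.List.Properties using (map-tabulate)
        Ts : List (Fin r → V)
        Ts = tabulate {n = k} (λ i a → lookup U (φ i a))
        index : ∀ {k} (ψ : Fin k → Fin r → Fin n) → List (Fin n)
        index ψ = concat (tabulate (λ i → tabulate (ψ i)))
        verts≡ : ∀ {k} (ψ : Fin k → Fin r → Fin n) → verts (tabulate (λ i a → lookup U (ψ i a))) ≡ map (lookup U) (index ψ)
        verts≡ {zero} ψ = refl
        verts≡ {suc k} ψ = trans (cong₂ _++_ (sym (map-tabulate (ψ Fin.zero) (lookup U))) (verts≡ (λ i → ψ (Fin.suc i)))) (sym (map-++ (lookup U) (tabulate (ψ Fin.zero)) _))
        ∈-index : ∀ {k} (ψ : Fin k → Fin r → Fin n) i a → ψ i a ∈ index ψ
        ∈-index ψ Fin.zero a = ∈-++⁺ˡ (∈-tabulate⁺ {f = ψ Fin.zero} a)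
        ∈-index ψ (Fin.suc i) a = ∈-++⁺ʳ (tabulate (ψ Fin.zero)) (∈-index (λ i → ψ (Fin.suc i)) i a)
        index-∈ : ∀ {k} (ψ : Fin k → Fin r → Fin n) {u} → u ∈ index ψ → ∃[ i ] ∃[ a ] (u ≡ ψ i a)
        index-∈ {suc k} ψ u∈ with ∈-++⁻ (tabulate (ψ Fin.zero)) u∈
        ... | inj₁ j with ∈-tabulate⁻ {f = ψ Fin.zero} j
        ... | a , e = Fin.zero , a , e
        index-∈ {suc k} ψ u∈ | inj₂ j with index-∈ (λ i → ψ (Fin.suc i)) j
        ... | i , a , e = Fin.suc i , a , e
        unique-index : ∀ {k} (ψ : Fin k → Fin r → Fin n) → (∀ i a j b → ψ i a ≡ ψ j b → (i ≡ j) × (a ≡ b)) → Unique (index ψ)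
        unique-index {zero} ψ inj = []
        unique-index {suc k} ψ inj = Unique-++⁺ (Unique-tabulate⁺ (λ {a} {b} e → proj₂ (inj Fin.zero a Fin.zero b e)))
          (unique-index (λ i → ψ (Fin.suc i)) (λ i a j b e → suc-inj (inj (Fin.suc i) a (Fin.suc j) b e))) disjoint
          where
          suc-inj : ∀ {i j : Fin k} {a b : Fin r} → (Fin.suc i ≡ Fin.suc j) × (a ≡ b) → (i ≡ j) × (a ≡ b)
          suc-inj (refl , e) = refl , e
          disjoint : ∀ {v} → ¬ ((v ∈ tabulate (ψ Fin.zero)) × (v ∈ index (λ i → ψ (Fin.suc i))))
          disjoint (p , q) with ∈-tabulate⁻ {f = ψ Fin.zero} p | index-∈ (λ i → ψ (Fin.suc i)) q
          ... | a , refl | i , b , e with inj Fin.zero a (Fin.suc i) b e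
          ... | () , _
        U↭ : verts Ts ↭ U
        U↭ = ↭-trans (↭-reflexive (verts≡ φ)) (↭-trans (map⁺ (lookup U) (unique-set⇒↭ (index φ) (allFin n) (unique-index φ inj) (allFin⁺ n)
            (λ {z} _ → ∈-allFin z) (λ {z} _ → hit z (surj z))))
            (↭-reflexive (trans (map-tabulate id (lookup U)) (tabulate-lookup U))))
          where
          hit : ∀ z → (∃[ i ] ∃[ a ] (φ i a ≡ z)) → z ∈ index φ
          hit z (i , a , refl) = ∈-index φ i a
        lenTs : length Ts ≡ x
        lenTs = cancel-r (trans (*-comm r (length Ts)) (trans (sym (length-verts Ts)) (trans (↭-length U↭) lenU)))
          where
          cancel : ∀ r → 1 ≤ r → ∀ {a b} → r * a ≡ r * b → a ≡ b
          cancel (suc r) _ {a} {b} e = *-cancelˡ-≡ a b (suc r) e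
          cancel-r : r * length Ts ≡ r * x → length Ts ≡ x
          cancel-r = cancel r r≥1
        inK : ∀ {e} → e ∈ edgesOf EF Ts → K (proj₁ e) (proj₂ e) ≡ true
        inK e∈ with ∈-concat⁻′ _ e∈
        ... | es , e∈es , es∈ with ∈-map⁻ (λ τ → map (edge τ) EF) es∈
        ... | τ , τ∈ , refl with ∈-tabulate⁻ {f = λ i a → lookup U (φ i a)} τ∈ | ∈-map⁻ (edge τ) e∈es
        ... | i , refl | (a , b) , ab∈ , refl = sub (φ i a) (φ i b) (emb i a b (EF-sound ab∈))

  -- Coloured tilings as transversals

  module Realise {r : ℕ} (F : Graph r) {N m : ℕ} (𝔊 : Collection m N) (EF : List (Fin r × Fin r))
    (EF-sorted : ∀ {a b} → (a , b) ∈ EF → toℕ a < toℕ b) (EF-sound : ∀ {a b} → (a , b) ∈ EF → Graph.adj F a b ≡ true)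
    (EF-complete : ∀ {a b} → toℕ a < toℕ b → Graph.adj F a b ≡ true → (a , b) ∈ EF) (EF-unique : Unique EF) where
    open import Data.Fin.Properties using (toℕ-injective) renaming (_≟_ to _≟F_)
    open import Data.Product.Properties using (≡-dec)
    open import Data.List.Membership.DecPropositional (≡-dec (_≟F_ {N}) (_≟F_ {N})) using (_∈?_)
    open import Data.Bool.Properties using (∨-comm)

    edges : List (Fin r → Fin N) → List (Fin N × Fin N)
    edges = edgesOf EF

    Pair : Set
    Pair = Fin N × Fin N

    tabulate-injective : (τ : Fin r → Fin N) → Unique (tabulate τ) → ∀ {a b} → τ a ≡ τ b → a ≡ b
    tabulate-injective τ u = unique-injective τ (allFin r) (subst Unique (sym (map-tabulate id τ)) u) (∈-allFin _) (∈-allFin _)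
      where open import Data.List.Properties using (map-tabulate)

    position : ∀ (Ts : List (Fin r → Fin N)) {u} → u ∈ verts Ts → ∃[ i ] ∃[ a ] (lookup Ts i a ≡ u)
    position (τ ∷ Ts) u∈ with ∈-++⁻ (tabulate τ) u∈
    ... | inj₁ j with ∈-tabulate⁻ {f = τ} j
    ... | a , e = Fin.zero , a , sym e
    position (τ ∷ Ts) u∈ | inj₂ j with position Ts j
    ... | i , a , e = Fin.suc i , a , e

    position-∈ : ∀ (Ts : List (Fin r → Fin N)) i a → lookup Ts i a ∈ verts Ts
    position-∈ (τ ∷ Ts) Fin.zero a = ∈-++⁺ˡ (∈-tabulate⁺ {f = τ} a)
    position-∈ (τ ∷ Ts) (Fin.suc i) a = ∈-++⁺ʳ (tabulate τ) (position-∈ Ts i a)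

    position-injective : ∀ (Ts : List (Fin r → Fin N)) → Unique (verts Ts) → ∀ i a j b → lookup Ts i a ≡ lookup Ts j b → (i ≡ j) × (a ≡ b)
    position-injective (τ ∷ Ts) u Fin.zero a Fin.zero b e = refl , tabulate-injective τ (Unique-++ˡ (tabulate τ) u) e
    position-injective (τ ∷ Ts) u Fin.zero a (Fin.suc j) b e =
      ⊥-elim (Unique-disjoint (tabulate τ) u (∈-tabulate⁺ {f = τ} a) (subst (_∈ verts Ts) (sym e) (position-∈ Ts j b)))
    position-injective (τ ∷ Ts) u (Fin.suc i) a Fin.zero b e =
      ⊥-elim (Unique-disjoint (tabulate τ) u (∈-tabulate⁺ {f = τ} b) (subst (_∈ verts Ts) e (position-∈ Ts i a)))
    position-injective (τ ∷ Ts) u (Fin.suc i) a (Fin.suc j) b e with position-injective Ts (Unique-++ʳ (tabulate τ) u) i a j b e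
    ... | refl , e′ = refl , e′

    edge-∈ : ∀ (Ts : List (Fin r → Fin N)) i {a b} → (a , b) ∈ EF → (lookup Ts i a , lookup Ts i b) ∈ edges Ts
    edge-∈ (τ ∷ Ts) Fin.zero ab = ∈-++⁺ˡ (∈-map⁺ (edge τ) ab)
    edge-∈ (τ ∷ Ts) (Fin.suc i) ab = ∈-++⁺ʳ (map (edge τ) EF) (edge-∈ Ts i ab)

    ∈-edge : ∀ Ts {u v} → (u , v) ∈ edges Ts → ∃[ i ] ∃[ a ] ∃[ b ] ((a , b) ∈ EF) × (lookup Ts i a ≡ u) × (lookup Ts i b ≡ v)
    ∈-edge (τ ∷ Ts) e∈ with ∈-++⁻ (map (edge τ) EF) e∈
    ... | inj₁ j with ∈-map⁻ (edge τ) j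
    ... | (a , b) , ab , refl = Fin.zero , a , b , ab , refl , refl
    ∈-edge (τ ∷ Ts) e∈ | inj₂ j with ∈-edge Ts j
    ... | i , a , b , ab , e₁ , e₂ = Fin.suc i , a , b , ab , e₁ , e₂

    -- A copy may list the ends of an edge in either order, whereas `edgeCount` counts pairs in
    -- increasing order.
    norm : Pair → Pair
    norm (u , v) with toℕ u <? toℕ v
    ... | yes _ = u , v
    ... | no _ = v , u

    norm-< : ∀ {u v} → toℕ u < toℕ v → norm (u , v) ≡ (u , v)
    norm-< {u} {v} lt with toℕ u <? toℕ v
    ... | yes _ = refl
    ... | no n = contradiction lt n

    norm-> : ∀ {u v} → toℕ v < toℕ u → norm (u , v) ≡ (v , u)
    norm-> {u} {v} lt with toℕ u <? toℕ v
    ... | yes l = contradiction l (<⇒≯ lt)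
    ... | no _ = refl

    Same : Pair → Pair → Set
    Same (p , q) (u , v) = ((p ≡ u) × (q ≡ v)) ⊎ ((p ≡ v) × (q ≡ u))

    norm-same : ∀ e e′ → norm e ≡ norm e′ → Same e e′
    norm-same (p , q) (u , v) h with toℕ p <? toℕ q | toℕ u <? toℕ v
    norm-same (p , q) (u , v) refl | yes _ | yes _ = inj₁ (refl , refl)
    norm-same (p , q) (u , v) refl | yes _ | no _ = inj₂ (refl , refl)
    norm-same (p , q) (u , v) refl | no _ | yes _ = inj₂ (refl , refl)
    norm-same (p , q) (u , v) refl | no _ | no _ = inj₁ (refl , refl)

    -- Within a copy, two edges agree as unordered pairs only if they are equal, by injectivity and
    -- the increasing order in `EF`. Different copies have no vertex in common.
    unique-edges : ∀ (Ts : List (Fin r → Fin N)) → Unique (verts Ts) → Unique (map norm (edges Ts))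
    unique-edges [] u = []
    unique-edges (τ ∷ Ts) u = subst Unique (sym (map-++ norm (map (edge τ) EF) (edges Ts)))
      (Unique-++⁺ (subst Unique (map-∘ EF) (Unique-map-on (λ e → norm (edge τ e)) EF inj EF-unique)) (unique-edges Ts (Unique-++ʳ (tabulate τ) u)) disjoint)
      where
      τ-inj : ∀ {a b} → τ a ≡ τ b → a ≡ b
      τ-inj = tabulate-injective τ (Unique-++ˡ (tabulate τ) u)
      inj : ∀ {x y} → x ∈ EF → y ∈ EF → norm (edge τ x) ≡ norm (edge τ y) → x ≡ y
      inj {a , b} {a′ , b′} x∈ y∈ h with norm-same (edge τ (a , b)) (edge τ (a′ , b′)) h
      ... | inj₁ (e₁ , e₂) = cong₂ _,_ (τ-inj e₁) (τ-inj e₂)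
      ... | inj₂ (e₁ , e₂) = contradiction (EF-sorted x∈) (<⇒≯ (subst₂ (λ s t → toℕ s < toℕ t) (sym (τ-inj e₂)) (sym (τ-inj e₁)) (EF-sorted y∈)))
      clash : ∀ a {w} → τ a ≡ w → w ∈ verts Ts → ⊥
      clash a refl w∈ = Unique-disjoint (tabulate τ) u (∈-tabulate⁺ {f = τ} a) w∈
      disjoint : ∀ {v} → ¬ ((v ∈ map norm (map (edge τ) EF)) × (v ∈ map norm (edges Ts)))
      disjoint (p , q) with ∈-map⁻ norm p | ∈-map⁻ norm q
      ... | e , e∈ , refl | (p′ , q′) , e′∈ , h with ∈-map⁻ (edge τ) e∈ | ∈-edge Ts e′∈
      ... | (a , b) , ab , refl | i , a′ , b′ , _ , refl , refl with norm-same (edge τ (a , b)) (p′ , q′) h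
      ... | inj₁ (e₁ , _) = clash a e₁ (position-∈ Ts i a′)
      ... | inj₂ (e₁ , _) = clash a e₁ (position-∈ Ts i b′)

    does-true : {P : Set} (d : Dec P) → does d ≡ true → P
    does-true (yes p) _ = p

    true-does : {P : Set} (d : Dec P) → P → does d ≡ true
    true-does (yes _) _ = refl
    true-does (no ¬p) p = contradiction p ¬p

    module _ (Ts : List (Fin r → Fin N)) (L : List (Pair × Fin m)) (vs : allFin N ↭ verts Ts) (es : map proj₁ L ↭ edges Ts)
      (cs : allFin m ↭ map proj₂ L) (ok : ∀ {x} → x ∈ L → Graph.adj (𝔊 (proj₂ x)) (proj₁ (proj₁ x)) (proj₂ (proj₁ x)) ≡ true) where

      E : List Pair
      E = edges Ts

      uniqueV : Unique (verts Ts)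
      uniqueV = Unique-↭ vs (allFin⁺ N)

      mem : Pair → Bool
      mem e = does (e ∈? E)

      loop-free : ∀ {u v} → (u , v) ∈ E → u ≢ v
      loop-free e∈ refl with ∈-edge Ts e∈
      ... | i , a , b , ab , e₁ , e₂ with position-injective Ts uniqueV i a i b (trans e₁ (sym e₂))
      ... | _ , refl = <-irrefl refl (EF-sorted ab)

      adjH : Fin N → Fin N → Bool
      adjH u v = mem (u , v) ∨ mem (v , u)

      H : Graph N
      H = record { adj = adjH ; sym = λ u v → ∨-comm (mem (u , v)) (mem (v , u)) ; irrfl = irr }
        where
        irr : ∀ u → adjH u u ≡ false
        irr u with (u , u) ∈? E
        ... | yes p = contradiction refl (loop-free p)
        ... | no _ = refl

      adjH-∈ : ∀ u v → adjH u v ≡ true → ((u , v) ∈ E) ⊎ ((v , u) ∈ E)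
      adjH-∈ u v h with (u , v) ∈? E
      ... | yes p = inj₁ p
      ... | no _ = inj₂ (does-true ((v , u) ∈? E) h)

      ∈-adjH : ∀ {u v} → (u , v) ∈ E → adjH u v ≡ true
      ∈-adjH {u} {v} p = cong (_∨ mem (v , u)) (true-does ((u , v) ∈? E) p)

      factor : IsFactor F H
      factor = length Ts , lookup Ts , position-injective Ts uniqueV , (λ u → position Ts (∈-resp-↭ vs (∈-allFin u))) , from , to
        where
        from : ∀ u v → adjH u v ≡ true → ∃[ i ] ∃[ a ] ∃[ b ] ((lookup Ts i a ≡ u) × (lookup Ts i b ≡ v) × (Graph.adj F a b ≡ true))
        from u v h with adjH-∈ u v h
        ... | inj₁ p with ∈-edge Ts p
        ... | i , a , b , ab , e₁ , e₂ = i , a , b , e₁ , e₂ , EF-sound ab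
        from u v h | inj₂ p with ∈-edge Ts p
        ... | i , a , b , ab , e₁ , e₂ = i , b , a , e₂ , e₁ , trans (Graph.sym F b a) (EF-sound ab)
        to : ∀ i a b → Graph.adj F a b ≡ true → adjH (lookup Ts i a) (lookup Ts i b) ≡ true
        to i a b h with toℕ-cmp a b
        ... | inj₁ l = ∈-adjH (edge-∈ Ts i (EF-complete l h))
        ... | inj₂ (inj₁ l) = trans (Graph.sym H (lookup Ts i a) (lookup Ts i b)) (∈-adjH (edge-∈ Ts i (EF-complete l (trans (Graph.sym F b a) h))))
        ... | inj₂ (inj₂ refl) = contradiction (trans (sym h) (Graph.irrfl F a)) true≢false

      edgeCount-H : edgeCount H ≡ m
      edgeCount-H = begin
        edgeCount H ≡⟨ EH.len ⟨
        length EH.es ≡⟨ ↭-length (unique-set⇒↭ EH.es (map norm E) EH.unique (unique-edges Ts uniqueV) in₁ in₂) ⟩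
        length (map norm E) ≡⟨ length-map norm E ⟩
        length E ≡⟨ ↭-length es ⟨
        length (map proj₁ L) ≡⟨ trans (length-map proj₁ L) (sym (length-map proj₂ L)) ⟩
        length (map proj₂ L) ≡⟨ ↭-length cs ⟨
        length (allFin m) ≡⟨ length-tabulate id ⟩
        m ∎
        where
        open ≡-Reasoning
        module EH = EdgeList (edgeList H)
        in₁ : ∀ {e} → e ∈ EH.es → e ∈ map norm E
        in₁ {u , v} e∈ with adjH-∈ u v (EH.sound e∈)
        ... | inj₁ p = subst (_∈ map norm E) (norm-< (EH.sorted e∈)) (∈-map⁺ norm p)
        ... | inj₂ p = subst (_∈ map norm E) (norm-> (EH.sorted e∈)) (∈-map⁺ norm p)
        in₂ : ∀ {e} → e ∈ map norm E → e ∈ EH.es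
        in₂ e∈ with ∈-map⁻ norm e∈
        ... | (p , q) , pq∈ , refl with toℕ p <? toℕ q
        ... | yes l = EH.complete l (∈-adjH pq∈)
        ... | no nl = EH.complete (≤∧≢⇒< (≮⇒≥ nl) (λ e → loop-free pq∈ (sym (toℕ-injective e)))) (trans (Graph.sym H q p) (∈-adjH pq∈))

      uniqueC : Unique (map proj₂ L)
      uniqueC = Unique-↭ cs (allFin⁺ m)

      colour : ∀ u v → adjH u v ≡ true → ∃[ c ] ∃[ e ] ((e , c) ∈ L) × Same e (u , v)
      colour u v h with adjH-∈ u v h
      ... | inj₁ p with ∈-map⁻ proj₁ (∈-resp-↭ (↭-sym es) p)
      ... | (e , c) , i , refl = c , e , i , inj₁ (refl , refl)
      colour u v h | inj₂ p with ∈-map⁻ proj₁ (∈-resp-↭ (↭-sym es) p)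
      ... | (e , c) , i , refl = c , e , i , inj₂ (refl , refl)

      -- Every colour occurs once in `L`, so equal colours come from one coloured edge, and the
      -- increasing order excludes a reversal. The results of `colour` are taken as arguments to
      -- permit matching on them.
      colour-injective : ∀ {u v u′ v′} → toℕ u < toℕ v → toℕ u′ < toℕ v′ →
        (x : ∃[ c ] ∃[ e ] ((e , c) ∈ L) × Same e (u , v)) (y : ∃[ c ] ∃[ e ] ((e , c) ∈ L) × Same e (u′ , v′)) →
        proj₁ x ≡ proj₁ y → (u , v) ≡ (u′ , v′)
      colour-injective lt lt′ (c , e , i , s) (.c , e′ , i′ , s′) refl with unique-injective proj₂ L uniqueC i i′ refl
      colour-injective lt lt′ (c , e , i , inj₁ (refl , refl)) (.c , .e , i′ , inj₁ (refl , refl)) refl | refl = refl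
      colour-injective lt lt′ (c , e , i , inj₁ (refl , refl)) (.c , .e , i′ , inj₂ (refl , refl)) refl | refl = contradiction lt (<⇒≯ lt′)
      colour-injective lt lt′ (c , e , i , inj₂ (refl , refl)) (.c , .e , i′ , inj₁ (refl , refl)) refl | refl = contradiction lt (<⇒≯ lt′)
      colour-injective lt lt′ (c , e , i , inj₂ (refl , refl)) (.c , .e , i′ , inj₂ (refl , refl)) refl | refl = refl

      transversal-H : IsTransversal 𝔊 H
      transversal-H = edgeCount-H , (λ { ((u , v) , _ , h) → proj₁ (colour u v h) }) ,
        (λ { ((u , v) , lt , h) ((u′ , v′) , lt′ , h′) e → colour-injective lt lt′ (colour u v h) (colour u′ v′ h′) e }) ,
        λ { ((u , v) , _ , h) → valid u v (colour u v h) }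
        where
        valid : ∀ u v (x : ∃[ c ] ∃[ e ] ((e , c) ∈ L) × Same e (u , v)) → Graph.adj (𝔊 (proj₁ x)) u v ≡ true
        valid u v (c , e , i , inj₁ (refl , refl)) = ok i
        valid u v (c , e , i , inj₂ (refl , refl)) = trans (Graph.sym (𝔊 c) u v) (ok i)

      realised : ∃[ H ] (IsTransversal 𝔊 H × IsFactor F H)
      realised = H , transversal-H , factor

  -- Rational thresholds

  module Rationals where
    open import Data.Integer using (+_; -[1+_]; +[1+_])
    import Data.Integer as ℤ
    import Data.Integer.Properties as ℤP
    open import Data.Rational using (mkℚ; toℚᵘ)
    import Data.Rational.Properties as ℚP
    open import Data.Rational.Unnormalised as ℚᵘ using (mkℚᵘ; *≡*; *≤*)
    import Data.Rational.Unnormalised.Properties as ℚᵘP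
    open import Data.Nat.Coprimality using (Coprime; 1-coprimeTo)

    to-ℕ→ℚ : ∀ k → toℚᵘ (ℕ→ℚ k) ℚᵘ.≃ mkℚᵘ (+ k) 0
    to-ℕ→ℚ k = ℚP.toℚᵘ-fromℚᵘ (mkℚᵘ (+ k) 0)

    ℕ→ℚ-* : ∀ a b → ℕ→ℚ (a * b) ≡ ℕ→ℚ a ℚ.* ℕ→ℚ b
    ℕ→ℚ-* a b = ℚP.toℚᵘ-injective (ℚᵘP.≃-trans (to-ℕ→ℚ (a * b)) (ℚᵘP.≃-trans (*≡* (cong (ℤ._* + 1) (ℤP.pos-* a b)))
      (ℚᵘP.≃-sym (ℚᵘP.≃-trans (ℚP.toℚᵘ-homo-* (ℕ→ℚ a) (ℕ→ℚ b)) (ℚᵘP.*-cong (to-ℕ→ℚ a) (to-ℕ→ℚ b))))))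

    ℕ→ℚ-+ : ∀ a b → ℕ→ℚ (a + b) ≡ ℕ→ℚ a ℚ.+ ℕ→ℚ b
    ℕ→ℚ-+ a b = ℚP.toℚᵘ-injective (ℚᵘP.≃-trans (to-ℕ→ℚ (a + b)) (ℚᵘP.≃-trans
        (*≡* (cong (ℤ._* + 1) (trans (ℤP.pos-+ a b) (sym (cong₂ ℤ._+_ (ℤP.*-identityʳ (+ a)) (ℤP.*-identityʳ (+ b)))))))
      (ℚᵘP.≃-sym (ℚᵘP.≃-trans (ℚP.toℚᵘ-homo-+ (ℕ→ℚ a) (ℕ→ℚ b)) (ℚᵘP.+-cong (to-ℕ→ℚ a) (to-ℕ→ℚ b))))))

    ℕ→ℚ-mono : ∀ {a b} → a ≤ b → ℕ→ℚ a ℚ.≤ ℕ→ℚ b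
    ℕ→ℚ-mono {a} {b} le = ℚP.toℚᵘ-cancel-≤ (ℚᵘP.≤-trans (ℚᵘP.≤-reflexive (to-ℕ→ℚ a))
      (ℚᵘP.≤-trans (*≤* (ℤP.*-monoʳ-≤-nonNeg (+ 1) (ℤ.+≤+ le))) (ℚᵘP.≤-reflexive (ℚᵘP.≃-sym (to-ℕ→ℚ b)))))

    ℕ→ℚ-cancel : ∀ {a b} → ℕ→ℚ a ℚ.≤ ℕ→ℚ b → a ≤ b
    ℕ→ℚ-cancel {a} {b} le with ℚᵘP.≤-trans (ℚᵘP.≤-reflexive (ℚᵘP.≃-sym (to-ℕ→ℚ a))) (ℚᵘP.≤-trans (ℚP.toℚᵘ-mono-≤ le) (ℚᵘP.≤-reflexive (to-ℕ→ℚ b)))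
    ... | *≤* h = ℤP.drop‿+≤+ (ℤP.*-cancelʳ-≤-pos (+ a) (+ b) (+ 1) h)

    ℕ→ℚ-scale : ∀ p d .(cop : Coprime p (suc d)) → ℕ→ℚ (suc d) ℚ.* mkℚ (+ p) d cop ≡ ℕ→ℚ p
    ℕ→ℚ-scale p d cop = ℚP.toℚᵘ-injective (ℚᵘP.≃-trans (ℚP.toℚᵘ-homo-* (ℕ→ℚ (suc d)) (mkℚ (+ p) d cop))
      (ℚᵘP.≃-trans (ℚᵘP.*-congʳ {mkℚᵘ (+ p) d} (to-ℕ→ℚ (suc d))) (ℚᵘP.≃-trans (*≡* eq) (ℚᵘP.≃-sym (to-ℕ→ℚ p)))))
      where
      eq : + suc d ℤ.* + p ℤ.* + 1 ≡ + p ℤ.* (+ (suc (d + 0)))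
      eq = trans (ℤP.*-identityʳ _) (trans (ℤP.*-comm (+ suc d) (+ p)) (cong (λ z → + p ℤ.* + suc z) (sym (+-identityʳ d))))

    nonNeg : ∀ k → ℚ.NonNegative (ℕ→ℚ k)
    nonNeg k = ℚ.nonNegative (ℕ→ℚ-mono {0} {k} z≤n)

    pos : ∀ k → 1 ≤ k → ℚ.Positive (ℕ→ℚ k)
    pos k k≥1 = ℚ.positive (ℚP.<-≤-trans (ℚP.positive⁻¹ (ℕ→ℚ 1)) (ℕ→ℚ-mono k≥1))

    degree-ℕ : ∀ P Q x n d → ℕ→ℚ P ℚ.≤ ℕ→ℚ Q ℚ.* x → x ℚ.* ℕ→ℚ n ℚ.≤ ℕ→ℚ d → P * n ≤ Q * d
    degree-ℕ P Q x n d h₁ h₂ = ℕ→ℚ-cancel (begin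
      ℕ→ℚ (P * n) ≡⟨ ℕ→ℚ-* P n ⟩
      ℕ→ℚ P ℚ.* ℕ→ℚ n ≤⟨ ℚP.*-monoʳ-≤-nonNeg (ℕ→ℚ n) {{nonNeg n}} h₁ ⟩
      ℕ→ℚ Q ℚ.* x ℚ.* ℕ→ℚ n ≡⟨ ℚP.*-assoc (ℕ→ℚ Q) x (ℕ→ℚ n) ⟩
      ℕ→ℚ Q ℚ.* (x ℚ.* ℕ→ℚ n) ≤⟨ ℚP.*-monoˡ-≤-nonNeg (ℕ→ℚ Q) {{nonNeg Q}} h₂ ⟩
      ℕ→ℚ Q ℚ.* ℕ→ℚ d ≡⟨ ℕ→ℚ-* Q d ⟨
      ℕ→ℚ (Q * d) ∎)
      where open ℚP.≤-Reasoning

    degree-ℚ : ∀ A Q x n d → 1 ≤ Q → ℕ→ℚ Q ℚ.* x ≡ ℕ→ℚ A → A * n ≤ Q * d → x ℚ.* ℕ→ℚ n ℚ.≤ ℕ→ℚ d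
    degree-ℚ A Q x n d Q≥1 eq h = ℚP.*-cancelˡ-≤-pos (ℕ→ℚ Q) {{pos Q Q≥1}} (begin
      ℕ→ℚ Q ℚ.* (x ℚ.* ℕ→ℚ n) ≡⟨ ℚP.*-assoc (ℕ→ℚ Q) x (ℕ→ℚ n) ⟨
      ℕ→ℚ Q ℚ.* x ℚ.* ℕ→ℚ n ≡⟨ cong (ℚ._* ℕ→ℚ n) eq ⟩
      ℕ→ℚ A ℚ.* ℕ→ℚ n ≡⟨ ℕ→ℚ-* A n ⟨
      ℕ→ℚ (A * n) ≤⟨ ℕ→ℚ-mono h ⟩
      ℕ→ℚ (Q * d) ≡⟨ ℕ→ℚ-* Q d ⟩
      ℕ→ℚ Q ℚ.* ℕ→ℚ d ∎)
      where open ℚP.≤-Reasoning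

    unit-fraction : ∀ Q → 1 ≤ Q → ∃[ ε ] (0ℚ ℚ.< ε) × (ℕ→ℚ Q ℚ.* ε ≡ ℕ→ℚ 1)
    unit-fraction (suc q) _ = mkℚ (+ 1) q (1-coprimeTo (suc q)) , ℚP.positive⁻¹ _ , ℕ→ℚ-scale 1 q (1-coprimeTo (suc q))

    scale-up : ∀ s Q x P → ℕ→ℚ Q ℚ.* x ≡ ℕ→ℚ P → ℕ→ℚ (s * Q) ℚ.* x ≡ ℕ→ℚ (s * P)
    scale-up s Q x P e = trans (cong (ℚ._* x) (ℕ→ℚ-* s Q)) (trans (ℚP.*-assoc (ℕ→ℚ s) (ℕ→ℚ Q) x) (trans (cong (ℕ→ℚ s ℚ.*_) e) (sym (ℕ→ℚ-* s P))))

    add-unit : ∀ Q c ε P → ℕ→ℚ Q ℚ.* c ≡ ℕ→ℚ P → ℕ→ℚ Q ℚ.* ε ≡ ℕ→ℚ 1 → ℕ→ℚ Q ℚ.* (c ℚ.+ ε) ≡ ℕ→ℚ (suc P)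
    add-unit Q c ε P e₁ e₂ = trans (ℚP.*-distribˡ-+ (ℕ→ℚ Q) c ε) (trans (cong₂ ℚ._+_ e₁ e₂) (trans (sym (ℕ→ℚ-+ P 1)) (cong ℕ→ℚ (+-comm P 1))))

    split-sign : ∀ c → (∃[ p ] ∃[ d ] (1 ≤ d) × (ℕ→ℚ d ℚ.* c ≡ ℕ→ℚ p)) ⊎ (∃[ ε ] (0ℚ ℚ.< ε) × (c ℚ.+ ε ≡ 0ℚ))
    split-sign (mkℚ (+ p) d cop) = inj₁ (p , suc d , s≤s z≤n , ℕ→ℚ-scale p d cop)
    split-sign c@(mkℚ -[1+ p ] d cop) = inj₂ (ℚ.- c , ℚP.positive⁻¹ _ , ℚP.+-inverseʳ c)

    split-pos : ∀ ε → 0ℚ ℚ.< ε → ∃[ p ] ∃[ d ] (1 ≤ d) × (1 ≤ p) × (ℕ→ℚ d ℚ.* ε ≡ ℕ→ℚ p)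
    split-pos (mkℚ (+ zero) d cop) h = contradiction (ℚ.positive h) λ ()
    split-pos (mkℚ +[1+ p ] d cop) h = suc p , suc d , s≤s z≤n , s≤s z≤n , ℕ→ℚ-scale (suc p) d cop
    split-pos (mkℚ -[1+ p ] d cop) h = contradiction (ℚ.positive h) λ ()

    -- Writing c = P/Q with Q so large that 6/Q ≤ ε.
    common-scale : ∀ c ε p d → 1 ≤ d → ℕ→ℚ d ℚ.* c ≡ ℕ→ℚ p → 0ℚ ℚ.< ε →
      ∃[ P ] ∃[ Q ] (1 ≤ Q) × (ℕ→ℚ Q ℚ.* c ≡ ℕ→ℚ P) × (ℕ→ℚ (6 + P) ℚ.≤ ℕ→ℚ Q ℚ.* (c ℚ.+ ε))
    common-scale c ε p d d≥1 ec ε>0 with split-pos ε ε>0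
    ... | e , f , f≥1 , e≥1 , eε = 6 * f * p , 6 * f * d , *-mono-≤ (*-mono-≤ (s≤s {0} {5} z≤n) f≥1) d≥1 , scale-up (6 * f) d c p ec , (begin
        ℕ→ℚ (6 + 6 * f * p) ≤⟨ ℕ→ℚ-mono (≤-trans (+-monoˡ-≤ (6 * f * p) (*-mono-≤ (*-mono-≤ (≤-refl {6}) d≥1) e≥1)) (≤-reflexive (+-comm (6 * d * e) (6 * f * p)))) ⟩
        ℕ→ℚ (6 * f * p + 6 * d * e) ≡⟨ ℕ→ℚ-+ (6 * f * p) (6 * d * e) ⟩
        ℕ→ℚ (6 * f * p) ℚ.+ ℕ→ℚ (6 * d * e) ≡⟨ cong₂ ℚ._+_ (sym (scale-up (6 * f) d c p ec)) (sym (scale-up (6 * d) f ε e eε)) ⟩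
        ℕ→ℚ (6 * f * d) ℚ.* c ℚ.+ ℕ→ℚ (6 * d * f) ℚ.* ε ≡⟨ cong (λ z → ℕ→ℚ (6 * f * d) ℚ.* c ℚ.+ ℕ→ℚ z ℚ.* ε) (e₁ d f) ⟩
        ℕ→ℚ (6 * f * d) ℚ.* c ℚ.+ ℕ→ℚ (6 * f * d) ℚ.* ε ≡⟨ ℚP.*-distribˡ-+ (ℕ→ℚ (6 * f * d)) c ε ⟨
        ℕ→ℚ (6 * f * d) ℚ.* (c ℚ.+ ε) ∎)
      where
      open ℚP.≤-Reasoning
      e₁ : ∀ d f → 6 * d * f ≡ 6 * f * d
      e₁ = solve-∀

    half≤ : ∀ c P Q → ℕ→ℚ Q ℚ.* c ≡ ℕ→ℚ P → ℚ.½ ℚ.≤ c → Q ≤ 2 * P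
    half≤ c P Q e h = ℕ→ℚ-cancel (begin
      ℕ→ℚ Q ≡⟨ cong ℕ→ℚ (*-identityʳ Q) ⟨
      ℕ→ℚ (Q * 1) ≡⟨ scale-up Q 2 ℚ.½ 1 refl ⟨
      ℕ→ℚ (Q * 2) ℚ.* ℚ.½ ≤⟨ ℚP.*-monoˡ-≤-nonNeg (ℕ→ℚ (Q * 2)) {{nonNeg (Q * 2)}} h ⟩
      ℕ→ℚ (Q * 2) ℚ.* c ≡⟨ cong (λ z → ℕ→ℚ z ℚ.* c) (*-comm Q 2) ⟩
      ℕ→ℚ (2 * Q) ℚ.* c ≡⟨ scale-up 2 Q c P e ⟩
      ℕ→ℚ (2 * P) ∎)
      where open ℚP.≤-Reasoning

  -- Consequences of the threshold of F

  module Threshold {r : ℕ} (F : Graph r) (c : ℚ) (adm : AdmissibleδF F c) where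
    import Data.Rational.Properties as ℚP
    open Rationals

    -- Admissibility is applied with `1 / Q`, the distance from `c = P / Q` to `(P + 1) / Q`.
    factors : ∀ P Q → 1 ≤ Q → ℕ→ℚ Q ℚ.* c ≡ ℕ→ℚ P → ∃[ n₀ ] FactorsAbove F (suc P) Q n₀
    factors P Q Q≥1 e = go (unit-fraction Q Q≥1)
      where
      go : (∃[ ε ] (0ℚ ℚ.< ε) × (ℕ→ℚ Q ℚ.* ε ≡ ℕ→ℚ 1)) → ∃[ n₀ ] FactorsAbove F (suc P) Q n₀
      go (ε , ε>0 , eε) = proj₁ (adm ε ε>0) , λ n big r∣n G dg → proj₂ (adm ε ε>0) n big r∣n G
        (λ v → degree-ℚ (suc P) Q (c ℚ.+ ε) n (deg G v) Q≥1 (add-unit Q c ε P e eε) (dg v))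

    -- If `c` were negative, admissibility with `- c` would promise a factor in every large graph,
    -- including the empty one, although F has an edge.
    nonneg : ∀ {a b} → Graph.adj F a b ≡ true → ∃[ p ] ∃[ d ] (1 ≤ d) × (ℕ→ℚ d ℚ.* c ≡ ℕ→ℚ p)
    nonneg {a} {b} ab = decide (split-sign c)
      where
      impossible : ∀ n → 1 ≤ n → {G : Graph n} → (∀ u v → Graph.adj G u v ≡ false) →
        (∃[ H ] (IsFactor F H × (∀ u v → Graph.adj H u v ≡ true → Graph.adj G u v ≡ true))) → ⊥
      impossible n n≥1 none (H , (k , φ , _ , surj , _ , emb) , sub) = clash (surj (element n≥1))
        where
        clash : (∃[ i ] ∃[ a′ ] (φ i a′ ≡ element n≥1)) → ⊥
        clash (i , _) = true≢false (trans (sym (sub (φ i a) (φ i b) (emb i a b ab))) (none (φ i a) (φ i b)))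
      negative : ∀ ε → 0ℚ ℚ.< ε → c ℚ.+ ε ≡ 0ℚ → ⊥
      negative ε ε>0 c+ε = impossible n (≤-trans (s≤s z≤n) n₀<n) {empty} (λ _ _ → refl)
          (proj₂ (adm ε ε>0) n (≤-trans (n≤1+n n₀) n₀<n) (divides (suc n₀) (*-comm r (suc n₀))) empty degs)
        where
        n₀ n : ℕ
        n₀ = proj₁ (adm ε ε>0)
        n = r * suc n₀
        n₀<n : suc n₀ ≤ n
        n₀<n = ≤-trans (≤-reflexive (sym (*-identityˡ (suc n₀)))) (*-monoˡ-≤ (suc n₀) (inhabited a))
        empty : Graph n
        empty = record { adj = λ _ _ → false ; sym = λ _ _ → refl ; irrfl = λ _ → refl }
        degs : MinDegAtLeast empty ((c ℚ.+ ε) ℚ.* ℕ→ℚ n)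
        degs v = ℚP.≤-trans (ℚP.≤-reflexive (trans (cong (ℚ._* ℕ→ℚ n) c+ε) (ℚP.*-zeroˡ (ℕ→ℚ n)))) (ℕ→ℚ-mono {0} {deg empty v} z≤n)
      decide : (∃[ p ] ∃[ d ] (1 ≤ d) × (ℕ→ℚ d ℚ.* c ≡ ℕ→ℚ p)) ⊎ (∃[ ε ] (0ℚ ℚ.< ε) × (c ℚ.+ ε ≡ 0ℚ)) →
        ∃[ p ] ∃[ d ] (1 ≤ d) × (ℕ→ℚ d ℚ.* c ≡ ℕ→ℚ p)
      decide (inj₁ res) = res
      decide (inj₂ (ε , ε>0 , c+ε)) = ⊥-elim (negative ε ε>0 c+ε)

  -- Complete multipartite graphs and colourings of F

  sumFin-++ : ∀ m {n} (f : Fin (m + n) → ℕ) → sumFin f ≡ sumFin (λ i → f (i ↑ˡ n)) + sumFin (λ j → f (m ↑ʳ j))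
  sumFin-++ zero f = refl
  sumFin-++ (suc m) f = trans (cong (f Fin.zero +_) (sumFin-++ m (λ i → f (Fin.suc i)))) (sym (+-assoc (f Fin.zero) _ _))

  sumFin-combine : ∀ m j (f : Fin (m * j) → ℕ) → sumFin f ≡ sumFin {m} (λ a → sumFin {j} (λ b → f (combine a b)))
  sumFin-combine zero j f = refl
  sumFin-combine (suc m) j f = trans (sumFin-++ j f) (cong (sumFin (λ b → f (b ↑ˡ (m * j))) +_) (sumFin-combine m j (λ i → f (j ↑ʳ i))))

  module _ where
    open import Data.Fin.Properties using (_≟_; remQuot-combine; suc-injective)
    open import Relation.Nullary.Decidable using (dec-true; dec-false)

    differ : ∀ {j} → Fin j → Fin j → Bool
    differ a b = not (does (a ≟ b))

    sumFin-differ : ∀ {j} (c : Fin (suc j)) → sumFin (λ b → if differ c b then 1 else 0) ≡ j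
    sumFin-differ {j} Fin.zero = trans (sumFin-const j 1) (*-identityʳ j)
    sumFin-differ {suc j} (Fin.suc c) = cong suc (trans (sumFin-cong (λ b → cong (λ z → if not z then 1 else 0) (shift-does c b))) (sumFin-differ c))
      where
      shift-does : ∀ {n} (c b : Fin n) → does (Fin.suc c ≟ Fin.suc b) ≡ does (c ≟ b)
      shift-does c b with c ≟ b
      ... | yes _ = refl
      ... | no _ = refl

    residue : ∀ m j → Fin (m * j) → Fin j
    residue m j u = proj₂ (remQuot {m} j u)

    -- The part of a vertex is its remainder modulo `j`, which makes all parts equally large.
    multipartite : ∀ m j → Graph (m * j)
    multipartite m j = record
      { adj = λ u v → differ (residue m j u) (residue m j v)
      ; sym = λ u v → cong not (does-sym (residue m j u) (residue m j v))
      ; irrfl = λ u → cong not (dec-true (residue m j u ≟ residue m j u) refl) }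
      where
      does-sym : ∀ {n} (a b : Fin n) → does (a ≟ b) ≡ does (b ≟ a)
      does-sym a b with a ≟ b
      ... | yes refl = sym (dec-true (a ≟ a) refl)
      ... | no ne = sym (dec-false (b ≟ a) (λ e → ne (sym e)))

    multipartite-degree : ∀ m j v → deg (multipartite m (suc j)) v ≡ m * j
    multipartite-degree m j v = trans (sumFin-combine m (suc j) (λ u → if differ (residue m (suc j) v) (residue m (suc j) u) then 1 else 0)) (trans (sumFin-cong inner) (sumFin-const m j))
      where
      inner : ∀ (a : Fin m) → sumFin {suc j} (λ b → if differ (residue m (suc j) v) (residue m (suc j) (combine {m} a b)) then 1 else 0) ≡ j
      inner a = trans (sumFin-cong (λ b → cong (λ z → if differ (residue m (suc j) v) (proj₂ z) then 1 else 0) (remQuot-combine {m} a b))) (sumFin-differ (residue m (suc j) v))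

    -- c < 1 − 1/(j+1): the balanced complete (j+1)-partite graph contains F.
    colouring : ∀ {r} (F : Graph r) (c : ℚ) (adm : AdmissibleδF F c) P Q j → 1 ≤ r → 1 ≤ Q → ℕ→ℚ Q ℚ.* c ≡ ℕ→ℚ P →
      suc j * P < j * Q → Σ (Fin r → Fin (suc j)) λ col → (∀ a b → Graph.adj F a b ≡ true → col a ≢ col b)
    colouring {r} F c adm P Q j r≥1 Q≥1 e lt = go (factors (suc j * P) (suc j * Q) (*-mono-≤ (s≤s {0} {j} z≤n) Q≥1) (Rationals.scale-up (suc j) Q c P e))
      where
      open Threshold F c adm
      go : (∃[ n₀ ] FactorsAbove F (suc (suc j * P)) (suc j * Q) n₀) → Σ (Fin r → Fin (suc j)) λ col → (∀ a b → Graph.adj F a b ≡ true → col a ≢ col b)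
      go (n₀ , box) = extract (box n n₀≤n (divides (suc n₀ * suc j) e₁) G degs)
        where
        m = suc n₀ * r
        n = m * suc j
        G = multipartite m (suc j)
        e₁ : n ≡ suc n₀ * suc j * r
        e₁ = e₂ n₀ r j
          where
          e₂ : ∀ n r j → suc n * r * suc j ≡ suc n * suc j * r
          e₂ = solve-∀
        m≥ : suc n₀ ≤ m
        m≥ = ≤-trans (≤-reflexive (sym (*-identityʳ (suc n₀)))) (*-monoʳ-≤ (suc n₀) r≥1)
        n≥m : m ≤ n
        n≥m = ≤-trans (≤-reflexive (sym (*-identityʳ m))) (*-monoʳ-≤ m (s≤s {0} {j} z≤n))
        n₀≤n : n₀ ≤ n
        n₀≤n = ≤-trans (n≤1+n n₀) (≤-trans m≥ n≥m)
        degs : ∀ v → suc (suc j * P) * n ≤ suc j * Q * deg G v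
        degs v = begin
          suc (suc j * P) * (m * suc j) ≤⟨ *-monoˡ-≤ (m * suc j) lt ⟩
          j * Q * (m * suc j) ≡⟨ e₂ j Q m ⟩
          suc j * Q * (m * j) ≡⟨ cong (suc j * Q *_) (sym (multipartite-degree m j v)) ⟩
          suc j * Q * deg G v ∎
          where
          open ≤-Reasoning
          e₂ : ∀ j Q m → j * Q * (m * suc j) ≡ suc j * Q * (m * j)
          e₂ = solve-∀
        differ-≢ : ∀ {k} (a b : Fin k) → differ a b ≡ true → a ≢ b
        differ-≢ a .a h refl = true≢false (trans (sym h) (cong not (dec-true (a ≟ a) refl)))
        extract : (∃[ H ] (IsFactor F H × (∀ u v → Graph.adj H u v ≡ true → Graph.adj G u v ≡ true))) → Σ (Fin r → Fin (suc j)) λ col → (∀ a b → Graph.adj F a b ≡ true → col a ≢ col b)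
        extract (H , (k , φ , _ , surj , _ , emb) , sub) with surj (element (≤-trans (≤-trans (s≤s z≤n) m≥) n≥m))
        -- A single copy of F is enough: the parts containing its vertices are the colours.
        ... | i , _ , _ = (λ a → residue m (suc j) (φ i a)) , λ a b ab → differ-≢ _ _ (sub (φ i a) (φ i b) (emb i a b ab))

    -- The two sides of a bridge

    reach-snoc : ∀ {n} {G : Graph n} {u v w} → Reach G u v → Graph.adj G v w ≡ true → Reach G u w
    reach-snoc Reach.here h = Reach.step h Reach.here
    reach-snoc (Reach.step a p) h = Reach.step a (reach-snoc p h)

    -- As long as an edge leaves `S`, its far end is added. `k` bounds the number of vertices
    -- outside `S`, so the process stops with the component of `x` as a Boolean predicate.
    closure : ∀ {n} (G : Graph n) (x : Fin n) k (S : Fin n → Bool) → n ≤ k + cnt S (allFin n) → S x ≡ true →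
      (∀ v → S v ≡ true → Reach G x v) →
      Σ (Fin n → Bool) λ S′ → (S′ x ≡ true) × (∀ v → S′ v ≡ true → Reach G x v) × (∀ u v → Graph.adj G u v ≡ true → S′ u ≡ true → S′ v ≡ true)
    closure {n} G x k S size Sx reach with search (λ { (u , v) → S u ∧ (not (S v) ∧ Graph.adj G u v) }) (cartesianProduct (allFin n) (allFin n))
    ... | inj₂ none = S , Sx , reach , closed
      where
      closed : ∀ u v → Graph.adj G u v ≡ true → S u ≡ true → S v ≡ true
      closed u v a Su with S v in eq
      ... | true = refl
      ... | false = contradiction (trans (sym (∧-intro Su (∧-intro (cong not eq) a))) (none (∈-cartesianProduct⁺ (∈-allFin u) (∈-allFin v)))) true≢false
    ... | inj₁ ((u , v) , _ , h) = continue k size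
      where
      Su : S u ≡ true
      Su = proj₁ (∧-true {S u} h)
      Sv : S v ≡ false
      Sv with S v | proj₁ (∧-true {not (S v)} (proj₂ (∧-true {S u} h)))
      ... | false | _ = refl
      uv : Graph.adj G u v ≡ true
      uv = proj₂ (∧-true {not (S v)} (proj₂ (∧-true {S u} h)))
      S′ : Fin n → Bool
      S′ w = S w ∨ does (w ≟ v)
      reach′ : ∀ w → S′ w ≡ true → Reach G x w
      reach′ w h′ with S w in eq | w ≟ v
      ... | true | _ = reach w eq
      ... | false | yes refl = reach-snoc (reach u Su) uv
      bigger : suc (cnt S (allFin n)) ≤ cnt S′ (allFin n)
      bigger = begin
        suc (cnt S (allFin n)) ≡⟨ +-comm 1 (cnt S (allFin n)) ⟩
        cnt S (allFin n) + 1 ≤⟨ +-monoʳ-≤ (cnt S (allFin n)) (≤-trans (≤-reflexive (cong b2n (sym (dec-true (v ≟ v) refl)))) (Σl-∈ (λ w → b2n (does (w ≟ v))) (∈-allFin v))) ⟩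
        cnt S (allFin n) + cnt (λ w → does (w ≟ v)) (allFin n) ≡⟨ Σl-+ (λ w → b2n (S w)) (λ w → b2n (does (w ≟ v))) (allFin n) ⟨
        Σl (λ w → b2n (S w) + b2n (does (w ≟ v))) (allFin n) ≤⟨ Σl-mono (allFin n) (λ {w} _ → each w) ⟩
        cnt S′ (allFin n) ∎
        where
        open ≤-Reasoning
        each : ∀ w → b2n (S w) + b2n (does (w ≟ v)) ≤ b2n (S′ w)
        each w with w ≟ v
        ... | yes refl = ≤-reflexive (trans (cong (λ z → b2n z + 1) Sv) (cong (λ z → b2n (z ∨ true)) (sym Sv)))
        ... | no _ with S w
        ... | true = ≤-refl
        ... | false = ≤-refl
      continue : ∀ k → n ≤ k + cnt S (allFin n) →
        Σ (Fin n → Bool) λ S′ → (S′ x ≡ true) × (∀ v → S′ v ≡ true → Reach G x v) × (∀ u v → Graph.adj G u v ≡ true → S′ u ≡ true → S′ v ≡ true)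
      continue zero size = contradiction (≤-trans bigger (≤-trans (cnt≤length S′ (allFin n)) (≤-trans (≤-reflexive (length-tabulate id)) size))) (<-irrefl refl)
      continue (suc k) size = closure G x k S′ (≤-trans size (≤-trans (≤-reflexive (sym (+-suc k _))) (+-monoʳ-≤ k bigger))) (cong (_∨ does (x ≟ v)) Sx) reach′

    record BridgeSide {r : ℕ} (F : Graph r) : Set where
      field
        x y : Fin r
        xy : Graph.adj F x y ≡ true
        side : Fin r → Bool
        side-x : side x ≡ true
        side-y : side y ≡ false
        same : ∀ a b → Graph.adj F a b ≡ true → ¬ ((a ≡ x) × (b ≡ y)) → ¬ ((a ≡ y) × (b ≡ x)) → side a ≡ side b

    bridgeSide : ∀ {r} (F : Graph r) → HasBridge F → BridgeSide F
    bridgeSide {r} F (x , y , xy , unreachable) = go (closure D x r (λ w → does (w ≟ x)) (m≤m+n r _) (dec-true (x ≟ x) refl) start)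
      where
      D = deleteEdge F x y
      start : ∀ v → does (v ≟ x) ≡ true → Reach D x v
      start v h with v ≟ x
      ... | yes refl = Reach.here
      kept : ∀ a b → Graph.adj F a b ≡ true → ¬ ((a ≡ x) × (b ≡ y)) → ¬ ((a ≡ y) × (b ≡ x)) → Graph.adj D a b ≡ true
      kept a b ab n₁ n₂ with a ≟ x | b ≟ y | a ≟ y | b ≟ x
      ... | yes p | yes q | _ | _ = contradiction (p , q) n₁
      ... | _ | _ | yes p | yes q = contradiction (p , q) n₂
      ... | yes _ | no _ | yes _ | no _ = ∧-intro ab refl
      ... | yes _ | no _ | no _ | yes _ = ∧-intro ab refl
      ... | yes _ | no _ | no _ | no _ = ∧-intro ab refl
      ... | no _ | yes _ | yes _ | no _ = ∧-intro ab refl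
      ... | no _ | yes _ | no _ | yes _ = ∧-intro ab refl
      ... | no _ | yes _ | no _ | no _ = ∧-intro ab refl
      ... | no _ | no _ | yes _ | no _ = ∧-intro ab refl
      ... | no _ | no _ | no _ | yes _ = ∧-intro ab refl
      ... | no _ | no _ | no _ | no _ = ∧-intro ab refl
      go : (Σ (Fin r → Bool) λ S → (S x ≡ true) × (∀ v → S v ≡ true → Reach D x v) × (∀ u v → Graph.adj D u v ≡ true → S u ≡ true → S v ≡ true)) → BridgeSide F
      go (S , Sx , reach , closed) = record { x = x ; y = y ; xy = xy ; side = S ; side-x = Sx ; side-y = Sy ; same = same }
        where
        Sy : S y ≡ false
        Sy with S y in eq
        ... | true = contradiction (reach y eq) unreachable
        ... | false = refl
        bool-eq : ∀ (p q : Bool) → (p ≡ true → q ≡ true) → (q ≡ true → p ≡ true) → p ≡ q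
        bool-eq true q f g = sym (f refl)
        bool-eq false true f g = g refl
        bool-eq false false f g = refl
        same : ∀ a b → Graph.adj F a b ≡ true → ¬ ((a ≡ x) × (b ≡ y)) → ¬ ((a ≡ y) × (b ≡ x)) → S a ≡ S b
        same a b ab n₁ n₂ = bool-eq (S a) (S b) (closed a b ad) (closed b a (trans (Graph.sym D b a) ad))
          where
          ad = kept a b ab n₁ n₂

  -- From the construction to the theorem

  Conclusion : ∀ {r} → Graph r → ℚ → Set
  Conclusion {r} F x = ∃[ n₀ ] ((n : ℕ) → n ≥ n₀ → (𝔊 : Collection (edgeCount F * n) (r * n)) →
    (∀ i → MinDegAtLeast (𝔊 i) (x ℚ.* ℕ→ℚ (r * n))) → ∃[ H ] (IsTransversal 𝔊 H × IsFactor F H))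

  -- Without edges there are no colours to place and no edge `e₀` to prescribe; the copies are the
  -- slices of `Fin r` times `Fin n`.
  edgeless : ∀ {r} (F : Graph r) (x : ℚ) → EdgeList.es (edgeList F) ≡ [] → Conclusion F x
  edgeless {r} F x none = 0 , λ n _ 𝔊 _ → H n , (count≡ n , (λ e → ⊥-elim (no-edge e)) , (λ e → ⊥-elim (no-edge e)) , (λ e → ⊥-elim (no-edge e))) ,
      (n , (λ i a → combine a i) , inj n , surj n , (λ _ _ ()) , λ i a b ab → ⊥-elim (no-adj ab))
    where
    open import Data.Fin.Properties using (combine-injective; combine-surjective)
    module EF = EdgeList (edgeList F)
    H : ∀ n → Graph (r * n)
    H n = record { adj = λ _ _ → false ; sym = λ _ _ → refl ; irrfl = λ _ → refl }
    no-edge : ∀ {n} → Edge (H n) → ⊥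
    no-edge (_ , _ , ())
    no-adj : ∀ {a b} → Graph.adj F a b ≡ true → ⊥
    no-adj {a} {b} ab with toℕ-cmp a b
    ... | inj₁ l = case subst ((a , b) ∈_) none (EF.complete l ab) of λ ()
    ... | inj₂ (inj₁ l) = case subst ((b , a) ∈_) none (EF.complete l (trans (Graph.sym F b a) ab)) of λ ()
    ... | inj₂ (inj₂ refl) = true≢false (trans (sym ab) (Graph.irrfl F a))
    count≡ : ∀ n → edgeCount (H n) ≡ edgeCount F * n
    count≡ n = trans (sym EH.len) (trans (empty EH.es EH.sound) (cong (_* n) (trans (cong length (sym none)) EF.len)))
      where
      module EH = EdgeList (edgeList (H n))
      empty : ∀ (xs : List (Fin (r * n) × Fin (r * n))) → (∀ {u v} → (u , v) ∈ xs → false ≡ true) → length xs ≡ 0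
      empty [] _ = refl
      empty (x ∷ xs) h = contradiction (sym (h (here refl))) true≢false
    inj : ∀ n (i : Fin n) (a : Fin r) (j : Fin n) (b : Fin r) → combine a i ≡ combine b j → (i ≡ j) × (a ≡ b)
    inj n i a j b e with combine-injective a i b j e
    ... | p , q = q , p
    surj : ∀ n (u : Fin (r * n)) → ∃[ i ] ∃[ a ] (combine {r} {n} a i ≡ u)
    surj n u with combine-surjective {r} {n} u
    ... | a , i , e = i , a , e

  module Conclude {r : ℕ} (F : Graph r) (x : ℚ) (P Q : ℕ) (Q≥1 : 1 ≤ Q) (above : ℕ→ℚ (6 + P) ℚ.≤ ℕ→ℚ Q ℚ.* x)
    (n₀ : ℕ) (box : FactorsAbove F (suc P) Q n₀)
    (e₀ : Fin r × Fin r) (EF′ : List (Fin r × Fin r)) (es↭ : EdgeList.es (edgeList F) ↭ e₀ ∷ EF′)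
    (needK : Bool) (half : needK ≡ true → Q ≤ 2 * P) (nE₁ nE₂ : ℕ)
    (ext₁ : Extends needK P Q (8 * Q * (2 * Q * (2 * Q))) nE₁ e₀ EF′) (ext₂ : Extends needK P Q Q nE₂ e₀ EF′) where

    module EL = EdgeList (edgeList F)
    EF : List (Fin r × Fin r)
    EF = e₀ ∷ EF′
    r≥1 : 1 ≤ r
    r≥1 = inhabited (proj₁ e₀)
    back : ∀ {e} → e ∈ EF → e ∈ EL.es
    back = ∈-resp-↭ (↭-sym es↭)
    t≡ : edgeCount F ≡ length EF
    t≡ = trans (sym EL.len) (↭-length es↭)

    n₁ : ℕ
    n₁ = Choice.n₁ r (length EF) P Q nE₁ nE₂ n₀ r≥1 (s≤s z≤n) Q≥1

    conclusion : Conclusion F x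
    conclusion = suc n₁ , λ n n≥ 𝔊 md → realise n n≥ 𝔊 md
      where
      realise : (n : ℕ) → n ≥ suc n₁ → (𝔊 : Collection (edgeCount F * n) (r * n)) →
        (∀ i → MinDegAtLeast (𝔊 i) (x ℚ.* ℕ→ℚ (r * n))) → ∃[ H ] (IsTransversal 𝔊 H × IsFactor F H)
      realise n n≥ 𝔊 md = finish (Tilings.Absorbers.Assembly.assembled V C adj a-sym a-irr r e₀ EF′ needK P Q (allFin (r * n)) (allFin (edgeCount F * n))
          half ∈-allFin ∈-allFin r≥1 Q≥1 nE₁ nE₂ n₀ n (≤-trans (s≤s z≤n) n≥)
          (Choice.parameters r (length EF) P Q nE₁ nE₂ n₀ r≥1 (s≤s z≤n) Q≥1 n (≤-trans (n≤1+n n₁) n≥)) lenV lenC ext₁ ext₂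
          (FactorBox.blackBox F V EF (λ i → EL.sound (back i)) r≥1 (suc P) Q n₀ box) degrees)
        where
        V = Fin (r * n)
        C = Fin (edgeCount F * n)
        adj : C → V → V → Bool
        adj i = Graph.adj (𝔊 i)
        a-sym : ∀ c u v → adj c u v ≡ adj c v u
        a-sym c = Graph.sym (𝔊 c)
        a-irr : ∀ c u → adj c u u ≡ false
        a-irr c = Graph.irrfl (𝔊 c)
        lenV : length (allFin (r * n)) ≡ r * n
        lenV = length-tabulate id
        lenC : length (allFin (edgeCount F * n)) ≡ length EF * n
        lenC = trans (length-tabulate id) (cong (_* n) t≡)
        degrees : Tilings.Degrees V C adj a-sym a-irr r e₀ EF′ (6 + P) Q (allFin (edgeCount F * n)) (allFin (r * n))
        degrees {i} {v} _ _ = subst₂ (λ k d → (6 + P) * k ≤ Q * d) (sym lenV) (count≡cnt (adj i v) id)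
          (Rationals.degree-ℕ (6 + P) Q x (r * n) (deg (𝔊 i) v) above (md i v))
        finish : Tilings.Tiled V C adj a-sym a-irr r e₀ EF′ (allFin (r * n)) (allFin (edgeCount F * n)) → ∃[ H ] (IsTransversal 𝔊 H × IsFactor F H)
        finish (Tilings.tiled Ts L vs es cs ok) = Realise.realised F 𝔊 EF (λ i → EL.sorted (back i)) (λ i → EL.sound (back i))
          (λ l a → ∈-resp-↭ es↭ (EL.complete l a)) (Unique-↭ es↭ EL.unique) Ts L vs es cs ok

  -- The case `c ≥ 1`: the degrees demanded exceed the number of vertices, and there is at least one
  -- colour class to contradict this.
  vacuous : ∀ {r} (F : Graph r) (x : ℚ) P Q → Fin r → 1 ≤ edgeCount F → Q ≤ P → ℕ→ℚ (6 + P) ℚ.≤ ℕ→ℚ Q ℚ.* x → Conclusion F x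
  vacuous {r} F x P Q a t≥1 Q≤P above = 1 , λ n n≥1 𝔊 md → ⊥-elim (absurd n n≥1 𝔊 md)
    where
    absurd : (n : ℕ) → n ≥ 1 → (𝔊 : Collection (edgeCount F * n) (r * n)) → (∀ i → MinDegAtLeast (𝔊 i) (x ℚ.* ℕ→ℚ (r * n))) → ⊥
    absurd n n≥1 𝔊 md = contradiction chain (<⇒≱ (s≤s (≤-refl {5 + P})))
      where
      i = element (*-mono-≤ t≥1 n≥1)
      rn≥1 : 1 ≤ r * n
      rn≥1 = *-mono-≤ (inhabited a) n≥1
      v = element rn≥1
      deg≤ : deg (𝔊 i) v ≤ r * n
      deg≤ = ≤-trans (≤-reflexive (count≡cnt (Graph.adj (𝔊 i) v) id)) (≤-trans (cnt≤length (Graph.adj (𝔊 i) v) (allFin (r * n))) (≤-reflexive (length-tabulate id)))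
      chain : 6 + P ≤ 5 + P
      chain = ≤-trans (cancelˡ (r * n) rn≥1 (begin
        r * n * (6 + P) ≡⟨ *-comm (r * n) (6 + P) ⟩
        (6 + P) * (r * n) ≤⟨ Rationals.degree-ℕ (6 + P) Q x (r * n) (deg (𝔊 i) v) above (md i v) ⟩
        Q * deg (𝔊 i) v ≤⟨ *-mono-≤ Q≤P deg≤ ⟩
        P * (r * n) ≡⟨ *-comm P (r * n) ⟩
        r * n * P ∎)) (m≤n+m P 5)
        where open ≤-Reasoning

  -- The least number 2 + k of colours for which 1 − 1/(2 + k) exceeds c = P/Q.
  part-number : ∀ P Q → P < Q → ∃[ k ] (suc (suc k) * P < suc k * Q) × (suc k * Q ≤ suc k * P + Q)
  part-number P Q P<Q = go Q 0 refl (m≤n⇒m≤o+n (1 * P) (≤-reflexive (*-identityˡ Q)))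
    where
    -- `k = Q` always qualifies, so a search with fuel `Q` succeeds.
    top : suc (suc Q) * P < suc Q * Q
    top = by-lin 1 (*-monoʳ-≤ (2 + Q) P<Q) (e₁ P Q)
      where
      e₁ : ∀ P Q → suc (suc (suc Q) * P) + (2 + Q) * Q + 1 ≡ suc Q * Q + (2 + Q) * suc P
      e₁ = solve-∀
    go : ∀ fuel k → k + fuel ≡ Q → suc k * Q ≤ suc k * P + Q → ∃[ k ] (suc (suc k) * P < suc k * Q) × (suc k * Q ≤ suc k * P + Q)
    go zero k e inv = k , subst (λ z → suc (suc z) * P < suc z * Q) (sym (trans (sym (+-identityʳ k)) e)) top , inv
    go (suc fuel) k e inv with suc (suc k) * P <? suc k * Q
    ... | yes lt = k , lt , inv
    ... | no nlt = go fuel (suc k) (trans (sym (+-suc k fuel)) e) (≤-trans (≤-reflexive (+-comm Q (suc k * Q))) (+-monoˡ-≤ Q (≮⇒≥ nlt)))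

  transversal-factor : (r : ℕ) (F : Graph r) (c ε : ℚ) → δT≤ F c → 0ℚ ℚ.< ε → Conclusion F (c ℚ.+ ε)
  transversal-factor r F c ε (adm , bridge⊎half) ε>0 = start (EdgeList.es (edgeList F)) refl
    where
    module EL = EdgeList (edgeList F)
    open Threshold F c adm
    X : Set
    X = Conclusion F (c ℚ.+ ε)

    module Scaled (e₁ : Fin r × Fin r) (e₁∈ : e₁ ∈ EL.es) (P Q : ℕ) (Q≥1 : 1 ≤ Q) (cQ : ℕ→ℚ Q ℚ.* c ≡ ℕ→ℚ P)
      (above : ℕ→ℚ (6 + P) ℚ.≤ ℕ→ℚ Q ℚ.* (c ℚ.+ ε)) (n₀ : ℕ) (box : FactorsAbove F (suc P) Q n₀) where

      M : ℕ
      M = 8 * Q * (2 * Q * (2 * Q))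
      2Q≥1 : 1 ≤ 2 * Q
      2Q≥1 = ≤-trans Q≥1 (m≤m+n Q (Q + 0))
      M≥1 : 1 ≤ M
      M≥1 = *-mono-≤ (≤-trans Q≥1 (m≤m+n Q (7 * Q))) (*-mono-≤ 2Q≥1 2Q≥1)
      r≥1 : 1 ≤ r
      r≥1 = inhabited (proj₁ e₁)
      t≥1 : 1 ≤ edgeCount F
      t≥1 = ≤-trans (nonempty e₁∈) (≤-reflexive EL.len)
        where
        nonempty : ∀ {A : Set} {x : A} {xs} → x ∈ xs → 1 ≤ length xs
        nonempty (here _) = s≤s z≤n
        nonempty (there _) = s≤s z≤n

      conclude : ∀ e₀ EF′ → EL.es ↭ e₀ ∷ EF′ → ∀ needK → (needK ≡ true → Q ≤ 2 * P) → ∀ nE₁ nE₂ →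
        Extends needK P Q M nE₁ e₀ EF′ → Extends needK P Q Q nE₂ e₀ EF′ → X
      conclude e₀ EF′ p needK half nE₁ nE₂ x₁ x₂ = Conclude.conclusion F (c ℚ.+ ε) P Q Q≥1 above n₀ box e₀ EF′ p needK half nE₁ nE₂ x₁ x₂

      -- `2 + k` parts are right from both ends: `c < 1 - 1 / (2 + k)` makes F colourable with
      -- `2 + k` colours, and `c ≥ 1 - 1 / (1 + k)` provides blow-ups with that many parts.
      dense-case : Q ≤ 2 * P → P < Q → X
      dense-case half P<Q = go (part-number P Q P<Q) (∈⇒↭ e₁∈)
        where
        go : (∃[ k ] (suc (suc k) * P < suc k * Q) × (suc k * Q ≤ suc k * P + Q)) → (∃[ EF′ ] EL.es ↭ e₁ ∷ EF′) → X
        go (k , lt , le) (EF′ , p) = paint (colouring F c adm P Q (suc k) r≥1 Q≥1 cQ lt)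
          where
          paint : (Σ (Fin r → Fin (2 + k)) λ col → (∀ a b → Graph.adj F a b ≡ true → col a ≢ col b)) → X
          paint (col , proper) = conclude e₁ EF′ p true (λ _ → half) (blowBound Q M k r) (blowBound Q Q k r) (ext M M≥1) (ext Q Q≥1)
            where
            ext : ∀ M → 1 ≤ M → Extends true P Q M (blowBound Q M k r) e₁ EF′
            ext M M≥1 = extends-partite P Q M k e₁ EF′ col r≥1 M≥1 Q≥1 (<⇒≤ P<Q) le (proper _ _ (EL.sound e₁∈))
              (λ e∈ → proper _ _ (EL.sound (∈-resp-↭ (↭-sym p) (there e∈))))

      -- Below 1/2 the balanced complete bipartite graph has to contain F, so F is bipartite and
      -- `extends-bridge` applies.
      sparse-case : 2 * P < Q → BridgeSide F → X
      sparse-case lt br = paint (colouring F c adm P Q 1 r≥1 Q≥1 cQ (≤-trans lt (≤-reflexive (sym (*-identityˡ Q)))))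
        where
        isZero : Fin 2 → Bool
        isZero Fin.zero = true
        isZero (Fin.suc _) = false
        isZero-≢ : ∀ i j → i ≢ j → isZero i ≡ not (isZero j)
        isZero-≢ Fin.zero Fin.zero ne = contradiction refl ne
        isZero-≢ Fin.zero (Fin.suc Fin.zero) _ = refl
        isZero-≢ (Fin.suc Fin.zero) Fin.zero _ = refl
        isZero-≢ (Fin.suc Fin.zero) (Fin.suc Fin.zero) ne = contradiction refl ne
        module _ (col : Fin r → Fin 2) (proper : ∀ a b → Graph.adj F a b ≡ true → col a ≢ col b) where
          -- The edge list stores the ends in increasing order, so a bridge given the other way
          -- round enters reversed and with the complementary side.
          oriented : ∀ x y (side : Fin r → Bool) → side x ≡ true → side y ≡ false → (x , y) ∈ EL.es →
            (∀ a b → Graph.adj F a b ≡ true → toℕ a < toℕ b → ¬ ((a ≡ x) × (b ≡ y)) → side a ≡ side b) → X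
          oriented x y side sx sy xy∈ same = go (∈⇒↭ xy∈)
            where
            go : (∃[ EF′ ] EL.es ↭ (x , y) ∷ EF′) → X
            go (EF′ , p) = conclude (x , y) EF′ p false (λ ()) (bridgeBound Q M r) (bridgeBound Q Q r) (ext M M≥1) (ext Q Q≥1)
              where
              old : ∀ {e} → e ∈ EF′ → e ∈ EL.es
              old e∈ = ∈-resp-↭ (↭-sym p) (there e∈)
              new : ∀ {a b} → (a , b) ∈ EF′ → ¬ ((a ≡ x) × (b ≡ y))
              new e∈ (refl , refl) = Unique[x∷xs]⇒x∉xs (Unique-↭ p EL.unique) e∈
              ext : ∀ M → 1 ≤ M → Extends false P Q M (bridgeBound Q M r) (x , y) EF′
              ext M M≥1 = extends-bridge P Q M (x , y) EF′ (λ v → isZero (col v)) side r≥1 M≥1 Q≥1 sx sy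
                (λ {e} e∈ → same (proj₁ e) (proj₂ e) (EL.sound (old e∈)) (EL.sorted (old e∈)) (new e∈))
                (λ {e} e∈ → isZero-≢ (col (proj₁ e)) (col (proj₂ e)) (proper (proj₁ e) (proj₂ e) (EL.sound (old e∈))))
          open BridgeSide br
          choose : toℕ x < toℕ y ⊎ toℕ y < toℕ x ⊎ x ≡ y → X
          choose (inj₁ l) = oriented x y side side-x side-y (EL.complete l xy)
                (λ a b ab sab n → same a b ab n λ { (refl , refl) → contradiction l (<⇒≯ sab) })
          choose (inj₂ (inj₁ l)) = oriented y x (λ v → not (side v)) (cong not side-y) (cong not side-x) (EL.complete l (trans (Graph.sym F y x) xy))
                (λ a b ab sab n → cong not (same a b ab (λ { (refl , refl) → contradiction l (<⇒≯ sab) }) n))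
          choose (inj₂ (inj₂ e)) = ⊥-elim (true≢false (trans (sym xy) (trans (cong (Graph.adj F x) (sym e)) (Graph.irrfl F x))))
        paint : (Σ (Fin r → Fin 2) λ col → (∀ a b → Graph.adj F a b ≡ true → col a ≢ col b)) → X
        paint (col , proper) = choose col proper (toℕ-cmp (BridgeSide.x br) (BridgeSide.y br))

      cases : Dec (Q ≤ 2 * P) → Dec (P < Q) → HasBridge F ⊎ (ℚ.½ ℚ.≤ c) → X
      cases (yes half) (yes P<Q) _ = dense-case half P<Q
      cases (yes _) (no P≮Q) _ = vacuous F (c ℚ.+ ε) P Q (proj₁ e₁) t≥1 (≮⇒≥ P≮Q) above
      cases (no nle) _ (inj₁ b) = sparse-case (≰⇒> nle) (bridgeSide F b)
      cases (no nle) _ (inj₂ h) = contradiction (Rationals.half≤ c P Q cQ h) nle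

    scaled : ∀ e₁ → e₁ ∈ EL.es → (∃[ P ] ∃[ Q ] (1 ≤ Q) × (ℕ→ℚ Q ℚ.* c ≡ ℕ→ℚ P) × (ℕ→ℚ (6 + P) ℚ.≤ ℕ→ℚ Q ℚ.* (c ℚ.+ ε))) → X
    scaled e₁ e₁∈ (P , Q , Q≥1 , cQ , above) = go (factors P Q Q≥1 cQ)
      where
      go : (∃[ n₀ ] FactorsAbove F (suc P) Q n₀) → X
      go (n₀ , box) = Scaled.cases e₁ e₁∈ P Q Q≥1 cQ above n₀ box (Q ≤? 2 * P) (P <? Q) bridge⊎half

    start : ∀ xs → EL.es ≡ xs → X
    start [] eq = edgeless F (c ℚ.+ ε) eq
    start (e₁ ∷ xs) eq = go (nonneg (EL.sound e₁∈))
      where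
      e₁∈ : e₁ ∈ EL.es
      e₁∈ = subst (e₁ ∈_) (sym eq) (here refl)
      go : (∃[ p ] ∃[ d ] (1 ≤ d) × (ℕ→ℚ d ℚ.* c ≡ ℕ→ℚ p)) → X
      go (p , d , d≥1 , ec) = scaled e₁ e₁∈ (Rationals.common-scale c ε p d d≥1 ec ε>0)

open import Defs
open import Data.Nat using (ℕ; _*_; _≥_)
open import Data.Product using (∃-syntax; _×_)
open import Data.Rational using (ℚ; 0ℚ; _<_; _+_)

theorem1p2 : (r : ℕ) (F : Graph r) (c ε : ℚ) → δT≤ F c → 0ℚ < ε →
    ∃[ n₀ ] ((n : ℕ) → n ≥ n₀ → (𝔊 : Collection (edgeCount F * n) (r * n)) →
    (∀ i → MinDegAtLeast (𝔊 i) ((c + ε) Data.Rational.* ℕ→ℚ (r * n))) →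
    ∃[ H ] (IsTransversal 𝔊 H × IsFactor F H))
theorem1p2 = Development.transversal-factor
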